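{- Let $\lambda$ be a partition of $n$ and let $d>1$ be an integer. Let $\kappa_d^\lambda$ be the $d$th cumulant of the random variable $\mathrm{maj}(T)$, where $T$ is chosen uniformly at random from the set $\mathrm{SYT}(\lambda)$ of standard Young tableaux of shape $\lambda$. Then $$\kappa_d^\lambda = \frac{B_d}{d}\left[\sum_{j=1}^n j^d - \sum_{c\in\lambda} h_c^d\right],$$ where $B_d$ is the $d$th Bernoulli number and $h_c$ is the hook length of the cell $c$ of $\lambda$.
   Context: Diagrams are drawn in English notation (row 1 at the top). A standard Young tableau of shape $\lambda\vdash n$ is a bijective filling of the cells of $\lambda$ with $1,\ldots,n$ increasing to the right along rows and downward along columns. An integer $i\in\{1,\dots,n-1\}$ is a descent of $T$ if $i+1$ lies in a strictly lower row of $T$ than $i$; $\mathrm{maj}(T)$ is the sum of the descents of $T$. The hook length $h_c$ of a cell $c$ is the number of cells of $\lambda$ in the same row as $c$ to its right, or in the same column as $c$ below it, including $c$ itself once. The sum over $c\in\lambda$ is over all cells of the Young diagram. The cumulants $\kappa_1,\kappa_2,\ldots$ of a random variable $X$ are defined by $\sum_{d\ge1}\kappa_d\, t^d/d! = \log \mathbb{E}[e^{tX}]$. The Bernoulli numbers are defined by $\sum_{d\ge0}B_d\,t^d/d! = t/(1-e^{ -t})$, so $B_0,B_1,B_2,\ldots = 1,\tfrac12,\tfrac16,0,-\tfrac1{30},0,\tfrac1{42},0,\ldots$. -}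

module Defs where

open import Data.Fin.Base using (Fin; toℕ)
import Data.Fin.Properties as Fin
open import Data.Integer.Base using (+_)
open import Data.List.Base
  using (List; []; _∷_; [_]; allFin; applyUpTo; cartesianProductWith; concatMap; filter; foldr; length; lookup; map)
open import Data.List.Membership.Propositional.Properties using (∈-lookup)
open import Data.List.Relation.Unary.All as All using (All; []; _∷_)
open import Data.List.Relation.Unary.Linked using (Linked)
open import Data.Nat.Base as ℕ using (ℕ; zero; suc; _<_; _≤_; _≥_; _∸_; _!; NonZero)
open import Data.Nat.ListAction using (sum)
import Data.Nat.Properties as ℕ
open import Data.Product.Base using (Σ; ∃; ∃₂; _×_; _,_; curry; uncurry; proj₁; proj₂)
import Data.Product.Properties as Product
open import Data.Rational.Base
  using (ℚ; 0ℚ; 1ℚ; _/_; _+_; _*_; _-_; -_; +-*-rawSemiring)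
open import Data.Rational.Properties using (+-0-monoid)
open import Data.Sum.Base using (_⊎_)
open import Data.Vec.Base as Vec using (Vec; []; _∷_)
open import Function.Base using (_∘_)
open import Function.Consequences.Propositional using (strictlySurjective⇒surjective; surjective⇒strictlySurjective)
open import Function.Definitions using (Bijective)
open import Relation.Binary.PropositionalEquality using (_≡_)
open import Relation.Nullary using (Dec)
open import Relation.Nullary.Decidable using (map′; _×-dec_; _⊎-dec_; _→-dec_)
open import Relation.Unary using (Pred; Decidable)

open import Algebra.Definitions.RawSemiring +-*-rawSemiring using (_^_) public
open import Algebra.Properties.Monoid.Sum +-0-monoid using (sum⁺-syntax) public

fromℕ : ℕ → ℚ
fromℕ n = + n / 1

1/ℕ : (n : ℕ) .{{_ : NonZero n}} → ℚ
1/ℕ n = + 1 / n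

------------------------------------------------------------------------
-- Formal power series over ℚ; f n is the coefficient of tⁿ in f(t)

Series : Set
Series = ℕ → ℚ

1ₛ : Series
1ₛ zero    = 1ℚ
1ₛ (suc _) = 0ℚ

_-ₛ_ : Series → Series → Series
(f -ₛ g) n = f n - g n

_*ₛ_ : Series → Series → Series
(f *ₛ g) n = ∑[ i ≤ n ] (f (toℕ i) * g (n ∸ toℕ i))

_^ₛ_ : Series → ℕ → Series
f ^ₛ zero  = 1ₛ
f ^ₛ suc k = f *ₛ (f ^ₛ k)

-- g ∘ₛ f is g(f(t)), for f with zero constant term: fᵏ then only has
-- terms of degree ≥ k, so that k ≤ n suffices for the coefficient of tⁿ.
_∘ₛ_ : Series → Series → Series
(g ∘ₛ f) n = ∑[ k ≤ n ] (g (toℕ k) * (f ^ₛ toℕ k) n)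

-- log(1 + t)
log1+ : Series
log1+ zero    = 0ℚ
log1+ (suc k) = (- 1ℚ) ^ k * 1/ℕ (suc k)

-- 1/(1 - t)
geometric : Series
geometric _ = 1ℚ

-- logₛ and invₛ are meant for series with constant term 1.
logₛ : Series → Series
logₛ f = log1+ ∘ₛ (f -ₛ 1ₛ)

invₛ : Series → Series
invₛ f = geometric ∘ₛ (1ₛ -ₛ f)

-- exp x is e^(xt)
exp : ℚ → Series
exp x d = x ^ d * 1/ℕ (d !) {{d ℕ.!≢0}}

-- The series invₛ is applied to is (1 - e⁻ᵗ)/t: its argument is shifted by
-- one because 1 - e⁻ᵗ has no constant term.
bernoulli : ℕ → ℚ
bernoulli d = fromℕ (d !) * invₛ (λ k → (1ₛ -ₛ exp (- 1ℚ)) (suc k)) d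

------------------------------------------------------------------------
-- Random variables on a finite set, listed without repetition, with the
-- uniform distribution

-- The value on the empty list is a dummy; it plays no role for SYT, since
-- every partition has a standard tableau.
𝔼 : {A : Set} → List A → (A → ℚ) → ℚ
𝔼 []         X = 0ℚ
𝔼 ωs@(_ ∷ _) X = foldr _+_ 0ℚ (map X ωs) * 1/ℕ (length ωs)

-- E[e^(tX)], the expectation being taken coefficientwise.
mgf : {A : Set} → List A → (A → ℚ) → Series
mgf ωs X d = 𝔼 ωs (λ ω → exp (X ω) d)

cumulant : {A : Set} → List A → (A → ℚ) → ℕ → ℚ
cumulant ωs X d = fromℕ (d !) * logₛ (mgf ωs X) d

------------------------------------------------------------------------
-- Partitions and their Young diagrams

record Partition (n : ℕ) : Set where
  field
    parts      : List ℕ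
    decreasing : Linked _≥_ parts
    positive   : All (0 <_) parts
    sum-parts  : sum parts ≡ n

open Partition public

-- All vectors of length m, and all arrays with row lengths ms, with entries
-- from xs; no repetitions if xs has none.
vectors : {A : Set} → List A → (m : ℕ) → List (Vec A m)
vectors xs zero    = [ [] ]
vectors xs (suc m) = cartesianProductWith _∷_ xs (vectors xs m)

fillings : {A : Set} → List A → (ms : List ℕ) → List (All (Vec A) ms)
fillings xs []       = [ [] ]
fillings xs (m ∷ ms) = cartesianProductWith _∷_ (vectors xs m) (fillings xs ms)

module _ {n : ℕ} (μ : Partition n) where

  Cell : Set
  Cell = Σ (Fin (length (parts μ))) λ i → Fin (lookup (parts μ) i)

  cells : List Cell
  cells = concatMap (λ i → map (i ,_) (allFin _)) (allFin _)

  -- Rows are numbered from the top and columns from the left, from 0.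
  row col : Cell → ℕ
  row = toℕ ∘ proj₁
  col = toℕ ∘ proj₂

  ∀-cell? : ∀ {p} {P : Pred Cell p} → Decidable P → Dec (∀ c → P c)
  ∀-cell? P? = map′ uncurry curry (Fin.all? λ i → Fin.all? λ j → P? (i , j))

  ∃-cell? : ∀ {p} {P : Pred Cell p} → Decidable P → Dec (∃ P)
  ∃-cell? P? = map′ (λ (i , j , p) → (i , j) , p) (λ ((i , j) , p) → i , j , p)
                    (Fin.any? λ i → Fin.any? λ j → P? (i , j))

  ∀-cells? : {P : Cell → Cell → Set} → (∀ c c′ → Dec (P c c′)) → Dec (∀ c c′ → P c c′)
  ∀-cells? P? = ∀-cell? λ c → ∀-cell? (P? c)

  Hook : Cell → Pred Cell _
  Hook c c′ = (row c′ ≡ row c × col c ≤ col c′) ⊎ (col c′ ≡ col c × row c ≤ row c′)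

  hook? : ∀ c → Decidable (Hook c)
  hook? c c′ = (row c′ ℕ.≟ row c ×-dec col c ℕ.≤? col c′)
         ⊎-dec (col c′ ℕ.≟ col c ×-dec row c ℕ.≤? row c′)

  hookLength : Cell → ℕ
  hookLength c = length (filter (hook? c) cells)

------------------------------------------------------------------------
-- Standard Young tableaux

  -- One vector of entries per row. An element k of Fin n stands for the
  -- number k + 1 (see label).
  Filling : Set
  Filling = All (Vec (Fin n)) (parts μ)

  entry : Filling → Cell → Fin n
  entry T (i , j) = Vec.lookup (All.lookup T (∈-lookup i)) j

  label : Filling → Cell → ℕ
  label T c = suc (toℕ (entry T c))

  record Standard (T : Filling) : Set where
    field
      bijective  : Bijective _≡_ _≡_ (entry T)
      rightwards : ∀ c c′ → row c ≡ row c′ → col c < col c′ → label T c < label T c′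
      downwards  : ∀ c c′ → col c ≡ col c′ → row c < row c′ → label T c < label T c′

  standard? : Decidable Standard
  standard? T = map′
    (λ ((inj , sur) , r , d) → record
      { bijective  = (λ {c} {c′} → inj c c′) , strictlySurjective⇒surjective sur
      ; rightwards = r
      ; downwards  = d
      })
    (λ std → let open Standard std in
      ((λ _ _ → proj₁ bijective) , surjective⇒strictlySurjective (proj₂ bijective))
      , rightwards , downwards)
    ((∀-cells? (λ c c′ → entry T c Fin.≟ entry T c′ →-dec Product.≡-dec Fin._≟_ Fin._≟_ c c′)
      ×-dec Fin.all? (λ k → ∃-cell? λ c → entry T c Fin.≟ k))
     ×-dec ∀-cells? (λ c c′ → row c ℕ.≟ row c′ →-dec
                              (col c ℕ.<? col c′ →-dec label T c ℕ.<? label T c′))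
     ×-dec ∀-cells? (λ c c′ → col c ℕ.≟ col c′ →-dec
                              (row c ℕ.<? row c′ →-dec label T c ℕ.<? label T c′)))

  SYT : List Filling
  SYT = filter standard? (fillings (allFin n) (parts μ))

  Descent : Filling → Pred ℕ _
  Descent T i = ∃₂ λ c c′ → label T c ≡ i × label T c′ ≡ suc i × row c < row c′

  descent? : ∀ T → Decidable (Descent T)
  descent? T i = ∃-cell? λ c → ∃-cell? λ c′ →
    label T c ℕ.≟ i ×-dec label T c′ ℕ.≟ suc i ×-dec row c ℕ.<? row c′

  maj : Filling → ℕ
  maj T = sum (filter (descent? T) (applyUpTo suc (n ∸ 1)))

module Submission where

-- Let x_i = q^(λ_i + ℓ - i) for a partition λ with ℓ rows. Reading off the rows
-- of n, n - 1, ..., 1 in a standard tableau turns SYT(λ) into words that are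
-- built by removing corners, and maj into a statistic of these words. Let
-- N(λ, s) be the generating function of maj after adding a cell n + 1 in row s.
-- Then N(λ, r) - N(λ, r + 1) is (1 - qⁿ) N(λ - e_r, r) if r is a corner and 0
-- otherwise, and N(λ, ℓ) = qⁿ N(λ, 0). Up to the factor ∏ (q; q)_(λ_i + ℓ - i),
-- the same recurrences are satisfied by the alternating sums of the
-- Vandermonde products obtained from x by decreasing some of the first r
-- entries of λ; the sum over all subsets of rows is evaluated by regarding it
-- as a polynomial in one x_i. This gives
--   (∑_T q^(maj T)) ∏_c (1 - q^(h_c)) = q^b ∏_(j ≤ n) (1 - q^j),
-- where b is the difference of two exponents that are kept on separate sides.
-- For q = eᵗ, the logarithmic derivative t f'/f of 1 - e^(ht) is the series of
-- ht/(1 - e^(-ht)), and comparing coefficients of t^d gives the cumulants.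

-- The recurrences only link neighbouring rows and λ to λ - e_r, so the induction carries all rows
-- at once; the system is closed by the passage from row ℓ back to row 0, where the factor qⁿ forces
-- the difference of the two sides to vanish because 1 - qⁿ is not a zero divisor. Decreasing row i
-- turns x_i into x_i / q. To stay clear of q⁻¹, every variable is multiplied by q: an unchanged row
-- carries q x_i and a decreased one x_i. The hook formula is proved in any commutative ring where
-- powers of q and differences of distinct powers are non-zero-divisors, and is then applied
-- directly to q = eᵗ in ℚ[[t]]. A factor 1 - e^(ht) has constant term 0 and hence no logarithm as a
-- power series. Logarithmic derivatives are therefore handled through the equation t f' = f l,
-- which determines l whenever f can be cancelled. The powers of q only contribute multiples of t to
-- l; they shift the mean and are invisible for d > 1.

module RingSolving where

  open import Level using (0ℓ)
  open import Algebra.Bundles using (CommutativeRing; RawRing)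
  open import Data.Maybe.Base using (Maybe; just; nothing)
  open import Data.Nat.Base as ℕ using (ℕ; zero; suc; _∸_)
  import Data.Nat.Properties as ℕ
  open import Data.Product.Base using (_×_; _,_)
  open import Relation.Binary.PropositionalEquality as ≡ using (_≡_)
  open import Relation.Nullary using (yes; no)

  -- The solver of the standard library only decides identities in which
  -- cancellation is visible in the coefficients, so these are formal
  -- differences a - b of naturals.
  module IntegralRingSolver (R : CommutativeRing 0ℓ 0ℓ) where
    open CommutativeRing R
    open import Algebra.Solver.Ring.AlmostCommutativeRing
      using (fromCommutativeRing; _-Raw-AlmostCommutative⟶_; Induced-equivalence)
    open import Algebra.Properties.Ring ring using (-‿distribˡ-*; -‿distribʳ-*)
    open import Algebra.Properties.AbelianGroup +-abelianGroup using (⁻¹-∙-comm; ⁻¹-involutive; ε⁻¹≈ε; x∙y⁻¹≈ε⇒x≈y)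
    open import Algebra.Properties.Semiring.Mult semiring renaming (_×_ to _·_) using (×-homo-+; ×1-homo-*)
    open import Algebra.Properties.Semiring.Mult.TCOptimised semiring renaming (_×_ to _·′_) using (×ᵤ≈×)
    open import Algebra.Properties.CommutativeSemigroup +-commutativeSemigroup using (interchange)
    open import Relation.Binary.Reasoning.Setoid setoid

    -- Reduced, since the solver compares coefficients by normalisation.
    reduce : ℕ × ℕ → ℕ × ℕ
    reduce (a , b) = a ∸ b , b ∸ a

    Coefficient : RawRing 0ℓ 0ℓ
    Coefficient = record
      { Carrier = ℕ × ℕ
      ; _≈_     = _≡_
      ; _+_     = λ (a , b) (c , d) → reduce (a ℕ.+ c , b ℕ.+ d)
      ; _*_     = λ (a , b) (c , d) → reduce (a ℕ.* c ℕ.+ b ℕ.* d , a ℕ.* d ℕ.+ b ℕ.* c)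
      ; -_      = λ (a , b) → b , a
      ; 0#      = 0 , 0
      ; 1#      = 1 , 0
      }

    -- With the optimised multiple in the first clause, `con (0 , 0)` and `con (1 , 0)` evaluate to
    -- `0#` and `1#` by computation, so that solved equations match goals containing these
    -- constants.
    ⟦_⟧ : ℕ × ℕ → Carrier
    ⟦ a , zero  ⟧ = a ·′ 1#
    ⟦ a , suc b ⟧ = a · 1# - suc b · 1#

    ⟦⟧≈ : ∀ a b → ⟦ a , b ⟧ ≈ a · 1# - b · 1#
    ⟦⟧≈ a (suc b) = refl
    ⟦⟧≈ a zero    = begin
      a ·′ 1#      ≈⟨ ×ᵤ≈× a 1# ⟨
      a · 1#       ≈⟨ +-identityʳ _ ⟨
      a · 1# + 0#  ≈⟨ +-congˡ ε⁻¹≈ε ⟨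
      a · 1# - 0#  ∎

    private
      +-difference : ∀ a b c d → (a + c) - (b + d) ≈ (a - b) + (c - d)
      +-difference a b c d = begin
        (a + c) - (b + d)        ≈⟨ +-congˡ (⁻¹-∙-comm b d) ⟨
        (a + c) + (- b + - d)    ≈⟨ interchange a c (- b) (- d) ⟩
        (a - b) + (c - d)        ∎

      *-difference : ∀ a b c d → (a * c + b * d) - (a * d + b * c) ≈ (a - b) * (c - d)
      *-difference a b c d = sym (begin
        (a - b) * (c - d)                              ≈⟨ distribʳ _ a (- b) ⟩
        a * (c - d) + - b * (c - d)                    ≈⟨ +-cong (distribˡ a c (- d)) (distribˡ (- b) c (- d)) ⟩
        (a * c + a * - d) + (- b * c + - b * - d)      ≈⟨ +-cong (+-congˡ (sym (-‿distribʳ-* a d))) (trans (+-comm _ _) (+-cong lem (sym (-‿distribˡ-* b c)))) ⟩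
        (a * c + - (a * d)) + (b * d + - (b * c))      ≈⟨ +-difference (a * c) (a * d) (b * d) (b * c) ⟨
        (a * c + b * d) - (a * d + b * c)              ∎)
        where
        lem : - b * - d ≈ b * d
        lem = begin
          - b * - d      ≈⟨ -‿distribˡ-* b (- d) ⟨
          - (b * - d)    ≈⟨ -‿cong (-‿distribʳ-* b d) ⟨
          - - (b * d)    ≈⟨ ⁻¹-involutive _ ⟩
          b * d          ∎

      -‿difference : ∀ a b → b - a ≈ - (a - b)
      -‿difference a b = begin
        b - a            ≈⟨ +-comm b (- a) ⟩
        - a + b          ≈⟨ +-congˡ (⁻¹-involutive b) ⟨
        - a + - - b      ≈⟨ ⁻¹-∙-comm a (- b) ⟩
        - (a - b)        ∎

      product-·1 : ∀ a b c d → (a ℕ.* c ℕ.+ b ℕ.* d) · 1# ≈ (a · 1#) * (c · 1#) + (b · 1#) * (d · 1#)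
      product-·1 a b c d = trans (×-homo-+ 1# (a ℕ.* c) (b ℕ.* d)) (+-cong (×1-homo-* a c) (×1-homo-* b d))

      equal-difference : ∀ a b c d → a ℕ.+ d ≡ c ℕ.+ b → a · 1# - b · 1# ≈ c · 1# - d · 1#
      equal-difference a b c d eq = x∙y⁻¹≈ε⇒x≈y _ _ (begin
        (A - B) - (C - D)    ≈⟨ +-congˡ (-‿difference C D) ⟨
        (A - B) + (D - C)    ≈⟨ +-difference A B D C ⟨
        (A + D) - (B + C)    ≈⟨ +-cong sums≈ (-‿cong (+-comm B C)) ⟩
        (C + B) - (C + B)    ≈⟨ -‿inverseʳ _ ⟩
        0#                   ∎)
        where
        A = a · 1# ; B = b · 1# ; C = c · 1# ; D = d · 1#

        sums≈ : A + D ≈ C + B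
        sums≈ = trans (sym (×-homo-+ 1# a d)) (trans (reflexive (≡.cong (_· 1#) eq)) (×-homo-+ 1# c b))

      ∸-+-swap : ∀ a b → a ∸ b ℕ.+ b ≡ a ℕ.+ (b ∸ a)
      ∸-+-swap zero    zero    = ≡.refl
      ∸-+-swap (suc a) zero    = ≡.refl
      ∸-+-swap zero    (suc b) = ≡.refl
      ∸-+-swap (suc a) (suc b) = ≡.trans (ℕ.+-suc (a ∸ b) b) (≡.cong suc (∸-+-swap a b))

      ⟦reduce⟧≈ : ∀ a b → ⟦ reduce (a , b) ⟧ ≈ a · 1# - b · 1#
      ⟦reduce⟧≈ a b = trans (⟦⟧≈ (a ∸ b) (b ∸ a)) (equal-difference (a ∸ b) (b ∸ a) a b (∸-+-swap a b))

    homomorphism : Coefficient -Raw-AlmostCommutative⟶ fromCommutativeRing R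
    homomorphism = record
      { ⟦_⟧    = ⟦_⟧
      ; +-homo = λ (a , b) (c , d) → begin
          _                                                  ≈⟨ ⟦reduce⟧≈ (a ℕ.+ c) (b ℕ.+ d) ⟩
          (a ℕ.+ c) · 1# - (b ℕ.+ d) · 1#                    ≈⟨ +-cong (×-homo-+ 1# a c) (-‿cong (×-homo-+ 1# b d)) ⟩
          (a · 1# + c · 1#) - (b · 1# + d · 1#)              ≈⟨ +-difference _ _ _ _ ⟩
          (a · 1# - b · 1#) + (c · 1# - d · 1#)              ≈⟨ +-cong (⟦⟧≈ a b) (⟦⟧≈ c d) ⟨
          ⟦ a , b ⟧ + ⟦ c , d ⟧                              ∎
      ; *-homo = λ (a , b) (c , d) → begin
          _                                                  ≈⟨ ⟦reduce⟧≈ (a ℕ.* c ℕ.+ b ℕ.* d) (a ℕ.* d ℕ.+ b ℕ.* c) ⟩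
          _                                                  ≈⟨ +-cong (product-·1 a b c d) (-‿cong (product-·1 a b d c)) ⟩
          _                                                  ≈⟨ *-difference _ _ _ _ ⟩
          (a · 1# - b · 1#) * (c · 1# - d · 1#)              ≈⟨ *-cong (⟦⟧≈ a b) (⟦⟧≈ c d) ⟨
          ⟦ a , b ⟧ * ⟦ c , d ⟧                              ∎
      ; -‿homo = λ (a , b) → begin
          ⟦ b , a ⟧              ≈⟨ ⟦⟧≈ b a ⟩
          b · 1# - a · 1#        ≈⟨ -‿difference _ _ ⟩
          - (a · 1# - b · 1#)    ≈⟨ -‿cong (⟦⟧≈ a b) ⟨
          - ⟦ a , b ⟧            ∎
      ; 0-homo = refl
      ; 1-homo = refl
      }

    coefficient≟ : ∀ x y → Maybe (Induced-equivalence homomorphism x y)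
    coefficient≟ (a , b) (c , d) with a ℕ.+ d ℕ.≟ c ℕ.+ b
    ... | no  _  = nothing
    ... | yes eq = just (trans (⟦⟧≈ a b) (trans (equal-difference a b c d eq) (sym (⟦⟧≈ c d))))

    open import Algebra.Solver.Ring Coefficient (fromCommutativeRing R) homomorphism coefficient≟ public
      using (solve; _:=_; _:+_; _:*_; _:-_; :-_; con)

-- Partitions as lists of rows: words, beta numbers, hook lengths

module Shapes where

  open import Data.Bool.Base using (if_then_else_)
  open import Data.List.Base using (List; []; _∷_; [_]; _++_; map; concatMap; filter; length; upTo)
  open import Data.List.Properties using (filter-none; filter-accept)
  open import Data.List.Relation.Unary.All as All using (All; []; _∷_)
  open import Data.Nat.Base as ℕ using (ℕ; zero; suc; _+_; _∸_; _<_; _≤_; z≤n; s≤s; _<ᵇ_; pred)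
  open import Data.Nat.ListAction using (sum)
  open import Data.Nat.Properties
  open import Data.Product.Base using (_,_)
  open import Data.Empty using (⊥-elim)
  open import Relation.Binary.PropositionalEquality hiding ([_])
  open import Relation.Nullary using (yes; no)
  open import Relation.Unary using (Pred; Decidable)

  -- Partitions as lists of row lengths with a fixed number of rows, some of
  -- which may be 0; missing rows count as 0.

  nth : List ℕ → ℕ → ℕ
  nth []       _       = 0
  nth (a ∷ as) zero    = a
  nth (a ∷ as) (suc i) = nth as i

  Decreasing : List ℕ → Set
  Decreasing as = ∀ i → nth as (suc i) ≤ nth as i

  decrement : ℕ → List ℕ → List ℕ
  decrement _       []       = []
  decrement zero    (a ∷ as) = pred a ∷ as
  decrement (suc r) (a ∷ as) = a ∷ decrement r as

  Corner : List ℕ → Pred ℕ _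
  Corner as r = nth as (suc r) < nth as r

  corner? : ∀ as → Decidable (Corner as)
  corner? as r = nth as (suc r) ℕ.<? nth as r
    where import Data.Nat.Properties as ℕ

  -- The rows of n, ..., 1 in a standard tableau with n cells, in this order.
  words : ℕ → List ℕ → List (List ℕ)
  words zero    as = [ [] ]
  words (suc n) as =
    concatMap (λ r → map (r ∷_) (words n (decrement r as))) (filter (corner? as) (upTo (length as)))

  -- In `s ∷ r ∷ w` the two heads are the rows of the labels `length w + 2` and `length w + 1`, so
  -- `r < s` says that `suc (length w)` is a descent.
  majʷ : List ℕ → ℕ
  majʷ []          = 0
  majʷ (r ∷ [])    = 0
  majʷ (s ∷ r ∷ w) = majʷ (r ∷ w) + (if r <ᵇ s then suc (length w) else 0)

  -- The beta numbers λ_i + ℓ - i, which are the hook lengths of the first column when all rows are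
  -- nonempty.
  beta : List ℕ → List ℕ
  beta []       = []
  beta (a ∷ as) = a + length as ∷ beta as

  leg : List ℕ → ℕ → ℕ
  leg as j = length (filter (j <?_) as)

  -- For column j of the first row, `a ∸ j` counts the cell and its arm, and `leg as j` the rows
  -- below that reach column j.
  hooks : List ℕ → List ℕ
  hooks []       = []
  hooks (a ∷ as) = map (λ j → a ∸ j + leg as j) (upTo a) ++ hooks as

  decreasing-tail : ∀ {a as} → Decreasing (a ∷ as) → Decreasing as
  decreasing-tail dec i = dec (suc i)

  length-decrement : ∀ r as → length (decrement r as) ≡ length as
  length-decrement r       []       = refl
  length-decrement zero    (a ∷ as) = refl
  length-decrement (suc r) (a ∷ as) = cong suc (length-decrement r as)

  nth-decrement-≡ : ∀ r as → nth (decrement r as) r ≡ pred (nth as r)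
  nth-decrement-≡ r       []       = refl
  nth-decrement-≡ zero    (a ∷ as) = refl
  nth-decrement-≡ (suc r) (a ∷ as) = nth-decrement-≡ r as

  nth-decrement-≢ : ∀ r as i → i ≢ r → nth (decrement r as) i ≡ nth as i
  nth-decrement-≢ r       []       i       i≢r = refl
  nth-decrement-≢ zero    (a ∷ as) zero    i≢r = ⊥-elim (i≢r refl)
  nth-decrement-≢ zero    (a ∷ as) (suc i) i≢r = refl
  nth-decrement-≢ (suc r) (a ∷ as) zero    i≢r = refl
  nth-decrement-≢ (suc r) (a ∷ as) (suc i) i≢r = nth-decrement-≢ r as i (λ eq → i≢r (cong suc eq))

  nth-decrement-≤ : ∀ r as i → nth (decrement r as) i ≤ nth as i
  nth-decrement-≤ r       []       i       = z≤n
  nth-decrement-≤ zero    (a ∷ as) zero    = pred[n]≤n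
  nth-decrement-≤ zero    (a ∷ as) (suc i) = ≤-refl
  nth-decrement-≤ (suc r) (a ∷ as) zero    = ≤-refl
  nth-decrement-≤ (suc r) (a ∷ as) (suc i) = nth-decrement-≤ r as i

  decreasing-decrement : ∀ {as r} → Decreasing as → Corner as r → Decreasing (decrement r as)
  decreasing-decrement {as} {r} dec corner i with i ≟ r
  ... | yes refl = begin
    nth (decrement r as) (suc r)  ≤⟨ nth-decrement-≤ r as (suc r) ⟩
    nth as (suc r)                ≤⟨ <⇒≤pred corner ⟩
    pred (nth as r)               ≡⟨ nth-decrement-≡ r as ⟨
    nth (decrement r as) r        ∎
    where open ≤-Reasoning
  ... | no i≢r = begin
    nth (decrement r as) (suc i)  ≤⟨ nth-decrement-≤ r as (suc i) ⟩
    nth as (suc i)                ≤⟨ dec i ⟩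
    nth as i                      ≡⟨ nth-decrement-≢ r as i i≢r ⟨
    nth (decrement r as) i        ∎
    where open ≤-Reasoning

  sum-decrement : ∀ r as → 0 < nth as r → suc (sum (decrement r as)) ≡ sum as
  sum-decrement zero    (suc a ∷ as) 0<a = refl
  sum-decrement (suc r) (a ∷ as)     0<a =
    trans (sym (+-suc a _)) (cong (a +_) (sum-decrement r as 0<a))

  sum≡0⇒nth≡0 : ∀ as i → sum as ≡ 0 → nth as i ≡ 0
  sum≡0⇒nth≡0 []       i       eq = refl
  sum≡0⇒nth≡0 (a ∷ as) zero    eq = m+n≡0⇒m≡0 a eq
  sum≡0⇒nth≡0 (a ∷ as) (suc i) eq = sum≡0⇒nth≡0 as i (m+n≡0⇒n≡0 a eq)

  all≤head : ∀ as → Decreasing as → All (_≤ nth as 0) as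
  all≤head []       dec = []
  all≤head (a ∷ as) dec =
    ≤-refl ∷ All.map (λ m≤ → ≤-trans m≤ (dec 0)) (all≤head as (decreasing-tail dec))

  leg≡0 : ∀ as j → All (_≤ j) as → leg as j ≡ 0
  leg≡0 as j as≤j = cong length (filter-none (j <?_) (All.map ≤⇒≯ as≤j))

  leg-∷ : ∀ a as j → j < a → leg (a ∷ as) j ≡ suc (leg as j)
  leg-∷ a as j j<a = cong length (filter-accept (j <?_) j<a)

  -- The staircase ℓ - i turns weak decrease into strict decrease. This makes the variables q^(β_i)
  -- distinct and the exponents β_i - β_j positive.
  beta-< : ∀ a as → Decreasing (a ∷ as) → All (_< a + length as) (beta as)
  beta-< a []       dec = []
  beta-< a (b ∷ bs) dec =
    subst (b + length bs <_) (sym (+-suc a _)) (s≤s (+-monoˡ-≤ (length bs) (dec 0)))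
    ∷ All.map (λ m< → <-≤-trans m< (+-mono-≤ (dec 0) (n≤1+n _))) (beta-< b bs (decreasing-tail dec))

  length-beta : ∀ as → length (beta as) ≡ length as
  length-beta []       = refl
  length-beta (a ∷ as) = cong suc (length-beta as)

  -- 0 + 1 + ... + (n - 1). It occurs both as the sum of the staircase in the beta numbers and as
  -- the number of pairs of variables in a Vandermonde product.
  triangular : ℕ → ℕ
  triangular zero    = 0
  triangular (suc n) = n + triangular n

  sum-beta : ∀ as → sum (beta as) ≡ sum as + triangular (length as)
  sum-beta []       = refl
  sum-beta (a ∷ as) = begin
    (a + length as) + sum (beta as)                       ≡⟨ cong (a + length as +_) (sum-beta as) ⟩
    (a + length as) + (sum as + triangular (length as))   ≡⟨ solve 4 (λ a l s t → (a :+ l) :+ (s :+ t) := (a :+ s) :+ (l :+ t)) refl a _ (sum as) _ ⟩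
    (a + sum as) + (length as + triangular (length as))   ∎
    where
    open ≡-Reasoning
    open import Data.Nat.Solver
    open +-*-Solver

-- Polynomial functions and sums of shifted Vandermonde products

module ShiftedVandermondes where

  open import Level using (0ℓ)
  open import Algebra.Bundles using (CommutativeRing)
  open import Data.List.Base using (List; []; _∷_; length)
  open import Data.List.Membership.Propositional using (_∈_)
  open import Data.List.Relation.Unary.All as All using (All; []; _∷_)
  open import Data.List.Relation.Unary.AllPairs using (AllPairs; []; _∷_)
  open import Data.List.Relation.Unary.Any using (here; there)
  open import Data.Nat.Base as ℕ using (ℕ; zero; suc)
  open import Data.Product.Base using (Σ; _×_; _,_)
  open import Relation.Binary.PropositionalEquality as ≡ using (_≡_)
  open RingSolving
  open Shapes

  module DividedDifferences (R : CommutativeRing 0ℓ 0ℓ) where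
    open CommutativeRing R hiding (zero)
    open IntegralRingSolver R
    open import Algebra.Properties.Semiring.Exp semiring using (_^_)
    open import Relation.Binary.Reasoning.Setoid setoid

    -- Asking for non-zero-divisors among the elements that actually occur takes the place of
    -- assuming an integral domain.
    Cancellable : Carrier → Set
    Cancellable a = ∀ x → a * x ≈ 0# → x ≈ 0#

    ∏ : {A : Set} → (A → Carrier) → List A → Carrier
    ∏ f []       = 1#
    ∏ f (x ∷ xs) = f x * ∏ f xs

    ∏-cong : {A : Set} {f g : A → Carrier} (xs : List A) → (∀ x → f x ≈ g x) → ∏ f xs ≈ ∏ g xs
    ∏-cong []       f≈g = refl
    ∏-cong (x ∷ xs) f≈g = *-cong (f≈g x) (∏-cong xs f≈g)

    ∏-* : {A : Set} (f g : A → Carrier) (xs : List A) → ∏ (λ x → f x * g x) xs ≈ ∏ f xs * ∏ g xs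
    ∏-* f g []       = sym (*-identityˡ 1#)
    ∏-* f g (x ∷ xs) = trans (*-congˡ (∏-* f g xs))
      (solve 4 (λ a b c d → (a :* b) :* (c :* d) := (a :* c) :* (b :* d)) refl _ _ _ _)

    ∏-1 : {A : Set} (xs : List A) → ∏ (λ _ → 1#) xs ≈ 1#
    ∏-1 []       = refl
    ∏-1 (x ∷ xs) = trans (*-identityˡ _) (∏-1 xs)

    -- p is a polynomial function of degree ≤ m whose coefficient of (-z)ᵐ is c.
    IsPolynomial : ℕ → Carrier → (Carrier → Carrier) → Set
    IsPolynomial zero    c p = ∀ z → p z ≈ c
    IsPolynomial (suc m) c p =
      ∀ a → Σ (Carrier → Carrier) λ g → IsPolynomial m c g × (∀ z → p z ≈ p a + (a - z) * g z)

    polynomial-cong : ∀ m {c c′ p p′} → c ≈ c′ → (∀ z → p z ≈ p′ z) →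
                      IsPolynomial m c p → IsPolynomial m c′ p′
    polynomial-cong zero    c≈ p≈ pol z = trans (sym (p≈ z)) (trans (pol z) c≈)
    polynomial-cong (suc m) c≈ p≈ pol a with pol a
    ... | g , polg , eq = g , polynomial-cong m c≈ (λ _ → refl) polg
                        , λ z → trans (sym (p≈ z)) (trans (eq z) (+-congʳ (p≈ a)))

    polynomial-+ : ∀ m {c c′ p p′} → IsPolynomial m c p → IsPolynomial m c′ p′ →
                   IsPolynomial m (c + c′) (λ z → p z + p′ z)
    polynomial-+ zero    pol pol′ z = +-cong (pol z) (pol′ z)
    polynomial-+ (suc m) pol pol′ a with pol a | pol′ a
    ... | g , polg , eq | g′ , polg′ , eq′ = _ , polynomial-+ m polg polg′
      , λ z → trans (+-cong (eq z) (eq′ z))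
          (solve 5 (λ x d u y v → (x :+ d :* u) :+ (y :+ d :* v) := (x :+ y) :+ d :* (u :+ v)) refl _ _ _ _ _)

    polynomial-* : ∀ m b {c p} → IsPolynomial m c p → IsPolynomial m (b * c) (λ z → b * p z)
    polynomial-* zero    b pol z = *-congˡ (pol z)
    polynomial-* (suc m) b pol a with pol a
    ... | g , polg , eq = _ , polynomial-* m b polg
      , λ z → trans (*-congˡ (eq z))
          (solve 4 (λ b x d u → b :* (x :+ d :* u) := b :* x :+ d :* (b :* u)) refl _ _ _ _)

    polynomial-raise : ∀ m {c p} → IsPolynomial m c p → IsPolynomial (suc m) 0# p
    polynomial-raise zero    pol a = (λ _ → 0#) , (λ _ → refl)
      , λ z → trans (pol z) (trans (sym (pol a)) (solve 2 (λ x d → x := x :+ d :* con (0 , 0)) refl _ _))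
    polynomial-raise (suc m) pol a with pol a
    ... | g , polg , eq = g , polynomial-raise m polg , eq

    -- Since leading coefficients refer to (-z)ᵐ, the factor b - z leaves c unchanged. If g is the
    -- divided difference of p at a, then that of the product is p z + (b - a) g z; its second
    -- summand has lower degree and is raised to match.
    polynomial-linear : ∀ m b {c p} → IsPolynomial m c p → IsPolynomial (suc m) c (λ z → (b - z) * p z)
    polynomial-linear zero    b {c} pol a = (λ _ → c) , (λ _ → refl)
      , λ z → trans (*-congˡ (pol z)) (trans
          (solve 4 (λ a b z c → (b :- z) :* c := (b :- a) :* c :+ (a :- z) :* c) refl _ _ _ _)
          (+-congʳ (*-congˡ (sym (pol a)))))
    polynomial-linear (suc m) b {c} {p} pol a with pol a
    ... | g , polg , eq = (λ z → p z + (b - a) * g z)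
      , polynomial-cong (suc m) (+-identityʳ c) (λ _ → refl)
          (polynomial-+ (suc m) pol (polynomial-raise m (polynomial-* m (b - a) polg)))
      , λ z → trans (*-congˡ (eq z)) (trans
          (solve 5 (λ a b z x u → (b :- z) :* (x :+ (a :- z) :* u) :=
             (b :- a) :* x :+ (a :- z) :* ((x :+ (a :- z) :* u) :+ (b :- a) :* u)) refl _ _ _ _ _)
          (+-congˡ (*-congˡ (+-congʳ (sym (eq z))))))

    polynomial-scale : ∀ m b {c p} → IsPolynomial m c p → IsPolynomial m (b ^ m * c) (λ z → p (b * z))
    polynomial-scale zero    b pol z = trans (pol (b * z)) (sym (*-identityˡ _))
    polynomial-scale (suc m) b {c} pol a with pol (b * a)
    ... | g , polg , eq = (λ z → b * g (b * z))
      , polynomial-cong m (sym (*-assoc b (b ^ m) c)) (λ _ → refl) (polynomial-* m b (polynomial-scale m b polg))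
      , λ z → trans (eq (b * z))
          (solve 5 (λ b a z x u → x :+ (b :* a :- b :* z) :* u := x :+ (a :- z) :* (b :* u)) refl _ _ _ _ _)

    -- At the first root a, p z is (a - z) g z. Any other root b then satisfies (a - b) g b = 0, so
    -- b is a root of g because a - b can be cancelled, and g has smaller degree.
    polynomial-roots : ∀ {c} p as → IsPolynomial (length as) c p → AllPairs (λ a b → Cancellable (a - b)) as →
                       All (λ a → p a ≈ 0#) as → ∀ z → p z ≈ c * ∏ (_- z) as
    polynomial-roots p []       pol []                  []             z = trans (pol z) (sym (*-identityʳ _))
    polynomial-roots {c} p (a ∷ as) pol (a-cancel ∷ cancel) (pa≈0 ∷ pas≈0) z with pol a
    ... | g , polg , eq = begin
      p z                              ≈⟨ eq z ⟩
      p a + (a - z) * g z              ≈⟨ +-cong pa≈0 (*-congˡ (polynomial-roots g as polg cancel (gas≈0 a-cancel pas≈0) z)) ⟩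
      0# + (a - z) * (c * ∏ (_- z) as) ≈⟨ solve 3 (λ d c x → con (0 , 0) :+ d :* (c :* x) := c :* (d :* x)) refl _ _ _ ⟩
      c * ((a - z) * ∏ (_- z) as)      ∎
      where
      gas≈0 : ∀ {bs} → All (λ b → Cancellable (a - b)) bs → All (λ b → p b ≈ 0#) bs → All (λ b → g b ≈ 0#) bs
      gas≈0 []             []             = []
      gas≈0 {b ∷ _} (canc ∷ cancs) (pb≈0 ∷ pbs≈0) = canc (g b) (begin
        (a - b) * g b        ≈⟨ +-identityˡ _ ⟨
        0# + (a - b) * g b   ≈⟨ +-congʳ pa≈0 ⟨
        p a + (a - b) * g b  ≈⟨ eq b ⟨
        p b                  ≈⟨ pb≈0 ⟩
        0#                   ∎) ∷ gas≈0 cancs pbs≈0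

  module ShiftedVandermonde (R : CommutativeRing 0ℓ 0ℓ) (q : CommutativeRing.Carrier R) where
    open CommutativeRing R hiding (zero)
    open IntegralRingSolver R
    open DividedDifferences R
    open import Algebra.Properties.Semiring.Exp semiring using (_^_)
    open import Relation.Binary.Reasoning.Setoid setoid

    vandermonde : List Carrier → Carrier
    vandermonde []       = 1#
    vandermonde (x ∷ xs) = ∏ (_- x) xs * vandermonde xs

    -- shifted r f xs is the sum over the subsets S of the first r indices of
    --   ∏_{i ∈ S} (xᵢ - 1) ∏ᵢ f(yᵢ) ∏_{i < j} (yⱼ - yᵢ),
    -- where yᵢ is xᵢ for i ∈ S and q xᵢ otherwise.
    shifted : ℕ → (Carrier → Carrier) → List Carrier → Carrier
    shifted r       f []       = 1#
    shifted zero    f (x ∷ xs) = f (q * x) * shifted zero (λ y → f y * (y - q * x)) xs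
    shifted (suc r) f (x ∷ xs) =
        f (q * x) * shifted r (λ y → f y * (y - q * x)) xs
      + (x - 1#) * f x * shifted r (λ y → f y * (y - x)) xs

    shifted-cong : ∀ r {f g} xs → (∀ y → f y ≈ g y) → shifted r f xs ≈ shifted r g xs
    shifted-cong r       []       f≈g = refl
    shifted-cong zero    (x ∷ xs) f≈g = *-cong (f≈g _) (shifted-cong zero xs (λ y → *-congʳ (f≈g y)))
    shifted-cong (suc r) (x ∷ xs) f≈g = +-cong
      (*-cong (f≈g _) (shifted-cong r xs (λ y → *-congʳ (f≈g y))))
      (*-cong (*-congˡ (f≈g _)) (shifted-cong r xs (λ y → *-congʳ (f≈g y))))

    private
      pair : ℕ → (Carrier → Carrier) → List Carrier → Carrier → Carrier → Carrier
      pair r f xs y y′ = shifted r (λ z → f z * (z - y) * (z - y′)) xs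

      pair-comm : ∀ r f xs y y′ → pair r f xs y y′ ≈ pair r f xs y′ y
      pair-comm r f xs y y′ = shifted-cong r xs
        (λ z → solve 3 (λ a b c → a :* b :* c := a :* c :* b) refl _ _ _)

    -- Both variables lie in the range of the subsets, so the four choices for them are permuted by
    -- the exchange; only the factor y₂ - y₁ is sensitive to the order, and it changes sign.
    shifted-swap : ∀ r f x x′ xs → shifted (2 ℕ.+ r) f (x ∷ x′ ∷ xs) ≈ - shifted (2 ℕ.+ r) f (x′ ∷ x ∷ xs)
    shifted-swap r f x x′ xs = begin
      shifted (2 ℕ.+ r) f (x ∷ x′ ∷ xs)
        ≈⟨ solve 12 (λ X Y x y a b c d t u v w →
               a :* (b :* (Y :- X) :* t :+ (y :- con (1 , 0)) :* (d :* (y :- X)) :* u)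
               :+ (x :- con (1 , 0)) :* c :* (b :* (Y :- x) :* v :+ (y :- con (1 , 0)) :* (d :* (y :- x)) :* w)
            := :- (b :* (a :* (X :- Y) :* t :+ (x :- con (1 , 0)) :* (c :* (x :- Y)) :* v)
               :+ (y :- con (1 , 0)) :* d :* (a :* (X :- y) :* u :+ (x :- con (1 , 0)) :* (c :* (x :- y)) :* w)))
             refl (q * x) (q * x′) x x′ (f (q * x)) (f (q * x′)) (f x) (f x′) _ _ _ _ ⟩
      _
        ≈⟨ -‿cong (+-cong
             (*-congˡ (+-cong (*-congˡ (pair-comm r f xs _ _)) (*-congˡ (pair-comm r f xs _ _))))
             (*-congˡ (+-cong (*-congˡ (pair-comm r f xs _ _)) (*-congˡ (pair-comm r f xs _ _))))) ⟩
      - shifted (2 ℕ.+ r) f (x′ ∷ x ∷ xs) ∎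

    -- Antisymmetry alone would only give that twice the sum is 0. For equal neighbours the four
    -- choices are therefore inspected: two contain a factor x - x or q x - q x, and the two mixed
    -- ones cancel. Otherwise a swap moves x closer to its copy.
    shifted-vanishes : ∀ {x xs} f → x ∈ xs → shifted (suc (length xs)) f (x ∷ xs) ≈ 0#
    shifted-vanishes {x} {.x ∷ xs} f (here ≡.refl) = begin
      _ ≈⟨ +-congˡ (*-congˡ (+-congʳ (*-congˡ (pair-comm (length xs) f xs x (q * x))))) ⟩
      _ ≈⟨ solve 7 (λ X x a c t u w →
               a :* (a :* (X :- X) :* t :+ (x :- con (1 , 0)) :* (c :* (x :- X)) :* u)
               :+ (x :- con (1 , 0)) :* c :* (a :* (X :- x) :* u :+ (x :- con (1 , 0)) :* (c :* (x :- x)) :* w)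
            := con (0 , 0)) refl (q * x) x (f (q * x)) (f x) _ _ _ ⟩
      0# ∎
    shifted-vanishes {x} {x′ ∷ xs} f (there x∈xs) = begin
      shifted (2 ℕ.+ length xs) f (x ∷ x′ ∷ xs)    ≈⟨ shifted-swap (length xs) f x x′ xs ⟩
      - shifted (2 ℕ.+ length xs) f (x′ ∷ x ∷ xs)  ≈⟨ -‿cong (+-cong (*-congˡ (shifted-vanishes _ x∈xs)) (*-congˡ (shifted-vanishes _ x∈xs))) ⟩
      _                                            ≈⟨ solve 2 (λ a b → :- (a :* con (0 , 0) :+ b :* con (0 , 0)) := con (0 , 0)) refl _ _ ⟩
      0#                                           ∎

    -- Each variable y brings exactly one factor y - z. Choosing -z from all of them leaves the sum
    -- without these factors as the leading coefficient.
    shifted-polynomial : ∀ r f xs →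
      IsPolynomial (length xs) (shifted r f xs) (λ z → shifted r (λ y → f y * (y - z)) xs)
    shifted-polynomial r       f []       = λ _ → refl
    shifted-polynomial zero    f (x ∷ xs) = polynomial-cong (suc (length xs)) refl
      (λ z → trans
        (*-congˡ (*-congˡ (shifted-cong zero xs (λ y → solve 3 (λ a b c → a :* b :* c := a :* c :* b) refl _ _ _))))
        (solve 3 (λ b a c → b :* (a :* c) := a :* b :* c) refl _ _ _))
      (polynomial-linear (length xs) (q * x)
        (polynomial-* (length xs) (f (q * x)) (shifted-polynomial zero (λ y → f y * (y - q * x)) xs)))
    shifted-polynomial (suc r) f (x ∷ xs) = polynomial-cong (suc (length xs)) refl
      (λ z → +-cong
        (trans
          (*-congˡ (*-congˡ (shifted-cong r xs (λ y → solve 3 (λ a b c → a :* b :* c := a :* c :* b) refl _ _ _))))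
          (solve 3 (λ b a c → b :* (a :* c) := a :* b :* c) refl _ _ _))
        (trans
          (*-congˡ (*-congˡ (shifted-cong r xs (λ y → solve 3 (λ a b c → a :* b :* c := a :* c :* b) refl _ _ _))))
          (solve 4 (λ b e a c → b :* (e :* a :* c) := e :* (a :* b) :* c) refl _ _ _ _)))
      (polynomial-+ (suc (length xs))
        (polynomial-linear (length xs) (q * x)
          (polynomial-* (length xs) (f (q * x)) (shifted-polynomial r (λ y → f y * (y - q * x)) xs)))
        (polynomial-linear (length xs) x
          (polynomial-* (length xs) ((x - 1#) * f x) (shifted-polynomial r (λ y → f y * (y - x)) xs))))

    -- In terms of the first variable, the left-hand side is a polynomial that
    -- vanishes at 0 and at the other variables; this determines it up to its
    -- leading coefficient, which is the left-hand side for the other variables.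
    shifted-all : ∀ xs → All (λ x → Cancellable (0# - x)) xs → AllPairs (λ x y → Cancellable (x - y)) xs →
                  shifted (length xs) (λ _ → 1#) xs ≈ ∏ (λ x → x) xs * vandermonde xs
    shifted-all []       _                 _                      = sym (*-identityˡ 1#)
    shifted-all (x ∷ xs) (_ ∷ cancel₀) (_ ∷ cancel) = begin
      G x                                                     ≈⟨ polynomial-roots G (0# ∷ xs) G-polynomial (cancel₀ ∷ cancel) (G0≈0 ∷ All.tabulate (shifted-vanishes _)) x ⟩
      - shifted n (λ _ → 1#) xs * ((0# - x) * ∏ (_- x) xs)    ≈⟨ *-congʳ (-‿cong (shifted-all xs cancel₀ cancel)) ⟩
      - (∏ (λ x → x) xs * vandermonde xs) * ((0# - x) * ∏ (_- x) xs)
        ≈⟨ solve 4 (λ a b c d → :- (a :* b) :* ((con (0 , 0) :- c) :* d) := (c :* a) :* (d :* b)) refl _ _ _ _ ⟩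
      ∏ (λ x → x) (x ∷ xs) * vandermonde (x ∷ xs)             ∎
      where
      n = length xs

      G P : Carrier → Carrier
      G z = shifted (suc n) (λ _ → 1#) (z ∷ xs)
      P z = shifted n (λ y → 1# * (y - z)) xs

      P-polynomial : IsPolynomial n (shifted n (λ _ → 1#) xs) P
      P-polynomial = shifted-polynomial n (λ _ → 1#) xs

      -- `G z` is `P (q * z)` minus (1 - z) `P z`. The first term has degree n only, so the leading
      -- coefficient comes from the second.
      G-polynomial : IsPolynomial (suc n) (- shifted n (λ _ → 1#) xs) G
      G-polynomial = polynomial-cong (suc n)
        (solve 1 (λ c → con (0 , 0) :+ (:- con (1 , 0)) :* c := :- c) refl _)
        (λ z → solve 3 (λ a b z → a :+ (:- con (1 , 0)) :* ((con (1 , 0) :- z) :* b)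
                          := con (1 , 0) :* a :+ (z :- con (1 , 0)) :* con (1 , 0) :* b) refl _ _ _)
        (polynomial-+ (suc n)
          (polynomial-raise n (polynomial-scale n q P-polynomial))
          (polynomial-* (suc n) (- 1#) (polynomial-linear n 1# P-polynomial)))

      -- At 0 the values z and q z coincide, and the two choices for the first variable have weights
      -- 1 and -1.
      G0≈0 : G 0# ≈ 0#
      G0≈0 = begin
        1# * P (q * 0#) + (0# - 1#) * 1# * P 0#  ≈⟨ +-congʳ (*-congˡ (shifted-cong n xs (λ y → *-congˡ (+-congˡ (-‿cong (zeroʳ q)))))) ⟩
        1# * P 0# + (0# - 1#) * 1# * P 0#        ≈⟨ solve 1 (λ a → con (1 , 0) :* a :+ (con (0 , 0) :- con (1 , 0)) :* con (1 , 0) :* a := con (0 , 0)) refl _ ⟩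
        0#                                       ∎

    -- Only the empty subset remains, so all variables are scaled by q and every pair contributes
    -- one factor q.
    shifted-none : ∀ f xs → shifted 0 f xs ≈ ∏ (λ x → f (q * x)) xs * (q ^ triangular (length xs) * vandermonde xs)
    shifted-none f []       = solve 0 (con (1 , 0) := con (1 , 0) :* (con (1 , 0) :* con (1 , 0))) refl
    shifted-none f (x ∷ xs) = begin
      f (q * x) * shifted 0 (λ y → f y * (y - q * x)) xs
        ≈⟨ *-congˡ (shifted-none _ xs) ⟩
      f (q * x) * (∏ (λ y → f (q * y) * (q * y - q * x)) xs * (q ^ triangular n * vandermonde xs))
        ≈⟨ *-congˡ (*-congʳ (trans (∏-* _ _ xs) (*-congˡ (differences xs)))) ⟩
      f (q * x) * (∏ (λ y → f (q * y)) xs * (q ^ n * ∏ (_- x) xs) * (q ^ triangular n * vandermonde xs))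
        ≈⟨ solve 6 (λ a b c d e g → a :* (b :* (c :* d) :* (e :* g)) := a :* b :* ((c :* e) :* (d :* g))) refl _ _ _ _ _ _ ⟩
      f (q * x) * ∏ (λ y → f (q * y)) xs * ((q ^ n * q ^ triangular n) * (∏ (_- x) xs * vandermonde xs))
        ≈⟨ *-congˡ (*-congʳ (^-homo-* q n (triangular n))) ⟨
      f (q * x) * ∏ (λ y → f (q * y)) xs * (q ^ (n ℕ.+ triangular n) * (∏ (_- x) xs * vandermonde xs)) ∎
      where
      open import Algebra.Properties.Semiring.Exp semiring using (^-homo-*)
      n = length xs

      differences : ∀ ys → ∏ (λ y → q * y - q * x) ys ≈ q ^ length ys * ∏ (_- x) ys
      differences []       = sym (*-identityˡ 1#)
      differences (y ∷ ys) = trans (*-congˡ (differences ys))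
        (solve 5 (λ q x y a b → (q :* y :- q :* x) :* (a :* b) := (q :* a) :* ((y :- x) :* b)) refl _ _ _ _ _)

-- Sums and products over lists; products over the hooks of a row

module Products where

  open import Level using (0ℓ)
  open import Algebra.Bundles using (CommutativeRing)
  open import Data.List.Base using (List; []; _∷_; length; map; _++_; applyUpTo; concatMap)
  open import Data.List.Membership.Propositional using (_∈_)
  open import Data.List.Relation.Unary.All as All using (All; []; _∷_)
  import Data.List.Relation.Unary.All.Properties as All
  open import Data.List.Relation.Unary.AllPairs using ([]; _∷_)
  open import Data.List.Relation.Unary.Any using (here; there)
  open import Data.Nat.Base as ℕ using (ℕ; zero; suc)
  import Data.Nat.Properties as ℕ
  open import Data.Product.Base using (_,_)
  open import Function.Base using (_∘_)
  open import Relation.Binary.PropositionalEquality as ≡ using (_≡_)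
  open RingSolving
  open Shapes
  open ShiftedVandermondes

  module ListSums (R : CommutativeRing 0ℓ 0ℓ) where
    open CommutativeRing R hiding (zero)
    open DividedDifferences R
    open IntegralRingSolver R
    open import Relation.Binary.Reasoning.Setoid setoid

    ∑ : {A : Set} → (A → Carrier) → List A → Carrier
    ∑ f []       = 0#
    ∑ f (x ∷ xs) = f x + ∑ f xs

    ∑-cong : {A : Set} {f g : A → Carrier} (xs : List A) → (∀ x → x ∈ xs → f x ≈ g x) → ∑ f xs ≈ ∑ g xs
    ∑-cong []       f≈g = refl
    ∑-cong (x ∷ xs) f≈g = +-cong (f≈g x (here ≡.refl)) (∑-cong xs (λ y y∈ → f≈g y (there y∈)))

    ∑-*ˡ : {A : Set} (a : Carrier) (f : A → Carrier) (xs : List A) → ∑ (λ x → a * f x) xs ≈ a * ∑ f xs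
    ∑-*ˡ a f []       = sym (zeroʳ a)
    ∑-*ˡ a f (x ∷ xs) = trans (+-congˡ (∑-*ˡ a f xs)) (sym (distribˡ a _ _))

    ∑-++ : {A : Set} (f : A → Carrier) (xs ys : List A) → ∑ f (xs ++ ys) ≈ ∑ f xs + ∑ f ys
    ∑-++ f []       ys = sym (+-identityˡ _)
    ∑-++ f (x ∷ xs) ys = trans (+-congˡ (∑-++ f xs ys)) (sym (+-assoc _ _ _))

    ∑-map : {A B : Set} (f : B → Carrier) (g : A → B) (xs : List A) → ∑ f (map g xs) ≈ ∑ (f ∘ g) xs
    ∑-map f g []       = refl
    ∑-map f g (x ∷ xs) = +-congˡ (∑-map f g xs)

    ∑-concatMap : {A B : Set} (f : B → Carrier) (g : A → List B) (xs : List A) →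
                  ∑ f (concatMap g xs) ≈ ∑ (λ x → ∑ f (g x)) xs
    ∑-concatMap f g []       = refl
    ∑-concatMap f g (x ∷ xs) = trans (∑-++ f (g x) _) (+-congˡ (∑-concatMap f g xs))

    ∏-map : {A B : Set} (f : B → Carrier) (g : A → B) (xs : List A) → ∏ f (map g xs) ≈ ∏ (f ∘ g) xs
    ∏-map f g []       = refl
    ∏-map f g (x ∷ xs) = *-congˡ (∏-map f g xs)

    ∏-++ : {A : Set} (f : A → Carrier) (xs ys : List A) → ∏ f (xs ++ ys) ≈ ∏ f xs * ∏ f ys
    ∏-++ f []       ys = sym (*-identityˡ _)
    ∏-++ f (x ∷ xs) ys = trans (*-congˡ (∏-++ f xs ys)) (sym (*-assoc _ _ _))

    ∏< : ℕ → (ℕ → Carrier) → Carrier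
    ∏< zero    f = 1#
    ∏< (suc n) f = f 0 * ∏< n (f ∘ suc)

    ∏<-cong : ∀ n {f g} → (∀ i → i ℕ.< n → f i ≈ g i) → ∏< n f ≈ ∏< n g
    ∏<-cong zero    f≈g = refl
    ∏<-cong (suc n) f≈g = *-cong (f≈g 0 ℕ.z<s) (∏<-cong n (λ i i<n → f≈g (suc i) (ℕ.s<s i<n)))

    ∏<-+ : ∀ m n f → ∏< (m ℕ.+ n) f ≈ ∏< m f * ∏< n (λ i → f (m ℕ.+ i))
    ∏<-+ zero    n f = sym (*-identityˡ _)
    ∏<-+ (suc m) n f = trans (*-congˡ (∏<-+ m n (f ∘ suc))) (sym (*-assoc _ _ _))

    ∏<-suc : ∀ n f → ∏< (suc n) f ≈ ∏< n f * f n
    ∏<-suc zero    f = *-comm _ _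
    ∏<-suc (suc n) f = trans (*-congˡ (∏<-suc n (f ∘ suc))) (sym (*-assoc _ _ _))

    ∏<-reverse : ∀ n (f : ℕ → Carrier) → ∏< n (λ i → f (n ℕ.∸ i)) ≈ ∏< n (f ∘ suc)
    ∏<-reverse zero    f = refl
    ∏<-reverse (suc n) f = begin
      f (suc n) * ∏< n (λ i → f (n ℕ.∸ i))  ≈⟨ *-congˡ (∏<-reverse n f) ⟩
      f (suc n) * ∏< n (f ∘ suc)            ≈⟨ *-comm _ _ ⟩
      ∏< n (f ∘ suc) * f (suc n)            ≈⟨ ∏<-suc n (f ∘ suc) ⟨
      ∏< (suc n) (f ∘ suc)                  ∎

    ∏-applyUpTo : {A : Set} (f : A → Carrier) (g : ℕ → A) → ∀ n → ∏ f (applyUpTo g n) ≈ ∏< n (f ∘ g)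
    ∏-applyUpTo f g zero    = refl
    ∏-applyUpTo f g (suc n) = *-congˡ (∏-applyUpTo f (g ∘ suc) n)

  module HookProducts (R : CommutativeRing 0ℓ 0ℓ) where
    open CommutativeRing R hiding (zero)
    open DividedDifferences R
    open ListSums R
    open IntegralRingSolver R
    open import Relation.Binary.Reasoning.Setoid setoid

    -- The hook lengths of a first row of length b placed s columns away from μ
    -- and the differences of beta numbers are complementary in
    -- {s + 1, ..., s + b + ℓ(μ)}.
    hook-product : ∀ (f : ℕ → Carrier) s b μ → Decreasing μ → nth μ 0 ℕ.≤ b →
      ∏< b (λ j → f (s ℕ.+ (b ℕ.∸ j ℕ.+ leg μ j))) * ∏ (λ m → f (s ℕ.+ b ℕ.+ length μ ℕ.∸ m)) (beta μ)
        ≈ ∏< (b ℕ.+ length μ) (λ k → f (s ℕ.+ suc k))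
    hook-product f s b [] dec _ = begin
      ∏< b (λ j → f (s ℕ.+ (b ℕ.∸ j ℕ.+ 0))) * 1#  ≈⟨ *-identityʳ _ ⟩
      ∏< b (λ j → f (s ℕ.+ (b ℕ.∸ j ℕ.+ 0)))       ≈⟨ ∏<-reverse b (λ k → f (s ℕ.+ (k ℕ.+ 0))) ⟩
      ∏< b (λ k → f (s ℕ.+ suc (k ℕ.+ 0)))         ≈⟨ ∏<-cong b (λ k _ → reflexive (≡.cong (λ k → f (s ℕ.+ suc k)) (ℕ.+-identityʳ k))) ⟩
      ∏< b (λ k → f (s ℕ.+ suc k))                 ≡⟨ ≡.cong (λ b → ∏< b (λ k → f (s ℕ.+ suc k))) (ℕ.+-identityʳ b) ⟨
      ∏< (b ℕ.+ 0) (λ k → f (s ℕ.+ suc k))         ∎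
    hook-product f s b (m ∷ μ) dec m≤b with b ℕ.∸ m | ℕ.m+[n∸m]≡n m≤b
    -- Here d is the excess of b over the next row m. The columns from m on have no leg and give s +
    -- 1, ..., s + d; the beta number of the row m gives s + d + 1. In a column j < m, the d further
    -- arm cells and the one further leg cell raise the hook length by d + 1, so that the row m
    -- takes over with s + d + 1 in place of s.
    ... | d | ≡.refl = begin
      ∏< (m ℕ.+ d) row * (f (s ℕ.+ (m ℕ.+ d) ℕ.+ suc ℓ ℕ.∸ (m ℕ.+ ℓ)) * ∏ (λ l → f (s ℕ.+ (m ℕ.+ d) ℕ.+ suc ℓ ℕ.∸ l)) (beta μ))
        ≈⟨ *-cong (trans (∏<-+ m d row) (*-cong (∏<-cong m left) (trans (∏<-cong d right) (∏<-reverse d (λ k → f (s ℕ.+ k))))))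
                  (*-cong (reflexive (≡.cong f middle)) (∏-cong (beta μ) (λ l → reflexive (≡.cong (λ k → f (k ℕ.∸ l)) total)))) ⟩
      ∏< m (λ j → f (s′ ℕ.+ (m ℕ.∸ j ℕ.+ leg μ j))) * ∏< d (λ i → f (s ℕ.+ suc i)) * (f (s ℕ.+ suc d) * ∏ (λ l → f (s′ ℕ.+ m ℕ.+ ℓ ℕ.∸ l)) (beta μ))
        ≈⟨ solve 4 (λ a b c d → (a :* b) :* (c :* d) := b :* (c :* (a :* d))) refl _ _ _ _ ⟩
      ∏< d (λ i → f (s ℕ.+ suc i)) * (f (s ℕ.+ suc d) * (∏< m (λ j → f (s′ ℕ.+ (m ℕ.∸ j ℕ.+ leg μ j))) * ∏ (λ l → f (s′ ℕ.+ m ℕ.+ ℓ ℕ.∸ l)) (beta μ)))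
        ≈⟨ *-congˡ (*-congˡ (hook-product f s′ m μ (decreasing-tail dec) (dec 0))) ⟩
      ∏< d (λ i → f (s ℕ.+ suc i)) * (f (s ℕ.+ suc d) * ∏< (m ℕ.+ ℓ) (λ k → f (s′ ℕ.+ suc k)))
        ≈⟨ *-congˡ (*-cong (reflexive (≡.cong (λ k → f (s ℕ.+ suc k)) (≡.sym (ℕ.+-identityʳ d))))
             (∏<-cong (m ℕ.+ ℓ) (λ k _ → reflexive (≡.cong f (ℕ.+-assoc s (suc d) (suc k)))))) ⟩
      ∏< d (λ i → f (s ℕ.+ suc i)) * ∏< (suc (m ℕ.+ ℓ)) (λ k → f (s ℕ.+ suc (d ℕ.+ k)))
        ≈⟨ ∏<-+ d (suc (m ℕ.+ ℓ)) (λ k → f (s ℕ.+ suc k)) ⟨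
      ∏< (d ℕ.+ suc (m ℕ.+ ℓ)) (λ k → f (s ℕ.+ suc k))
        ≡⟨ ≡.cong (λ n → ∏< n (λ k → f (s ℕ.+ suc k))) rearrange ⟩
      ∏< (m ℕ.+ d ℕ.+ suc ℓ) (λ k → f (s ℕ.+ suc k)) ∎
      where
      open import Data.Nat.Solver
      module S = +-*-Solver
      ℓ = length μ
      s′ = s ℕ.+ suc d

      row : ℕ → Carrier
      row j = f (s ℕ.+ (m ℕ.+ d ℕ.∸ j ℕ.+ leg (m ∷ μ) j))

      left : ∀ j → j ℕ.< m → row j ≈ f (s′ ℕ.+ (m ℕ.∸ j ℕ.+ leg μ j))
      left j j<m = reflexive (≡.cong f (≡.trans
        (≡.cong₂ (λ a b → s ℕ.+ (a ℕ.+ b)) (ℕ.+-∸-comm d (ℕ.<⇒≤ j<m)) (leg-∷ m μ j j<m))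
        (S.solve 4 (λ s k d l → s S.:+ ((k S.:+ d) S.:+ (S.con 1 S.:+ l)) S.:= (s S.:+ (S.con 1 S.:+ d)) S.:+ (k S.:+ l)) ≡.refl s (m ℕ.∸ j) d (leg μ j))))

      right : ∀ i → i ℕ.< d → row (m ℕ.+ i) ≈ f (s ℕ.+ (d ℕ.∸ i))
      right i _ = reflexive (≡.cong (λ k → f (s ℕ.+ k)) (≡.trans
        (≡.cong₂ ℕ._+_ (ℕ.[m+n]∸[m+o]≡n∸o m d i)
          (leg≡0 (m ∷ μ) (m ℕ.+ i) (All.map (λ k≤ → ℕ.≤-trans k≤ (ℕ.m≤m+n m i)) (all≤head (m ∷ μ) dec))))
        (ℕ.+-identityʳ _)))

      total : s ℕ.+ (m ℕ.+ d) ℕ.+ suc ℓ ≡ s′ ℕ.+ m ℕ.+ ℓ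
      total = S.solve 4 (λ s m d l → (s S.:+ (m S.:+ d)) S.:+ (S.con 1 S.:+ l) S.:= (s S.:+ (S.con 1 S.:+ d)) S.:+ m S.:+ l) ≡.refl s m d ℓ

      middle : s ℕ.+ (m ℕ.+ d) ℕ.+ suc ℓ ℕ.∸ (m ℕ.+ ℓ) ≡ s ℕ.+ suc d
      middle = ≡.trans (≡.cong (ℕ._∸ (m ℕ.+ ℓ)) (≡.trans total (ℕ.+-assoc s′ m ℓ))) (ℕ.m+n∸n≡m s′ (m ℕ.+ ℓ))

      rearrange : d ℕ.+ suc (m ℕ.+ ℓ) ≡ m ℕ.+ d ℕ.+ suc ℓ
      rearrange = S.solve 3 (λ m d l → d S.:+ (S.con 1 S.:+ (m S.:+ l)) S.:= (m S.:+ d) S.:+ (S.con 1 S.:+ l)) ≡.refl m d ℓ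

-- The q-hook formula for words

module HookFormula where

  open import Level using (0ℓ)
  open import Algebra.Bundles using (CommutativeRing)
  import Algebra.Properties.Semiring.Exp
  open import Data.Bool.Base using (true; false; if_then_else_)
  open import Data.List.Base using (List; []; _∷_; length; map; upTo; replicate; filter)
  open import Data.List.Properties using (length-map)
  open import Data.List.Membership.Propositional using (_∈_)
  open import Data.List.Membership.Propositional.Properties using (∈-filter⁺; ∈-filter⁻; ∈-upTo⁺; ∈-upTo⁻; ∈-concatMap⁻; ∈-map⁻)
  open import Data.List.Relation.Unary.All as All using (All; []; _∷_)
  import Data.List.Relation.Unary.All.Properties as All
  open import Data.List.Relation.Unary.AllPairs as AllPairs using (AllPairs; []; _∷_)
  open import Data.List.Relation.Unary.Any using (here; there)
  open import Data.List.Relation.Unary.Unique.Propositional using (Unique)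
  import Data.List.Relation.Unary.Unique.Propositional.Properties as Unique
  open import Data.Nat.Base as ℕ using (ℕ; zero; suc; _<ᵇ_; z≤n; s≤s)
  import Data.Nat.Properties as ℕ
  open import Data.Nat.ListAction using (sum)
  open import Data.Product.Base using (_,_; proj₁; proj₂)
  open import Data.Empty using (⊥-elim)
  open import Function.Base using (_∘_; id)
  open import Relation.Binary.PropositionalEquality as ≡ using (_≡_; _≢_)
  open import Relation.Nullary using (yes; no; ¬_)
  open RingSolving
  open Shapes
  open ShiftedVandermondes
  open Products

  <⇒<ᵇ≡true : ∀ {m n} → m ℕ.< n → (m <ᵇ n) ≡ true
  <⇒<ᵇ≡true {m} {n} m<n with m <ᵇ n | ℕ.<⇒<ᵇ m<n
  ... | true | _ = ≡.refl

  ≮⇒<ᵇ≡false : ∀ {m n} → ¬ m ℕ.< n → (m <ᵇ n) ≡ false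
  ≮⇒<ᵇ≡false {m} {n} m≮n with m <ᵇ n | ℕ.<ᵇ⇒< m n
  ... | true  | m<n = ⊥-elim (m≮n (m<n _))
  ... | false | _   = ≡.refl

  length-words : ∀ n as {w} → w ∈ words n as → length w ≡ n
  length-words zero    as (here ≡.refl) = ≡.refl
  length-words (suc n) as w∈ with ∈-concatMap⁻ (λ r → map (r ∷_) (words n (decrement r as))) {xs = filter (corner? as) (upTo (length as))} w∈
  ... | any = go any
    where
    open import Data.List.Relation.Unary.Any using (Any)
    go : ∀ {rs w} → Any (λ r → w ∈ map (r ∷_) (words n (decrement r as))) rs → length w ≡ suc n
    go {r ∷ _} (here w∈) with ∈-map⁻ (r ∷_) w∈
    ... | _ , w′∈ , ≡.refl = ≡.cong suc (length-words n (decrement r as) w′∈)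
    go (there any) = go any

  -- The hypotheses under which q behaves like an indeterminate.
  record Generic (R : CommutativeRing 0ℓ 0ℓ) (q : CommutativeRing.Carrier R) : Set where
    open CommutativeRing R
    open DividedDifferences R using (Cancellable)
    open Algebra.Properties.Semiring.Exp semiring using (_^_)
    field
      power-cancellable      : ∀ a → Cancellable (q ^ a)
      difference-cancellable : ∀ a b → a ≢ b → Cancellable (q ^ a - q ^ b)

  module QHookFormula (R : CommutativeRing 0ℓ 0ℓ) (q : CommutativeRing.Carrier R) (generic : Generic R q) where
    open CommutativeRing R hiding (zero)
    open Generic generic
    open DividedDifferences R
    open ListSums R
    open HookProducts R
    open ShiftedVandermonde R q
    open IntegralRingSolver R
    open import Algebra.Properties.Semiring.Exp semiring using (_^_; ^-homo-*)
    open import Algebra.Properties.Group +-group using (x∙y⁻¹≈ε⇒x≈y; x≈y⇒x∙y⁻¹≈ε)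
    open import Relation.Binary.Reasoning.Setoid setoid

    cancel : ∀ {a x y} → Cancellable a → a * x ≈ a * y → x ≈ y
    cancel {a} {x} {y} canc ax≈ay = x∙y⁻¹≈ε⇒x≈y x y (canc (x - y) (begin
      a * (x - y)    ≈⟨ solve 3 (λ a x y → a :* (x :- y) := a :* x :- a :* y) refl _ _ _ ⟩
      a * x - a * y  ≈⟨ x≈y⇒x∙y⁻¹≈ε ax≈ay ⟩
      0#             ∎))

    cancellable-* : ∀ {a b} → Cancellable a → Cancellable b → Cancellable (a * b)
    cancellable-* canc-a canc-b x abx≈0 = canc-b x (canc-a _ (trans (sym (*-assoc _ _ _)) abx≈0))

    cancellable-1 : Cancellable 1#
    cancellable-1 x 1x≈0 = trans (sym (*-identityˡ x)) 1x≈0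

    cancellable-∏ : {A : Set} (f : A → Carrier) (xs : List A) → All (Cancellable ∘ f) xs → Cancellable (∏ f xs)
    cancellable-∏ f []       []             = cancellable-1
    cancellable-∏ f (x ∷ xs) (canc ∷ cancs) = cancellable-* canc (cancellable-∏ f xs cancs)

    factor : ℕ → Carrier
    factor k = 1# - q ^ k

    factor-cancellable : ∀ {k} → k ≢ 0 → Cancellable (factor k)
    factor-cancellable k≢0 = difference-cancellable 0 _ (k≢0 ∘ ≡.sym)

    pochhammer : ℕ → Carrier
    pochhammer n = ∏< n (λ k → factor (suc k))

    pochhammer-suc : ∀ n → pochhammer (suc n) ≈ factor (suc n) * pochhammer n
    pochhammer-suc n = trans (∏<-suc n (factor ∘ suc)) (*-comm _ _)

    variables : List ℕ → List Carrier
    variables as = map (q ^_) (beta as)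

    pochhammers : List ℕ → Carrier
    pochhammers as = ∏ pochhammer (beta as)

    hookProduct : List ℕ → Carrier
    hookProduct as = ∏ factor (hooks as)

    -- The product of 1 - q^(β_i - β_j) over i < j, which is the Vandermonde product of the
    -- variables without its power of q.
    differences : List ℕ → Carrier
    differences []       = 1#
    differences (a ∷ as) = ∏ (λ m → factor (a ℕ.+ length as ℕ.∸ m)) (beta as) * differences as

    -- The q-analogue of the classical identity ∏ β_i! = ∏ h_c ∏_(i < j) (β_i - β_j); each row is
    -- the case s = 0 of `hook-product`.
    pochhammers≈hooks*differences : ∀ as → Decreasing as → pochhammers as ≈ hookProduct as * differences as
    pochhammers≈hooks*differences []       dec = sym (*-identityˡ 1#)
    pochhammers≈hooks*differences (a ∷ as) dec = begin
      pochhammer (a ℕ.+ length as) * pochhammers as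
        ≈⟨ *-cong (sym (hook-product factor 0 a as (decreasing-tail dec) (dec 0))) (pochhammers≈hooks*differences as (decreasing-tail dec)) ⟩
      ∏< a (λ j → factor (a ℕ.∸ j ℕ.+ leg as j)) * ∏ (λ m → factor (a ℕ.+ length as ℕ.∸ m)) (beta as) * (hookProduct as * differences as)
        ≈⟨ solve 4 (λ a b c d → a :* b :* (c :* d) := a :* c :* (b :* d)) refl _ _ _ _ ⟩
      ∏< a (λ j → factor (a ℕ.∸ j ℕ.+ leg as j)) * hookProduct as * differences (a ∷ as)
        ≈⟨ *-congʳ (*-congʳ (trans (∏-map factor _ (upTo a)) (∏-applyUpTo _ id a))) ⟨
      ∏ factor (map (λ j → a ℕ.∸ j ℕ.+ leg as j) (upTo a)) * hookProduct as * differences (a ∷ as)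
        ≈⟨ *-congʳ (∏-++ factor (map (λ j → a ℕ.∸ j ℕ.+ leg as j) (upTo a)) (hooks as)) ⟨
      hookProduct (a ∷ as) * differences (a ∷ as) ∎

    differences-cancellable : ∀ as → Decreasing as → Cancellable (differences as)
    differences-cancellable []       dec = cancellable-1
    differences-cancellable (a ∷ as) dec = cancellable-*
      (cancellable-∏ _ (beta as) (All.map (λ m< → factor-cancellable (ℕ.m>n⇒m∸n≢0 m<)) (beta-< a as dec)))
      (differences-cancellable as (decreasing-tail dec))

    -- The sum of β_j over all pairs i < j: it collects the powers taken out of x_j - x_i = x_j (1 -
    -- q^(β_i - β_j)).
    betaSums : List ℕ → ℕ
    betaSums []       = 0
    betaSums (a ∷ as) = sum (beta as) ℕ.+ betaSums as

    vandermonde-variables : ∀ as → Decreasing as → vandermonde (variables as) ≈ q ^ betaSums as * differences as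
    vandermonde-variables []       dec = sym (*-identityˡ 1#)
    vandermonde-variables (a ∷ as) dec = begin
      ∏ (_- q ^ l) (variables as) * vandermonde (variables as)
        ≈⟨ *-cong (row (beta as) (beta-< a as dec)) (vandermonde-variables as (decreasing-tail dec)) ⟩
      q ^ sum (beta as) * ∏ (λ m → factor (l ℕ.∸ m)) (beta as) * (q ^ betaSums as * differences as)
        ≈⟨ solve 4 (λ a b c d → a :* b :* (c :* d) := (a :* c) :* (b :* d)) refl _ _ _ _ ⟩
      q ^ sum (beta as) * q ^ betaSums as * differences (a ∷ as)
        ≈⟨ *-congʳ (^-homo-* q (sum (beta as)) (betaSums as)) ⟨
      q ^ betaSums (a ∷ as) * differences (a ∷ as) ∎
      where
      l = a ℕ.+ length as

      row : ∀ ms → All (ℕ._< l) ms → ∏ (_- q ^ l) (map (q ^_) ms) ≈ q ^ sum ms * ∏ (λ m → factor (l ℕ.∸ m)) ms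
      row []       []         = sym (*-identityˡ 1#)
      row (m ∷ ms) (m<l ∷ ms<l) = begin
        (q ^ m - q ^ l) * ∏ (_- q ^ l) (map (q ^_) ms)
          ≈⟨ *-cong (+-congˡ (-‿cong (trans (reflexive (≡.cong (q ^_) (≡.sym (ℕ.m+[n∸m]≡n (ℕ.<⇒≤ m<l))))) (^-homo-* q m (l ℕ.∸ m))))) (row ms ms<l) ⟩
        (q ^ m - q ^ m * q ^ (l ℕ.∸ m)) * (q ^ sum ms * ∏ (λ m → factor (l ℕ.∸ m)) ms)
          ≈⟨ solve 4 (λ a b c d → (a :- a :* b) :* (c :* d) := (a :* c) :* ((con (1 , 0) :- b) :* d)) refl _ _ _ _ ⟩
        q ^ m * q ^ sum ms * ∏ (λ m → factor (l ℕ.∸ m)) (m ∷ ms)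
          ≈⟨ *-congʳ (^-homo-* q m (sum ms)) ⟨
        q ^ (m ℕ.+ sum ms) * ∏ (λ m → factor (l ℕ.∸ m)) (m ∷ ms) ∎

    one : Carrier → Carrier
    one _ = 1#

    shifted-none-variables : ∀ as → Decreasing as →
      shifted 0 one (variables as) ≈ q ^ (triangular (length as) ℕ.+ betaSums as) * differences as
    shifted-none-variables as dec = begin
      shifted 0 one (variables as)
        ≈⟨ shifted-none one (variables as) ⟩
      ∏ (λ _ → 1#) (variables as) * (q ^ triangular (length (variables as)) * vandermonde (variables as))
        ≈⟨ *-cong (∏-1 (variables as)) (*-cong (reflexive (≡.cong (λ n → q ^ triangular n) (≡.trans (length-map _ (beta as)) (length-beta as)))) (vandermonde-variables as dec)) ⟩
      1# * (q ^ triangular (length as) * (q ^ betaSums as * differences as))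
        ≈⟨ solve 3 (λ a b c → con (1 , 0) :* (a :* (b :* c)) := a :* b :* c) refl _ _ _ ⟩
      q ^ triangular (length as) * q ^ betaSums as * differences as
        ≈⟨ *-congʳ (^-homo-* q (triangular (length as)) (betaSums as)) ⟨
      q ^ (triangular (length as) ℕ.+ betaSums as) * differences as ∎

    -- The product of the variables is q^(n + `triangular` ℓ) with n = `sum as`, and `shifted 0`
    -- already contains q^(`triangular` ℓ). The remaining qⁿ is the factor by which `wordSum`
    -- changes from row 0 to row ℓ.
    shifted-all-variables : ∀ as → Decreasing as →
      shifted (length as) one (variables as) ≈ q ^ sum as * shifted 0 one (variables as)
    shifted-all-variables as dec = cancel (power-cancellable t) (begin
      q ^ t * shifted (length as) one (variables as)
        ≡⟨ ≡.cong (λ n → q ^ t * shifted n one (variables as)) (≡.sym length-variables) ⟩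
      q ^ t * shifted (length (variables as)) one (variables as)
        ≈⟨ *-congˡ (shifted-all (variables as) (All.map⁺ (All.tabulate λ {m} _ → cancellable-0- m)) (distinct as dec)) ⟩
      q ^ t * (∏ id (variables as) * vandermonde (variables as))
        ≈⟨ *-congˡ (*-congʳ (trans (product (beta as)) (trans (reflexive (≡.cong (q ^_) (sum-beta as))) (^-homo-* q (sum as) t)))) ⟩
      q ^ t * (q ^ sum as * q ^ t * vandermonde (variables as))
        ≈⟨ solve 3 (λ t s v → t :* (s :* t :* v) := t :* (s :* (con (1 , 0) :* (t :* v)))) refl _ _ _ ⟩
      q ^ t * (q ^ sum as * (1# * (q ^ t * vandermonde (variables as))))
        ≈⟨ *-congˡ (*-congˡ (*-cong (sym (∏-1 (variables as))) (*-congʳ (reflexive (≡.cong (λ n → q ^ triangular n) (≡.sym length-variables)))))) ⟩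
      q ^ t * (q ^ sum as * (∏ (λ _ → 1#) (variables as) * (q ^ triangular (length (variables as)) * vandermonde (variables as))))
        ≈⟨ *-congˡ (*-congˡ (shifted-none one (variables as))) ⟨
      q ^ t * (q ^ sum as * shifted 0 one (variables as)) ∎)
      where
      t = triangular (length as)

      length-variables : length (variables as) ≡ length as
      length-variables = ≡.trans (length-map _ (beta as)) (length-beta as)

      product : ∀ ms → ∏ id (map (q ^_) ms) ≈ q ^ sum ms
      product []       = refl
      product (m ∷ ms) = trans (*-congˡ (product ms)) (sym (^-homo-* q m (sum ms)))

      cancellable-0- : ∀ m → Cancellable (0# - q ^ m)
      cancellable-0- m x eq = power-cancellable m x (begin
        q ^ m * x            ≈⟨ solve 2 (λ a x → a :* x := :- ((con (0 , 0) :- a) :* x)) refl _ _ ⟩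
        - ((0# - q ^ m) * x) ≈⟨ -‿cong eq ⟩
        - 0#                 ≈⟨ solve 0 (:- con (0 , 0) := con (0 , 0)) refl ⟩
        0#                   ∎)

      distinct : ∀ as → Decreasing as → AllPairs (λ x y → Cancellable (x - y)) (variables as)
      distinct []       dec = []
      distinct (a ∷ as) dec =
        All.map⁺ (All.map (λ m<l → difference-cancellable _ _ (ℕ.<⇒≢ m<l ∘ ≡.sym)) (beta-< a as dec))
        ∷ distinct as (decreasing-tail dec)

    -- The subsets containing r contribute nothing. If r is the last row, its length is 0, so x_r =
    -- 1 and the weight x_r - 1 vanishes. Otherwise rows r and r + 1 have equal length, so x_r = q
    -- x_(r + 1); as r + 1 is outside the range of the subsets, the product contains the difference
    -- of these two.
    shifted-no-corner : ∀ r as f → Decreasing as → r ℕ.< length as → ¬ Corner as r →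
      shifted (suc r) f (variables as) ≈ shifted r f (variables as)
    shifted-no-corner zero    (a ∷ []) f dec _ ¬corner with ℕ.n≤0⇒n≡0 (ℕ.≮⇒≥ ¬corner)
    ... | ≡.refl = solve 3 (λ a b c → a :* b :+ (con (1 , 0) :- con (1 , 0)) :* c :* con (1 , 0) := a :* b) refl _ _ _
    shifted-no-corner zero    (a ∷ b ∷ bs) f dec _ ¬corner with ℕ.≤-antisym (ℕ.≮⇒≥ ¬corner) (dec 0)
    ... | ≡.refl = begin
      u + v * (f x′ * (x′ - x) * shifted 0 g (variables bs))
        ≈⟨ +-congˡ (*-congˡ (*-congʳ (*-congˡ (trans (+-congʳ (sym x≈x′)) (-‿inverseʳ x))))) ⟩
      u + v * (f x′ * 0# * shifted 0 g (variables bs))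
        ≈⟨ solve 4 (λ a b c d → a :+ b :* (c :* con (0 , 0) :* d) := a) refl _ _ _ _ ⟩
      u ∎
      where
      x  = q ^ (a ℕ.+ suc (length bs))
      x′ = q * q ^ (a ℕ.+ length bs)
      g  = λ y → f y * (y - x) * (y - x′)
      u  = shifted 0 f (variables (a ∷ b ∷ bs))
      v  = (x - 1#) * f x

      x≈x′ : x ≈ x′
      x≈x′ = reflexive (≡.cong (q ^_) (ℕ.+-suc a (length bs)))
    shifted-no-corner (suc r) (a ∷ as) f dec (s≤s r<) ¬corner = +-cong
      (*-congˡ (shifted-no-corner r as _ (decreasing-tail dec) r< ¬corner))
      (*-congˡ (shifted-no-corner r as _ (decreasing-tail dec) r< ¬corner))

    -- For the subsets containing r, the variable x_r is q times the variable of the shortened row,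
    -- so they form the sum for `decrement r as`; their weight x_r - 1 is the negative of the
    -- factor.
    shifted-corner : ∀ r as f → r ℕ.< length as → Corner as r →
      shifted (suc r) f (variables as) ≈
        shifted r f (variables as) - factor (nth (beta as) r) * shifted r f (variables (decrement r as))
    shifted-corner zero    (suc a ∷ as) f _ _ =
      solve 4 (λ u x v w → u :+ (x :- con (1 , 0)) :* v :* w := u :- (con (1 , 0) :- x) :* (v :* w)) refl _ _ _ _
    shifted-corner (suc r) (a ∷ as) f (s≤s r<) corner = begin
      _ ≈⟨ +-cong (*-congˡ (shifted-corner r as _ r< corner)) (*-congˡ (shifted-corner r as _ r< corner)) ⟩
      _ ≈⟨ solve 7 (λ u v x y c z w → u :* (x :- c :* y) :+ v :* (z :- c :* w)
               := (u :* x :+ v :* z) :- c :* (u :* y :+ v :* w)) refl _ _ _ _ _ _ _ ⟩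
      shifted (suc r) f (variables (a ∷ as)) - factor (nth (beta as) r) *
        (f (q * x) * shifted r (λ y → f y * (y - q * x)) (variables (decrement r as))
          + (x - 1#) * f x * shifted r (λ y → f y * (y - x)) (variables (decrement r as)))
        ≡⟨ ≡.cong (λ n → shifted (suc r) f (variables (a ∷ as)) - factor (nth (beta as) r) *
             shifted (suc r) f (q ^ (a ℕ.+ n) ∷ variables (decrement r as))) (length-decrement r as) ⟨
      _ ∎
      where x = q ^ (a ℕ.+ length as)

    pochhammers-decrement : ∀ r as → 0 ℕ.< nth as r →
      pochhammers as ≈ factor (nth (beta as) r) * pochhammers (decrement r as)
    pochhammers-decrement zero    (suc a ∷ as) _   =
      trans (*-congʳ (pochhammer-suc (a ℕ.+ length as))) (*-assoc _ _ _)
    pochhammers-decrement (suc r) (a ∷ as)     0<a = begin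
      pochhammer (a ℕ.+ length as) * pochhammers as
        ≈⟨ *-cong (reflexive (≡.cong (λ n → pochhammer (a ℕ.+ n)) (≡.sym (length-decrement r as)))) (pochhammers-decrement r as 0<a) ⟩
      pochhammer (a ℕ.+ length (decrement r as)) * (factor (nth (beta as) r) * pochhammers (decrement r as))
        ≈⟨ solve 3 (λ a b c → a :* (b :* c) := b :* (a :* c)) refl _ _ _ ⟩
      factor (nth (beta as) r) * (pochhammer (a ℕ.+ length (decrement r as)) * pochhammers (decrement r as)) ∎

    -- The generating function of maj after adding the cell n + 1 in row s.
    wordSum : ℕ → List ℕ → ℕ → Carrier
    wordSum n as s = ∑ (λ w → q ^ majʷ (s ∷ w)) (words n as)

    corners : List ℕ → List ℕ
    corners as = filter (corner? as) (upTo (length as))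

    -- Here p is the weight of a new descent. The row s enters only through the comparisons with r,
    -- so the values at s and s + 1 can differ only in the term r = s.
    weightedSum : Carrier → (ℕ → Carrier) → List ℕ → ℕ → Carrier
    weightedSum p t rs s = ∑ (λ r → (if r <ᵇ s then p else 1#) * t r) rs

    wordSum-suc : ∀ n as s →
      wordSum (suc n) as s ≈ weightedSum (q ^ suc n) (λ r → wordSum n (decrement r as) r) (corners as) s
    wordSum-suc n as s = begin
      wordSum (suc n) as s
        ≈⟨ ∑-concatMap _ (λ r → map (r ∷_) (words n (decrement r as))) (corners as) ⟩
      ∑ (λ r → ∑ (λ w → q ^ majʷ (s ∷ w)) (map (r ∷_) (words n (decrement r as)))) (corners as)
        ≈⟨ ∑-cong (corners as) (λ r _ → trans (∑-map _ (r ∷_) (words n (decrement r as)))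
             (trans (∑-cong (words n (decrement r as)) (weight r)) (∑-*ˡ _ _ (words n (decrement r as))))) ⟩
      weightedSum (q ^ suc n) (λ r → wordSum n (decrement r as) r) (corners as) s ∎
      where
      weight : ∀ r w → w ∈ words n (decrement r as) →
        q ^ majʷ (s ∷ r ∷ w) ≈ (if r <ᵇ s then q ^ suc n else 1#) * q ^ majʷ (r ∷ w)
      weight r w w∈ with r <ᵇ s
      ... | true  rewrite length-words n _ w∈ = trans (^-homo-* q (majʷ (r ∷ w)) (suc n)) (*-comm _ _)
      ... | false = trans (reflexive (≡.cong (q ^_) (ℕ.+-identityʳ (majʷ (r ∷ w))))) (sym (*-identityˡ _))

    weightedSum-all : ∀ p t rs s → All (ℕ._< s) rs → weightedSum p t rs s ≈ p * weightedSum p t rs 0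
    weightedSum-all p t rs s rs<s = trans
      (∑-cong rs (λ r r∈ → trans (*-congʳ (reflexive (≡.cong (if_then p else 1#) (<⇒<ᵇ≡true (All.lookup rs<s r∈)))))
        (*-congˡ (sym (*-identityˡ (t r))))))
      (∑-*ˡ p _ rs)

    private
      <ᵇ-suc : ∀ {r s} → r ≢ s → (r <ᵇ suc s) ≡ (r <ᵇ s)
      <ᵇ-suc {r} {s} r≢s with r ℕ.<? s
      ... | yes r<s = ≡.trans (<⇒<ᵇ≡true (ℕ.m<n⇒m<1+n r<s)) (≡.sym (<⇒<ᵇ≡true r<s))
      ... | no  r≮s = ≡.trans (≮⇒<ᵇ≡false (λ r<1+s → r≮s (ℕ.≤∧≢⇒< (ℕ.s≤s⁻¹ r<1+s) r≢s))) (≡.sym (≮⇒<ᵇ≡false r≮s))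

    weightedSum-∉ : ∀ p t rs s → All (_≢ s) rs → weightedSum p t rs s ≈ weightedSum p t rs (suc s)
    weightedSum-∉ p t rs s rs≢s =
      ∑-cong rs (λ r r∈ → *-congʳ (reflexive (≡.cong (if_then p else 1#) (≡.sym (<ᵇ-suc (All.lookup rs≢s r∈))))))

    weightedSum-∈ : ∀ p t rs s → Unique rs → s ∈ rs →
      weightedSum p t rs s ≈ weightedSum p t rs (suc s) + (1# - p) * t s
    weightedSum-∈ p t (s ∷ rs) .s (s∉ ∷ _) (here ≡.refl)
      rewrite ≮⇒<ᵇ≡false (ℕ.n≮n s) | <⇒<ᵇ≡true (ℕ.n<1+n s) = begin
      1# * t s + weightedSum p t rs s                         ≈⟨ +-congˡ (weightedSum-∉ p t rs s (All.map (_∘ ≡.sym) s∉)) ⟩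
      1# * t s + weightedSum p t rs (suc s)                   ≈⟨ solve 3 (λ p t w → con (1 , 0) :* t :+ w := p :* t :+ w :+ (con (1 , 0) :- p) :* t) refl _ _ _ ⟩
      p * t s + weightedSum p t rs (suc s) + (1# - p) * t s   ∎
    weightedSum-∈ p t (r ∷ rs) s (r∉ ∷ unique) (there s∈) = begin
      _ ≈⟨ +-cong (*-congʳ (reflexive (≡.cong (if_then p else 1#) (≡.sym (<ᵇ-suc (All.lookup r∉ s∈)))))) (weightedSum-∈ p t rs s unique s∈) ⟩
      _ ≈⟨ +-assoc _ _ _ ⟨
      _ ∎

    corners-unique : ∀ as → Unique (corners as)
    corners-unique as = Unique.filter⁺ (corner? as) (Unique.upTo⁺ (length as))

    corners-< : ∀ as → All (ℕ._< length as) (corners as)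
    corners-< as = All.tabulate (λ r∈ → ∈-upTo⁻ (proj₁ (∈-filter⁻ (corner? as) r∈)))

    wordSum-all : ∀ n as → wordSum (suc n) as (length as) ≈ q ^ suc n * wordSum (suc n) as 0
    wordSum-all n as = trans (wordSum-suc n as (length as))
      (trans (weightedSum-all _ _ (corners as) (length as) (corners-< as)) (*-congˡ (sym (wordSum-suc n as 0))))

    wordSum-no-corner : ∀ n as r → ¬ Corner as r → wordSum (suc n) as r ≈ wordSum (suc n) as (suc r)
    wordSum-no-corner n as r ¬corner = trans (wordSum-suc n as r) (trans
      (weightedSum-∉ _ _ (corners as) r
        (All.tabulate λ r′∈ → λ { ≡.refl → ¬corner (proj₂ (∈-filter⁻ (corner? as) {xs = upTo (length as)} r′∈)) }))
      (sym (wordSum-suc n as (suc r))))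

    wordSum-corner : ∀ n as r → r ℕ.< length as → Corner as r →
      wordSum (suc n) as r ≈ wordSum (suc n) as (suc r) + factor (suc n) * wordSum n (decrement r as) r
    wordSum-corner n as r r< corner = trans (wordSum-suc n as r) (trans
      (weightedSum-∈ _ _ (corners as) r (corners-unique as) (∈-filter⁺ (corner? as) (∈-upTo⁺ r<) corner))
      (+-congʳ (sym (wordSum-suc n as (suc r)))))

    module _ (c : ℕ) where

      -- The recurrences are homogeneous, so c is arbitrary here and is fixed only by the empty
      -- shape in `claim`. It then depends on the number of rows alone, which does not change when
      -- cells are removed.
      Claim : ℕ → List ℕ → ℕ → Set
      Claim n as r = q ^ c * pochhammers as * wordSum n as r ≈ pochhammer n * shifted r one (variables as)

      private
        defect : ℕ → List ℕ → ℕ → Carrier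
        defect n as r = q ^ c * pochhammers as * wordSum n as r - pochhammer n * shifted r one (variables as)

      -- At a corner, passing from r + 1 to r adds to both sides (1 - q^(n + 1)) (1 - q^(β_r)) times
      -- the corresponding side for the shape without the corner; these agree by the claim for that
      -- shape. Elsewhere neither side changes.
      defect-step : ∀ n as r → Decreasing as → r ℕ.< length as →
        (Corner as r → Claim n (decrement r as) r) → defect (suc n) as r ≈ defect (suc n) as (suc r)
      defect-step n as r dec r< claim with corner? as r
      ... | no ¬corner = +-cong (*-congˡ (wordSum-no-corner n as r ¬corner))
                                (-‿cong (*-congˡ (sym (shifted-no-corner r as one dec r< ¬corner))))
      ... | yes corner = begin
        C * Q * wordSum (suc n) as r - P * S
          ≈⟨ +-congʳ (*-cong (*-congˡ (pochhammers-decrement r as (ℕ.≤-<-trans z≤n corner))) (wordSum-corner n as r r< corner)) ⟩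
        C * (b * Q′) * (wordSum (suc n) as (suc r) + factor (suc n) * N′) - P * S
          ≈⟨ solve 8 (λ C b Q′ N f N′ P S → C :* (b :* Q′) :* (N :+ f :* N′) :- P :* S
               := C :* (b :* Q′) :* N :+ f :* b :* (C :* Q′ :* N′) :- P :* S) refl _ _ _ _ _ _ _ _ ⟩
        C * (b * Q′) * wordSum (suc n) as (suc r) + factor (suc n) * b * (C * Q′ * N′) - P * S
          ≈⟨ +-cong (+-cong (*-congʳ (*-congˡ (sym (pochhammers-decrement r as (ℕ.≤-<-trans z≤n corner))))) (*-congˡ (claim corner)))
                    (-‿cong (*-congʳ (pochhammer-suc n))) ⟩
        C * Q * wordSum (suc n) as (suc r) + factor (suc n) * b * (pochhammer n * S′) - factor (suc n) * pochhammer n * S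
          ≈⟨ solve 6 (λ N f b p S′ S → N :+ f :* b :* (p :* S′) :- f :* p :* S := N :- f :* p :* (S :- b :* S′)) refl _ _ _ _ _ _ ⟩
        C * Q * wordSum (suc n) as (suc r) - factor (suc n) * pochhammer n * (S - b * S′)
          ≈⟨ +-congˡ (-‿cong (*-cong (sym (pochhammer-suc n)) (sym (shifted-corner r as one r< corner)))) ⟩
        defect (suc n) as (suc r) ∎
        where
        C  = q ^ c
        Q  = pochhammers as
        Q′ = pochhammers (decrement r as)
        N′ = wordSum n (decrement r as) r
        P  = pochhammer (suc n)
        S  = shifted r one (variables as)
        S′ = shifted r one (variables (decrement r as))
        b  = factor (nth (beta as) r)

      -- The defect does not depend on the row, but it is also multiplied by
      -- qⁿ⁺¹ when passing from the first row to below the last one.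
      claim-suc : ∀ n as → Decreasing as → sum as ≡ suc n →
        (∀ r → r ℕ.< length as → Corner as r → Claim n (decrement r as) r) →
        ∀ r → r ℕ.≤ length as → Claim (suc n) as r
      claim-suc n as dec sum≡ claim r r≤ = x∙y⁻¹≈ε⇒x≈y _ _ (trans (sym (constant r r≤)) defect≈0)
        where
        d = defect (suc n) as

        constant : ∀ r → r ℕ.≤ length as → d 0 ≈ d r
        constant zero    _  = refl
        constant (suc r) r< = trans (constant r (ℕ.<⇒≤ r<)) (defect-step n as r dec r< (claim r r<))

        defect≈0 : d 0 ≈ 0#
        defect≈0 = factor-cancellable {suc n} (λ ()) (d 0) (begin
          (1# - q ^ suc n) * d 0       ≈⟨ solve 2 (λ p d → (con (1 , 0) :- p) :* d := d :- p :* d) refl _ _ ⟩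
          d 0 - q ^ suc n * d 0        ≈⟨ +-congʳ (constant (length as) ℕ.≤-refl) ⟩
          d (length as) - q ^ suc n * d 0
            ≈⟨ +-congʳ (+-cong (*-congˡ (wordSum-all n as)) (-‿cong (*-congˡ
                 (trans (shifted-all-variables as dec) (*-congʳ (reflexive (≡.cong (q ^_) sum≡))))))) ⟩
          _ ≈⟨ solve 5 (λ A N P S p → A :* (p :* N) :- P :* (p :* S) :- p :* (A :* N :- P :* S) := con (0 , 0)) refl _ _ _ _ _ ⟩
          0# ∎)

    hookProduct-zero : ∀ as → sum as ≡ 0 → hookProduct as ≈ 1#
    hookProduct-zero []          _  = refl
    hookProduct-zero (zero ∷ as) eq = hookProduct-zero as eq

    shifted-zero : ∀ as → Decreasing as → sum as ≡ 0 → ∀ r → r ℕ.≤ length as →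
      shifted r one (variables as) ≈ shifted 0 one (variables as)
    shifted-zero as dec sum≡0 zero    _  = refl
    shifted-zero as dec sum≡0 (suc r) r< = trans
      (shifted-no-corner r as one dec r< (λ corner → ℕ.n≮0 (≡.subst (nth as (suc r) ℕ.<_) (sum≡0⇒nth≡0 as r sum≡0) corner)))
      (shifted-zero as dec sum≡0 r (ℕ.<⇒≤ r<))

    sum≡0⇒replicate : ∀ as → sum as ≡ 0 → as ≡ replicate (length as) 0
    sum≡0⇒replicate []          _  = ≡.refl
    sum≡0⇒replicate (zero ∷ as) eq = ≡.cong (0 ∷_) (sum≡0⇒replicate as eq)

    -- The power of q in `shifted 0 one (variables as)`. Subtracting its value for the empty shape
    -- with equally many rows leaves ∑ (i - 1) λ_i, with rows numbered from 1; this is the exponent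
    -- b.
    exponent : List ℕ → ℕ
    exponent as = triangular (length as) ℕ.+ betaSums as

    claim : ∀ n as → Decreasing as → sum as ≡ n → ∀ r → r ℕ.≤ length as →
            Claim (exponent (replicate (length as) 0)) n as r
    claim zero    as dec sum≡ r r≤ = begin
      q ^ exponent (replicate (length as) 0) * pochhammers as * (1# + 0#)
        ≡⟨ ≡.cong (λ bs → q ^ exponent bs * pochhammers as * (1# + 0#)) (≡.sym (sum≡0⇒replicate as sum≡)) ⟩
      q ^ exponent as * pochhammers as * (1# + 0#)
        ≈⟨ *-congʳ (*-congˡ (trans (pochhammers≈hooks*differences as dec) (*-congʳ (hookProduct-zero as sum≡)))) ⟩
      q ^ exponent as * (1# * differences as) * (1# + 0#)
        ≈⟨ solve 2 (λ a b → a :* (con (1 , 0) :* b) :* (con (1 , 0) :+ con (0 , 0)) := con (1 , 0) :* (a :* b)) refl _ _ ⟩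
      1# * (q ^ exponent as * differences as)
        ≈⟨ *-congˡ (trans (shifted-zero as dec sum≡ r r≤) (shifted-none-variables as dec)) ⟨
      1# * shifted r one (variables as) ∎
    claim (suc n) as dec sum≡ = claim-suc (exponent (replicate (length as) 0)) n as dec sum≡ λ r r< corner →
      ≡.subst (λ ℓ → Claim (exponent (replicate ℓ 0)) n (decrement r as) r) (length-decrement r as)
        (claim n (decrement r as) (decreasing-decrement {as} {r} dec corner)
          (ℕ.suc-injective (≡.trans (sum-decrement r as (ℕ.≤-<-trans z≤n corner)) sum≡))
          r (≡.subst (r ℕ.≤_) (≡.sym (length-decrement r as)) (ℕ.<⇒≤ r<)))

    -- This is the claim for row 0, where a cell n + 1 creates no descent. The pochhammers split
    -- into hooks and differences, and the differences also occur on the other side and cancel.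
    q-hook-formula : ∀ as → Decreasing as →
      ∑ (λ w → q ^ majʷ w) (words (sum as) as) * hookProduct as * q ^ exponent (replicate (length as) 0)
        ≈ pochhammer (sum as) * q ^ exponent as
    q-hook-formula as dec = cancel (differences-cancellable as dec) (begin
      D * (∑ (λ w → q ^ majʷ w) (words n as) * H * q ^ c)
        ≈⟨ *-congˡ (*-congʳ (*-congʳ (∑-cong (words n as) (λ w _ → reflexive (≡.cong (q ^_) (majʷ-0∷ w)))))) ⟩
      D * (wordSum n as 0 * H * q ^ c)
        ≈⟨ solve 4 (λ D N H C → D :* (N :* H :* C) := C :* (H :* D) :* N) refl _ _ _ _ ⟩
      q ^ c * (H * D) * wordSum n as 0
        ≈⟨ *-congʳ (*-congˡ (pochhammers≈hooks*differences as dec)) ⟨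
      q ^ c * pochhammers as * wordSum n as 0
        ≈⟨ claim n as dec ≡.refl 0 z≤n ⟩
      pochhammer n * shifted 0 one (variables as)
        ≈⟨ *-congˡ (shifted-none-variables as dec) ⟩
      pochhammer n * (q ^ exponent as * D)
        ≈⟨ solve 3 (λ p e D → p :* (e :* D) := D :* (p :* e)) refl _ _ _ ⟩
      D * (pochhammer n * q ^ exponent as) ∎)
      where
      n = sum as
      c = exponent (replicate (length as) 0)
      D = differences as
      H = hookProduct as

      majʷ-0∷ : ∀ w → majʷ w ≡ majʷ (0 ∷ w)
      majʷ-0∷ []      = ≡.refl
      majʷ-0∷ (r ∷ w) = ≡.sym (ℕ.+-identityʳ _)

-- Words and tableaux determine each other; descents

module Tableaux where

  open import Level using (0ℓ)
  open import Data.List.Base using (List; []; _∷_; [_]; length; map; upTo; _++_; applyUpTo; filter; _∷ʳ_)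
  open import Data.List.Properties using (filter-++; applyUpTo-∷ʳ)
  open import Data.List.Membership.Propositional using (_∈_)
  open import Data.List.Membership.Propositional.Properties using (∈-filter⁺; ∈-filter⁻; ∈-upTo⁺; ∈-upTo⁻; ∈-concatMap⁻; ∈-concatMap⁺; ∈-map⁻; ∈-map⁺; ∈-∃++)
  open import Data.List.Relation.Binary.Disjoint.Propositional using (Disjoint)
  open import Data.List.Relation.Binary.Permutation.Propositional as ↭ using (_↭_; ↭-sym; ↭-trans)
  import Data.List.Relation.Binary.Permutation.Propositional.Properties as ↭
  open import Data.List.Relation.Unary.All as All using (All; []; _∷_)
  import Data.List.Relation.Unary.All.Properties as All
  open import Data.List.Relation.Unary.AllPairs as AllPairs using (AllPairs; []; _∷_)
  import Data.List.Relation.Unary.AllPairs.Properties as AllPairs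
  open import Data.List.Relation.Unary.Any as Any using (here; there)
  open import Data.List.Relation.Unary.Unique.Propositional using (Unique)
  import Data.List.Relation.Unary.Unique.Propositional.Properties as Unique
  open import Data.Nat.Base as ℕ using (ℕ; zero; suc; _<ᵇ_; z≤n; s≤s; _<_; _≤_; pred; z<s; _∸_; _+_)
  open import Data.Nat.Properties
  open import Data.Nat.ListAction using (sum)
  open import Data.Nat.ListAction.Properties using (sum-++)
  open import Data.Product.Base using (∃; ∃₂; _×_; _,_; proj₁; proj₂)
  open import Data.Sum.Base using (_⊎_; inj₁; inj₂)
  open import Data.Empty using (⊥-elim)
  open import Function.Base using (_∘_)
  open import Relation.Binary.PropositionalEquality hiding ([_])
  open import Relation.Nullary using (yes; no; ¬_)
  open import Relation.Nullary.Decidable using (_×-dec_)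
  open import Relation.Unary using (Pred; Decidable)
  open Shapes
  open HookFormula using (<⇒<ᵇ≡true; ≮⇒<ᵇ≡false; length-words)

  words-∷⁻ : ∀ n as {w} → w ∈ words (suc n) as →
    ∃₂ λ r w′ → w ≡ r ∷ w′ × r < length as × Corner as r × w′ ∈ words n (decrement r as)
  words-∷⁻ n as w∈ =
    let r , r∈ , w∈r       = find (∈-concatMap⁻ (λ r → map (r ∷_) (words n (decrement r as))) {xs = corners} w∈)
        w′ , w′∈ , eq      = ∈-map⁻ (r ∷_) w∈r
        r∈upTo , corner    = ∈-filter⁻ (corner? as) {xs = upTo (length as)} r∈
    in r , w′ , eq , ∈-upTo⁻ r∈upTo , corner , w′∈
    where
    open import Data.List.Membership.Propositional using (find)
    corners = filter (corner? as) (upTo (length as))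

  words-∷⁺ : ∀ n as {r w} → r < length as → Corner as r → w ∈ words n (decrement r as) → r ∷ w ∈ words (suc n) as
  words-∷⁺ n as {r} r< corner w∈ =
    ∈-concatMap⁺ (λ r → map (r ∷_) (words n (decrement r as)))
      (lose (∈-filter⁺ (corner? as) (∈-upTo⁺ r<) corner) (∈-map⁺ (r ∷_) w∈))
    where open import Data.List.Membership.Propositional using (lose)

  words-unique : ∀ n as → Unique (words n as)
  words-unique zero    as = [] ∷ []
  words-unique (suc n) as = Unique.concat⁺
    (All.map⁺ (All.tabulate λ {r} _ → Unique.map⁺ (λ { refl → refl }) (words-unique n (decrement r as))))
    (AllPairs.map⁺ (AllPairs.map disjoint (Unique.filter⁺ (corner? as) (Unique.upTo⁺ (length as)))))
    where
    disjoint : ∀ {r r′} → r ≢ r′ →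
      Disjoint (map (r ∷_) (words n (decrement r as))) (map (r′ ∷_) (words n (decrement r′ as)))
    disjoint {r} {r′} r≢r′ (w∈ , w∈′) with ∈-map⁻ (r ∷_) w∈ | ∈-map⁻ (r′ ∷_) w∈′
    ... | _ , _ , refl | _ , _ , refl = r≢r′ refl

  -- The tableau of shape as given by a word; the cell of the head r of the word
  -- is the last one in row r.
  place : List ℕ → List ℕ → ℕ → ℕ → ℕ
  place []      as i j = 0
  place (r ∷ w) as i j with (i ≟ r) ×-dec (j ≟ nth (decrement r as) r)
  ... | yes _ = suc (length w)
  ... | no  _ = place w (decrement r as) i j

  place-new : ∀ r w as → place (r ∷ w) as r (nth (decrement r as) r) ≡ suc (length w)
  place-new r w as with (r ≟ r) ×-dec (nth (decrement r as) r ≟ nth (decrement r as) r)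
  ... | yes _ = refl
  ... | no ¬p = ⊥-elim (¬p (refl , refl))

  place-old : ∀ r w as i j → j < nth (decrement r as) i → place (r ∷ w) as i j ≡ place w (decrement r as) i j
  place-old r w as i j j< with (i ≟ r) ×-dec (j ≟ nth (decrement r as) r)
  ... | yes (refl , refl) = ⊥-elim (<-irrefl refl j<)
  ... | no  _             = refl

  nth<⇒<length : ∀ as i {j} → j < nth as i → i < length as
  nth<⇒<length (a ∷ as) zero    j< = z<s
  nth<⇒<length (a ∷ as) (suc i) j< = s≤s (nth<⇒<length as i j<)

  corner-positive : ∀ as r → Corner as r → 0 < nth as r
  corner-positive as r = ≤-<-trans z≤n

  new-cell : ∀ as r → Corner as r → nth (decrement r as) r < nth as r
  new-cell as r corner rewrite nth-decrement-≡ r as with nth as r | corner-positive as r corner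
  ... | suc _ | _ = ≤-refl

  cell-cases : ∀ as r i j → j < nth as i → (i ≡ r × j ≡ nth (decrement r as) r) ⊎ j < nth (decrement r as) i
  cell-cases as r i j j< with i ≟ r
  ... | no  i≢r  = inj₂ (subst (j <_) (sym (nth-decrement-≢ r as i i≢r)) j<)
  ... | yes refl with m≤n⇒m<n∨m≡n (<⇒≤pred j<)
  ... | inj₁ j<′ = inj₂ (subst (j <_) (sym (nth-decrement-≡ r as)) j<′)
  ... | inj₂ j≡  = inj₁ (refl , trans j≡ (sym (nth-decrement-≡ r as)))

  old-cell : ∀ as r {i j} → j < nth (decrement r as) i → j < nth as i
  old-cell as r {i} j< = <-≤-trans j< (nth-decrement-≤ r as i)

  decreasing-≤ : ∀ {as} → Decreasing as → ∀ {i i′} → i ≤ i′ → nth as i′ ≤ nth as i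
  decreasing-≤ {as} dec {i} {i′} i≤i′ with m≤n⇒m<n∨m≡n i≤i′
  ... | inj₂ refl = ≤-refl
  decreasing-≤ {as} dec {i} {suc i′} _ | inj₁ (s≤s i≤i′) = ≤-trans (dec i′) (decreasing-≤ {as} dec i≤i′)

  -- Labels are a total function of the coordinates, constrained only on the cells of the shape, so
  -- that the same `L` serves for the shape with a corner removed.
  record IsTableau (n : ℕ) (as : List ℕ) (L : ℕ → ℕ → ℕ) : Set where
    field
      nonzero    : ∀ {i j} → j < nth as i → 0 < L i j
      bounded    : ∀ {i j} → j < nth as i → L i j ≤ n
      injective  : ∀ {i j i′ j′} → j < nth as i → j′ < nth as i′ → L i j ≡ L i′ j′ → i ≡ i′ × j ≡ j′
      surjective : ∀ {k} → 0 < k → k ≤ n → ∃₂ λ i j → j < nth as i × L i j ≡ k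
      rightwards : ∀ {i j j′} → j < j′ → j′ < nth as i → L i j < L i j′
      downwards  : ∀ {i i′ j} → i < i′ → j < nth as i → j < nth as i′ → L i j < L i′ j

  open IsTableau

  -- The head of the word puts the largest label into a corner, where it ends its row and its
  -- column; all other conditions concern the smaller shape.
  place-tableau : ∀ n as {w} → w ∈ words n as → Decreasing as → sum as ≡ n → IsTableau n as (place w as)
  place-tableau zero as _ dec sum≡ = record
    { nonzero    = λ {i} j< → ⊥-elim (empty i j<)
    ; bounded    = λ {i} j< → ⊥-elim (empty i j<)
    ; injective  = λ {i} j< → ⊥-elim (empty i j<)
    ; surjective = λ 0<k k≤0 → ⊥-elim (<⇒≱ 0<k k≤0)
    ; rightwards = λ {i} _ j< → ⊥-elim (empty i j<)
    ; downwards  = λ {i} _ j< → ⊥-elim (empty i j<)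
    }
    where
    empty : ∀ i {j} → ¬ j < nth as i
    empty i j< = n≮0 (subst (_ <_) (sum≡0⇒nth≡0 as i sum≡) j<)
  place-tableau (suc n) as w∈ dec sum≡ with words-∷⁻ n as w∈
  ... | r , w , refl , r< , corner , w∈′ = record
    { nonzero    = nonzero′
    ; bounded    = bounded′
    ; injective  = injective′
    ; surjective = surjective′
    ; rightwards = rightwards′
    ; downwards  = downwards′
    }
    where
    bs = decrement r as
    L  = place (r ∷ w) as

    T : IsTableau n bs (place w bs)
    T = place-tableau n bs w∈′ (decreasing-decrement {as} {r} dec corner)
          (suc-injective (trans (sum-decrement r as (corner-positive as r corner)) sum≡))

    new : L r (nth bs r) ≡ suc n
    new = trans (place-new r w as) (cong suc (length-words n bs w∈′))

    old : ∀ {i j} → j < nth bs i → L i j ≡ place w bs i j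
    old = place-old r w as _ _

    old-≤ : ∀ {i j} → j < nth bs i → L i j ≤ n
    old-≤ j< = ≤-trans (≤-reflexive (old j<)) (bounded T j<)

    nonzero′ : ∀ {i j} → j < nth as i → 0 < L i j
    nonzero′ {i} {j} j< with cell-cases as r i j j<
    ... | inj₁ (refl , refl) = subst (0 <_) (sym new) z<s
    ... | inj₂ j<′           = subst (0 <_) (sym (old j<′)) (nonzero T j<′)

    bounded′ : ∀ {i j} → j < nth as i → L i j ≤ suc n
    bounded′ {i} {j} j< with cell-cases as r i j j<
    ... | inj₁ (refl , refl) = ≤-reflexive new
    ... | inj₂ j<′           = m≤n⇒m≤1+n (old-≤ j<′)

    injective′ : ∀ {i j i′ j′} → j < nth as i → j′ < nth as i′ → L i j ≡ L i′ j′ → i ≡ i′ × j ≡ j′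
    injective′ {i} {j} {i′} {j′} j< j′< eq with cell-cases as r i j j< | cell-cases as r i′ j′ j′<
    ... | inj₁ (refl , refl) | inj₁ (refl , refl) = refl , refl
    ... | inj₁ (refl , refl) | inj₂ j′<′ = ⊥-elim (1+n≰n (subst (_≤ n) (trans (sym eq) new) (old-≤ j′<′)))
    ... | inj₂ j<′ | inj₁ (refl , refl)  = ⊥-elim (1+n≰n (subst (_≤ n) (trans eq new) (old-≤ j<′)))
    ... | inj₂ j<′ | inj₂ j′<′ = injective T j<′ j′<′ (trans (sym (old j<′)) (trans eq (old j′<′)))

    surjective′ : ∀ {k} → 0 < k → k ≤ suc n → ∃₂ λ i j → j < nth as i × L i j ≡ k
    surjective′ 0<k k≤ with m≤n⇒m<n∨m≡n k≤
    ... | inj₂ refl      = r , nth bs r , new-cell as r corner , new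
    ... | inj₁ (s≤s k≤n) with surjective T 0<k k≤n
    ... | i , j , j< , eq = i , j , old-cell as r j< , trans (old j<) eq

    rightwards′ : ∀ {i j j′} → j < j′ → j′ < nth as i → L i j < L i j′
    rightwards′ {i} {j} {j′} j<j′ j′< with cell-cases as r i j′ j′<
    ... | inj₁ (refl , refl) = subst (L i j <_) (sym new) (s≤s (old-≤ j<j′))
    ... | inj₂ j′<′ = subst₂ _<_ (sym (old (<-trans j<j′ j′<′))) (sym (old j′<′)) (rightwards T j<j′ j′<′)

    downwards′ : ∀ {i i′ j} → i < i′ → j < nth as i → j < nth as i′ → L i j < L i′ j
    downwards′ {i} {i′} {j} i<i′ j< j<′ with cell-cases as r i′ j j<′ | cell-cases as r i j j<
    ... | inj₁ (refl , refl) | inj₁ (refl , _) = ⊥-elim (<-irrefl refl i<i′)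
    ... | inj₁ (refl , refl) | inj₂ jold       = subst (L i j <_) (sym new) (s≤s (old-≤ jold))
    -- The new cell lies just beyond row r of `bs`, so no lower row of `bs` can reach its column.
    ... | inj₂ jold′ | inj₁ (refl , refl) =
      ⊥-elim (<⇒≱ jold′ (decreasing-≤ {bs} (decreasing-decrement {as} {r} dec corner) (<⇒≤ i<i′)))
    ... | inj₂ jold′ | inj₂ jold = subst₂ _<_ (sym (old jold)) (sym (old jold′)) (downwards T i<i′ jold jold′)

  -- A neighbour to the right of or below the label n + 1 would need a larger label, so this label
  -- sits in a corner. Its row is the head of the word, and what remains is a tableau with the same
  -- labels.
  tableau-word : ∀ n as L → Decreasing as → sum as ≡ n → IsTableau n as L →
    ∃ λ w → w ∈ words n as × (∀ {i j} → j < nth as i → L i j ≡ place w as i j)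
  tableau-word zero    as L dec sum≡ T =
    [] , here refl , λ {i} j< → ⊥-elim (n≮0 (subst (_ <_) (sum≡0⇒nth≡0 as i sum≡) j<))
  tableau-word (suc n) as L dec sum≡ T with surjective T {suc n} z<s ≤-refl
  ... | r , c , c< , Lrc≡ =
    let w , w∈ , L≡ = tableau-word n bs L (decreasing-decrement {as} {r} dec corner)
                        (suc-injective (trans (sum-decrement r as (corner-positive as r corner)) sum≡)) T′
    in r ∷ w , words-∷⁺ n as (nth<⇒<length as r c<) corner w∈ , λ {i} {j} j< → labels w w∈ L≡ i j j< (cell-cases as r i j j<)
    where
    bs = decrement r as

    nth≡ : nth as r ≡ suc c
    nth≡ with m≤n⇒m<n∨m≡n c<
    ... | inj₂ eq = sym eq
    ... | inj₁ c+1< = ⊥-elim (<⇒≱ (subst (_< L r (suc c)) Lrc≡ (rightwards T ≤-refl c+1<)) (bounded T c+1<))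

    corner : Corner as r
    corner with nth as (suc r) ≤? c
    ... | yes ≤c = ≤-<-trans ≤c c<
    ... | no  ≰c = ⊥-elim (<⇒≱ (subst (_< L (suc r) c) Lrc≡ (downwards T ≤-refl c< (≰⇒> ≰c))) (bounded T (≰⇒> ≰c)))

    nth-bs : nth bs r ≡ c
    nth-bs = trans (nth-decrement-≡ r as) (cong pred nth≡)

    T′ : IsTableau n bs L
    T′ = record
      { nonzero    = λ j< → nonzero T (old-cell as r j<)
      ; bounded    = bounded′
      ; injective  = λ j< j′< → injective T (old-cell as r j<) (old-cell as r j′<)
      ; surjective = surjective′
      ; rightwards = λ j<j′ j′< → rightwards T j<j′ (old-cell as r j′<)
      ; downwards  = λ i<i′ j< j<′ → downwards T i<i′ (old-cell as r j<) (old-cell as r j<′)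
      }
      where
      bounded′ : ∀ {i j} → j < nth bs i → L i j ≤ n
      bounded′ {i} {j} j< with m≤n⇒m<n∨m≡n (bounded T (old-cell as r j<))
      ... | inj₁ (s≤s ≤n) = ≤n
      ... | inj₂ eq with injective T (old-cell as r j<) c< (trans eq (sym Lrc≡))
      ... | refl , refl = ⊥-elim (<-irrefl (sym nth-bs) j<)

      surjective′ : ∀ {k} → 0 < k → k ≤ n → ∃₂ λ i j → j < nth bs i × L i j ≡ k
      surjective′ 0<k k≤n with surjective T 0<k (m≤n⇒m≤1+n k≤n)
      ... | i , j , j< , eq with cell-cases as r i j j<
      ... | inj₂ j<′         = i , j , j<′ , eq
      ... | inj₁ (refl , j≡) = ⊥-elim (1+n≰n (subst (_≤ n) (trans (sym eq) (trans (cong (L r) (trans j≡ nth-bs)) Lrc≡)) k≤n))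

    labels : ∀ w → w ∈ words n bs → (∀ {i j} → j < nth bs i → L i j ≡ place w bs i j) →
      ∀ i j → j < nth as i → (i ≡ r × j ≡ nth bs r) ⊎ j < nth bs i → L i j ≡ place (r ∷ w) as i j
    labels w w∈ L≡ i j j< (inj₁ (refl , refl)) = begin
      L r (nth bs r)                ≡⟨ cong (L r) nth-bs ⟩
      L r c                         ≡⟨ Lrc≡ ⟩
      suc n                         ≡⟨ cong suc (length-words n bs w∈) ⟨
      suc (length w)                ≡⟨ place-new r w as ⟨
      place (r ∷ w) as r (nth bs r) ∎
      where open ≡-Reasoning
    labels w w∈ L≡ i j j< (inj₂ j<′) = trans (L≡ j<′) (sym (place-old r w as i j j<′))

  -- The head of a word is the row of the largest label, so it can be recovered from the labelling.
  place-injective : ∀ n as {w w′} → w ∈ words n as → w′ ∈ words n as → Decreasing as → sum as ≡ n →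
    (∀ {i j} → j < nth as i → place w as i j ≡ place w′ as i j) → w ≡ w′
  place-injective zero    as (here refl) (here refl) dec sum≡ eq = refl
  place-injective (suc n) as w∈ w′∈ dec sum≡ eq
    with T ← place-tableau (suc n) as w∈ dec sum≡ | words-∷⁻ n as w∈ | words-∷⁻ n as w′∈
  ... | r , w , refl , r< , corner , w∈₁ | r′ , w′ , refl , r′< , corner′ , w′∈₁
    with injective T (new-cell as r corner) (new-cell as r′ corner′)
           (trans (place-new r w as) (trans (cong suc (trans (length-words n _ w∈₁) (sym (length-words n _ w′∈₁))))
             (trans (sym (place-new r′ w′ as)) (sym (eq (new-cell as r′ corner′))))))
  ... | refl , _ = cong (r ∷_) (place-injective n (decrement r as) w∈₁ w′∈₁
    (decreasing-decrement {as} {r} dec corner)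
    (suc-injective (trans (sum-decrement r as (corner-positive as r corner)) sum≡))
    (λ {i} {j} j< → trans (sym (place-old r w as i j j<)) (trans (eq (old-cell as r j<)) (place-old r w′ as i j j<))))

  IsDescent : List ℕ → (ℕ → ℕ → ℕ) → ℕ → Set
  IsDescent as L k = ∃₂ λ i j → ∃₂ λ i′ j′ →
    j < nth as i × j′ < nth as i′ × L i j ≡ k × L i′ j′ ≡ suc k × i < i′

  -- P is compared with descents only for 0 < k < n. Hence the same decision procedure serves for
  -- the shape without the cell of n, whose descents are those below n - 1; the candidate n - 1
  -- gives the last summand of `majʷ`.
  sum-descents : ∀ n as {w} → w ∈ words n as → Decreasing as → sum as ≡ n →
    {P : Pred ℕ 0ℓ} (P? : Decidable P) →
    (∀ {k} → 0 < k → k < n → (P k → IsDescent as (place w as) k) × (IsDescent as (place w as) k → P k)) →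
    sum (filter P? (applyUpTo suc (n ∸ 1))) ≡ majʷ w
  sum-descents zero as (here refl) dec sum≡ P? P⇔ = refl
  sum-descents (suc n) as w∈ dec sum≡ P? P⇔ with T ← place-tableau (suc n) as w∈ dec sum≡ | words-∷⁻ n as w∈
  sum-descents (suc zero) as w∈ dec sum≡ P? P⇔ | r , _ , refl , _ , _ , here refl = refl
  sum-descents (suc (suc m)) as w∈ dec sum≡ {P} P? P⇔ | r , w′ , refl , r< , corner , w′∈
    with words-∷⁻ m (decrement r as) w′∈
  ... | r′ , w″ , refl , _ , corner′ , w″∈ = begin
    sum (filter P? (applyUpTo suc (suc m)))                          ≡⟨ cong (sum ∘ filter P?) (applyUpTo-∷ʳ suc m) ⟨
    sum (filter P? (applyUpTo suc m ∷ʳ suc m))                       ≡⟨ cong sum (filter-++ P? (applyUpTo suc m) [ suc m ]) ⟩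
    sum (filter P? (applyUpTo suc m) ++ filter P? [ suc m ])         ≡⟨ sum-++ (filter P? (applyUpTo suc m)) _ ⟩
    sum (filter P? (applyUpTo suc m)) + sum (filter P? [ suc m ])    ≡⟨ cong₂ _+_ (sum-descents (suc m) bs w′∈ dec′ sum′ P? old⇔) last ⟩
    majʷ (r ∷ r′ ∷ w″)                                               ∎
    where
    open ≡-Reasoning
    open import Data.Bool.Base using (if_then_else_)
    bs   = decrement r as
    L    = place (r ∷ r′ ∷ w″) as
    dec′ = decreasing-decrement {as} {r} dec corner
    sum′ = suc-injective (trans (sum-decrement r as (corner-positive as r corner)) sum≡)
    T′   = place-tableau (suc m) bs w′∈ dec′ sum′

    length-w″ : length w″ ≡ m
    length-w″ = length-words m _ w″∈

    new : L r (nth bs r) ≡ suc (suc m)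
    new = trans (place-new r (r′ ∷ w″) as) (cong (suc ∘ suc) length-w″)

    old : ∀ {i j} → j < nth bs i → L i j ≡ place (r′ ∷ w″) bs i j
    old = place-old r (r′ ∷ w″) as _ _

    is-old : ∀ {i j} → j < nth as i → L i j < suc (suc m) → j < nth bs i
    is-old {i} {j} j< L< with cell-cases as r i j j<
    ... | inj₁ (refl , refl) = ⊥-elim (<-irrefl new L<)
    ... | inj₂ j<′           = j<′

    old⇔ : ∀ {k} → 0 < k → k < suc m → (P k → IsDescent bs (place (r′ ∷ w″) bs) k) × (IsDescent bs (place (r′ ∷ w″) bs) k → P k)
    old⇔ {k} 0<k k< = to , from
      where
      to : P k → IsDescent bs (place (r′ ∷ w″) bs) k
      to p with proj₁ (P⇔ 0<k (m<n⇒m<1+n k<)) p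
      ... | i , j , i′ , j′ , j< , j′< , eq , eq′ , i<i′ =
        let jold  = is-old j< (subst (_< _) (sym eq) (m<n⇒m<1+n k<))
            j′old = is-old j′< (subst (_< _) (sym eq′) (s≤s k<))
        in i , j , i′ , j′ , jold , j′old , trans (sym (old jold)) eq , trans (sym (old j′old)) eq′ , i<i′

      from : IsDescent bs (place (r′ ∷ w″) bs) k → P k
      from (i , j , i′ , j′ , j< , j′< , eq , eq′ , i<i′) = proj₂ (P⇔ 0<k (m<n⇒m<1+n k<))
        (i , j , i′ , j′ , old-cell as r j< , old-cell as r j′< , trans (old j<) eq , trans (old j′<) eq′ , i<i′)

    new′ : nth (decrement r′ bs) r′ < nth bs r′
    new′ = new-cell bs r′ corner′

    L-new′ : L r′ (nth (decrement r′ bs) r′) ≡ suc m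
    L-new′ = trans (old new′) (trans (place-new r′ w″ bs) (cong suc length-w″))

    P⇒< : P (suc m) → r′ < r
    P⇒< p with proj₁ (P⇔ z<s ≤-refl) p
    ... | i , j , i′ , j′ , j< , j′< , eq , eq′ , i<i′
      with injective T j< (old-cell as r new′) (trans eq (sym L-new′))
         | injective T j′< (new-cell as r corner) (trans eq′ (sym new))
    ... | refl , _ | refl , _ = i<i′

    <⇒P : r′ < r → P (suc m)
    <⇒P r′<r = proj₂ (P⇔ z<s ≤-refl)
      (r′ , _ , r , _ , old-cell as r new′ , new-cell as r corner , L-new′ , new , r′<r)

    last : sum (filter P? [ suc m ]) ≡ (if r′ <ᵇ r then suc (length w″) else 0)
    last with P? (suc m)
    ... | yes p rewrite <⇒<ᵇ≡true (P⇒< p) | length-w″ = +-identityʳ (suc m)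
    ... | no ¬p rewrite ≮⇒<ᵇ≡false (¬p ∘ <⇒P) = refl

  -- R is a perfect matching between two lists without repetitions; the partner of the first element
  -- is taken out of `ys`. A relation is convenient since fillings and words are matched by having
  -- equal labels on all cells.
  map-↭-matching : {A B C : Set} (R : A → B → Set) (f : A → C) (g : B → C) (xs : List A) (ys : List B) →
    Unique xs → Unique ys →
    (∀ {x} → x ∈ xs → ∃ λ y → y ∈ ys × R x y) → (∀ {y} → y ∈ ys → ∃ λ x → x ∈ xs × R x y) →
    (∀ {x y y′} → x ∈ xs → y ∈ ys → y′ ∈ ys → R x y → R x y′ → y ≡ y′) →
    (∀ {x x′ y} → x ∈ xs → x′ ∈ xs → y ∈ ys → R x y → R x′ y → x ≡ x′) →
    (∀ {x y} → x ∈ xs → y ∈ ys → R x y → f x ≡ g y) → map f xs ↭ map g ys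
  map-↭-matching R f g []       []       _ _ _ _ _ _ _ = ↭.refl
  map-↭-matching R f g []       (y ∷ ys) _ _ _ from _ _ _ with from (here refl)
  ... | _ , () , _
  map-↭-matching R f g (x ∷ xs) ys (x∉xs ∷ xs!) ys! to from functional injective f≡g with to (here refl)
  ... | y , y∈ , Rxy with ∈-∃++ y∈
  ... | ys₁ , ys₂ , refl = ↭-trans
    (↭.trans (↭.↭-reflexive (cong (_∷ map f xs) (f≡g (here refl) y∈ Rxy)))
             (↭.prep (g y) (map-↭-matching R f g xs (ys₁ ++ ys₂) xs! ys′! to′ from′
               (λ x∈ y∈ y′∈ → functional (there x∈) (keep y∈) (keep y′∈))
               (λ x∈ x′∈ y∈ → injective (there x∈) (there x′∈) (keep y∈))
               (λ x∈ y∈ → f≡g (there x∈) (keep y∈)))))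
    (↭-sym (↭.map⁺ g (↭.shift y ys₁ ys₂)))
    where
    y∷ys! : Unique (y ∷ ys₁ ++ ys₂)
    y∷ys! = Unique-resp-↭ (↭.↭⇒↭ₛ (↭.shift y ys₁ ys₂)) ys!
      where open import Data.List.Relation.Binary.Permutation.Setoid.Properties (setoid _) using (Unique-resp-↭)

    ys′! : Unique (ys₁ ++ ys₂)
    ys′! with y∷ys!
    ... | _ ∷ u = u

    keep : ∀ {z} → z ∈ ys₁ ++ ys₂ → z ∈ ys₁ ++ y ∷ ys₂
    keep z∈ = ↭.∈-resp-↭ (↭-sym (↭.shift y ys₁ ys₂)) (there z∈)

    to′ : ∀ {x′} → x′ ∈ xs → ∃ λ z → z ∈ ys₁ ++ ys₂ × R x′ z
    to′ {x′} x′∈ with to (there x′∈)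
    ... | z , z∈ , Rx′z with ↭.∈-resp-↭ (↭.shift y ys₁ ys₂) z∈
    ... | there z∈′  = z , z∈′ , Rx′z
    ... | here refl = ⊥-elim (All.lookup x∉xs x′∈ (injective (here refl) (there x′∈) y∈ Rxy Rx′z))

    from′ : ∀ {z} → z ∈ ys₁ ++ ys₂ → ∃ λ x′ → x′ ∈ xs × R x′ z
    from′ {z} z∈ with from (keep z∈)
    ... | x′ , there x′∈ , Rx′z = x′ , x′∈ , Rx′z
    ... | _ , here refl , Rxz with y∷ys!
    ... | y∉ ∷ _ = ⊥-elim (All.lookup y∉ z∈ (functional (here refl) y∈ (keep z∈) Rxy Rxz))

-- Fillings as labellings; standard tableaux and words have the same values of maj

module Fillings where

  open import Data.Fin.Base using (Fin; zero; suc; toℕ; fromℕ<)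
  import Data.Fin.Properties as Fin
  open import Data.List.Base using (List; []; _∷_; length; lookup; map; allFin)
  open import Data.List.Membership.Propositional using (_∈_)
  open import Data.List.Membership.Propositional.Properties using (∈-filter⁺; ∈-filter⁻; ∈-lookup; ∈-allFin; ∈-cartesianProductWith⁺)
  open import Data.List.Relation.Binary.Permutation.Propositional using (_↭_)
  open import Data.List.Relation.Unary.All as All using (All; []; _∷_)
  open import Data.List.Relation.Unary.AllPairs as AllPairs using ([]; _∷_)
  open import Data.List.Relation.Unary.Any using (here)
  open import Data.List.Relation.Unary.Linked using (Linked; []; [-]; _∷_)
  open import Data.List.Relation.Unary.Unique.Propositional using (Unique)
  import Data.List.Relation.Unary.Unique.Propositional.Properties as Unique
  open import Data.Nat.Base as ℕ using (ℕ; zero; suc; z≤n; s≤s; _<_; _≤_; _≥_; z<s)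
  open import Data.Nat.Properties
  open import Data.Product.Base using (Σ; ∃; ∃₂; _×_; _,_; proj₁; proj₂)
  open import Data.Vec.Base as Vec using (Vec; []; _∷_)
  open import Function.Base using (_∘_)
  open import Function.Consequences.Propositional using (strictlySurjective⇒surjective; surjective⇒strictlySurjective)
  open import Relation.Binary.PropositionalEquality hiding ([_])
  open import Defs
  open Shapes
  open Tableaux

  CellOf : List ℕ → Set
  CellOf as = Σ (Fin (length as)) (Fin ∘ lookup as)

  rowOf : ∀ {ℓ} {P : Fin ℓ → Set} → Σ (Fin ℓ) P → ℕ
  rowOf = toℕ ∘ proj₁

  colOf : ∀ {ℓ} {m : Fin ℓ → ℕ} → Σ (Fin ℓ) (Fin ∘ m) → ℕ
  colOf = toℕ ∘ proj₂

  lookup≡nth : ∀ as i → lookup as i ≡ nth as (toℕ i)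
  lookup≡nth (a ∷ as) zero    = refl
  lookup≡nth (a ∷ as) (suc i) = lookup≡nth as i

  colOf< : ∀ as (c : CellOf as) → colOf c < nth as (rowOf c)
  colOf< as (i , j) = subst (toℕ j <_) (lookup≡nth as i) (Fin.toℕ<n j)

  cellAt : ∀ as i j → j < nth as i → Σ (CellOf as) λ c → rowOf c ≡ i × colOf c ≡ j
  cellAt (a ∷ as) zero    j j< = (zero , fromℕ< j<) , refl , Fin.toℕ-fromℕ< j<
  cellAt (a ∷ as) (suc i) j j< with cellAt as i j j<
  ... | (i′ , j′) , refl , eq = (suc i′ , j′) , refl , eq

  cell-≡ : ∀ as (c c′ : CellOf as) → rowOf c ≡ rowOf c′ → colOf c ≡ colOf c′ → c ≡ c′
  cell-≡ as (i , j) (i′ , j′) row≡ col≡ with Fin.toℕ-injective row≡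
  ... | refl = cong (i ,_) (Fin.toℕ-injective col≡)

  linked⇒decreasing : ∀ {as} → Linked _≥_ as → Decreasing as
  linked⇒decreasing []          i       = z≤n
  linked⇒decreasing [-]         zero    = z≤n
  linked⇒decreasing [-]         (suc i) = z≤n
  linked⇒decreasing (a≥b ∷ lnk) zero    = a≥b
  linked⇒decreasing (a≥b ∷ lnk) (suc i) = linked⇒decreasing lnk i

  module _ {n : ℕ} where

    rowLabels : ∀ {m} → Vec (Fin n) m → ℕ → ℕ
    rowLabels []      j       = 0
    rowLabels (x ∷ v) zero    = suc (toℕ x)
    rowLabels (x ∷ v) (suc j) = rowLabels v j

    labels : ∀ {ms} → All (Vec (Fin n)) ms → ℕ → ℕ → ℕ
    labels []       i       j = 0
    labels (v ∷ vs) zero    j = rowLabels v j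
    labels (v ∷ vs) (suc i) j = labels vs i j

    rowLabels-lookup : ∀ {m} (v : Vec (Fin n) m) j → suc (toℕ (Vec.lookup v j)) ≡ rowLabels v (toℕ j)
    rowLabels-lookup (x ∷ v) zero    = refl
    rowLabels-lookup (x ∷ v) (suc j) = rowLabels-lookup v j

    labels-lookup : ∀ {ms} (T : All (Vec (Fin n)) ms) (i : Fin (length ms)) (j : Fin (lookup ms i)) →
      suc (toℕ (Vec.lookup (All.lookup T (∈-lookup i)) j)) ≡ labels T (toℕ i) (toℕ j)
    labels-lookup (v ∷ vs) zero    j = rowLabels-lookup v j
    labels-lookup (v ∷ vs) (suc i) j = labels-lookup vs i j

    rowLabels-injective : ∀ {m} (v v′ : Vec (Fin n) m) → (∀ {j} → j < m → rowLabels v j ≡ rowLabels v′ j) → v ≡ v′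
    rowLabels-injective []      []        eq = refl
    rowLabels-injective (x ∷ v) (x′ ∷ v′) eq =
      cong₂ _∷_ (Fin.toℕ-injective (suc-injective (eq z<s))) (rowLabels-injective v v′ (λ j< → eq (s≤s j<)))

    labels-injective : ∀ {ms} (T T′ : All (Vec (Fin n)) ms) →
      (∀ {i j} → j < nth ms i → labels T i j ≡ labels T′ i j) → T ≡ T′
    labels-injective []       []         eq = refl
    labels-injective (v ∷ vs) (v′ ∷ vs′) eq =
      cong₂ _∷_ (rowLabels-injective v v′ (λ {j} → eq {0} {j})) (labels-injective vs vs′ (λ {i} → eq {suc i}))

    fill-row : ∀ m (L : ℕ → ℕ) → (∀ {j} → j < m → 0 < L j × L j ≤ n) →
      Σ (Vec (Fin n) m) λ v → ∀ {j} → j < m → rowLabels v j ≡ L j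
    fill-row zero    L bounds = [] , λ ()
    fill-row (suc m) L bounds with L 0 in L0≡ | bounds {0} z<s | fill-row m (L ∘ suc) (bounds ∘ s≤s)
    ... | suc k | _ , k<n | v , v≡ = fromℕ< k<n ∷ v , λ
      { {zero}  _        → trans (cong suc (Fin.toℕ-fromℕ< k<n)) (sym L0≡)
      ; {suc j} (s≤s j<) → v≡ j<
      }

    fill : ∀ ms (L : ℕ → ℕ → ℕ) → (∀ {i j} → j < nth ms i → 0 < L i j × L i j ≤ n) →
      Σ (All (Vec (Fin n)) ms) λ T → ∀ {i j} → j < nth ms i → labels T i j ≡ L i j
    fill []       L bounds = [] , λ ()
    fill (m ∷ ms) L bounds with fill-row m (L 0) bounds | fill ms (L ∘ suc) (λ {i} → bounds {suc i})
    ... | v , v≡ | T , T≡ = v ∷ T , λ { {zero} → v≡ ; {suc i} → T≡ }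

  module _ {A : Set} {xs : List A} where

    vectors-unique : Unique xs → ∀ m → Unique (vectors xs m)
    vectors-unique xs! zero    = [] ∷ []
    vectors-unique xs! (suc m) = Unique.cartesianProductWith⁺ _∷_ (λ { refl → refl , refl }) xs! (vectors-unique xs! m)

    fillings-unique : Unique xs → ∀ ms → Unique (fillings xs ms)
    fillings-unique xs! []       = [] ∷ []
    fillings-unique xs! (m ∷ ms) =
      Unique.cartesianProductWith⁺ _∷_ (λ { refl → refl , refl }) (vectors-unique xs! m) (fillings-unique xs! ms)

    ∈-vectors : (∀ x → x ∈ xs) → ∀ {m} (v : Vec A m) → v ∈ vectors xs m
    ∈-vectors ∈xs []      = here refl
    ∈-vectors ∈xs (x ∷ v) = ∈-cartesianProductWith⁺ _∷_ (∈xs x) (∈-vectors ∈xs v)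

    ∈-fillings : (∀ x → x ∈ xs) → ∀ {ms} (T : All (Vec A) ms) → T ∈ fillings xs ms
    ∈-fillings ∈xs []       = here refl
    ∈-fillings ∈xs (v ∷ vs) = ∈-cartesianProductWith⁺ _∷_ (∈-vectors ∈xs v) (∈-fillings ∈xs vs)

  module _ {n : ℕ} (μ : Partition n) where

    label≡labels : ∀ T (c : Cell μ) → label μ T c ≡ labels T (rowOf c) (colOf c)
    label≡labels T (i , j) = labels-lookup T i j

    parts-decreasing : Decreasing (parts μ)
    parts-decreasing = linked⇒decreasing (decreasing μ)

    standard⇒tableau : ∀ {T} → Standard μ T → IsTableau n (parts μ) (labels T)
    standard⇒tableau {T} std = record
      { nonzero    = nonzero′
      ; bounded    = bounded′
      ; injective  = injective′
      ; surjective = surjective′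
      ; rightwards = rightwards′
      ; downwards  = downwards′
      }
      where
      open Standard std
      L = labels T

      nonzero′ : ∀ {i j} → j < nth (parts μ) i → 0 < L i j
      nonzero′ {i} {j} j< with cellAt (parts μ) i j j<
      ... | c , refl , refl = subst (0 <_) (label≡labels T c) z<s

      bounded′ : ∀ {i j} → j < nth (parts μ) i → L i j ≤ n
      bounded′ {i} {j} j< with cellAt (parts μ) i j j<
      ... | c , refl , refl = subst (_≤ n) (label≡labels T c) (Fin.toℕ<n (entry μ T c))

      injective′ : ∀ {i j i′ j′} → j < nth (parts μ) i → j′ < nth (parts μ) i′ → L i j ≡ L i′ j′ → i ≡ i′ × j ≡ j′
      injective′ {i} {j} {i′} {j′} j< j′< eq with cellAt (parts μ) i j j< | cellAt (parts μ) i′ j′ j′<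
      ... | c , refl , refl | c′ , refl , refl
        with proj₁ bijective {c} {c′} (Fin.toℕ-injective (suc-injective
               (trans (label≡labels T c) (trans eq (sym (label≡labels T c′))))))
      ... | refl = refl , refl

      surjective′ : ∀ {k} → 0 < k → k ≤ n → ∃₂ λ i j → j < nth (parts μ) i × L i j ≡ k
      surjective′ {suc k} _ k<n with surjective⇒strictlySurjective (proj₂ bijective) (fromℕ< k<n)
      ... | c , eq = rowOf c , colOf c , colOf< (parts μ) c
        , trans (sym (label≡labels T c)) (cong suc (trans (cong toℕ eq) (Fin.toℕ-fromℕ< k<n)))

      rightwards′ : ∀ {i j j′} → j < j′ → j′ < nth (parts μ) i → L i j < L i j′
      rightwards′ {i} {j} {j′} j<j′ j′< with cellAt (parts μ) i j (<-trans j<j′ j′<) | cellAt (parts μ) i j′ j′<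
      ... | c , refl , refl | c′ , row≡ , refl = subst₂ _<_ (label≡labels T c)
        (trans (label≡labels T c′) (cong (λ i → L i (colOf c′)) row≡)) (rightwards c c′ (sym row≡) j<j′)

      downwards′ : ∀ {i i′ j} → i < i′ → j < nth (parts μ) i → j < nth (parts μ) i′ → L i j < L i′ j
      downwards′ {i} {i′} {j} i<i′ j< j<′ with cellAt (parts μ) i j j< | cellAt (parts μ) i′ j j<′
      ... | c , refl , refl | c′ , refl , col≡ = subst₂ _<_ (label≡labels T c)
        (trans (label≡labels T c′) (cong (L (rowOf c′)) col≡)) (downwards c c′ (sym col≡) i<i′)

    tableau⇒standard : ∀ {T} → IsTableau n (parts μ) (labels T) → Standard μ T
    tableau⇒standard {T} tab = record
      { bijective  = (λ {c} {c′} eq → let row≡ , col≡ = injective (colOf< (parts μ) c) (colOf< (parts μ) c′)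
                                            (trans (sym (label≡labels T c)) (trans (cong (suc ∘ toℕ) eq) (label≡labels T c′)))
                                      in cell-≡ (parts μ) c c′ row≡ col≡)
                   , strictlySurjective⇒surjective surjective′
      ; rightwards = λ c c′ row≡ col< → subst₂ _<_ (sym (label≡labels T c))
          (trans (cong (λ i → labels T i (colOf c′)) row≡) (sym (label≡labels T c′)))
          (rightwards col< (subst (λ i → colOf c′ < nth (parts μ) i) (sym row≡) (colOf< (parts μ) c′)))
      ; downwards  = λ c c′ col≡ row< → subst₂ _<_ (sym (label≡labels T c))
          (trans (cong (labels T (rowOf c′)) col≡) (sym (label≡labels T c′)))
          (downwards row< (colOf< (parts μ) c) (subst (_< nth (parts μ) (rowOf c′)) (sym col≡) (colOf< (parts μ) c′)))
      }
      where
      open IsTableau tab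

      surjective′ : ∀ k → ∃ λ c → entry μ T c ≡ k
      surjective′ k with surjective {suc (toℕ k)} z<s (Fin.toℕ<n k)
      ... | i , j , j< , eq with cellAt (parts μ) i j j<
      ... | c , refl , refl = c , Fin.toℕ-injective (suc-injective (trans (label≡labels T c) eq))

    -- A permutation is enough, because only sums over the values of maj are taken afterwards.
    maj-SYT↭majʷ-words : map (maj μ) (SYT μ) ↭ map majʷ (words n (parts μ))
    maj-SYT↭majʷ-words = map-↭-matching Matches (maj μ) majʷ (SYT μ) (words n as)
      (Unique.filter⁺ (standard? μ) (fillings-unique (Unique.allFin⁺ n) as))
      (words-unique n as)
      to from
      (λ _ w∈ w′∈ T~w T~w′ → place-injective n as w∈ w′∈ dec (sum-parts μ) (λ j< → trans (sym (T~w j<)) (T~w′ j<)))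
      (λ {T} {T′} _ _ _ T~w T′~w → labels-injective T T′ (λ j< → trans (T~w j<) (sym (T′~w j<))))
      maj≡
      where
      as  = parts μ
      dec = parts-decreasing

      Matches : Filling μ → List ℕ → Set
      Matches T w = ∀ {i j} → j < nth as i → labels T i j ≡ place w as i j

      to : ∀ {T} → T ∈ SYT μ → ∃ λ w → w ∈ words n as × Matches T w
      to {T} T∈ = tableau-word n as (labels T) dec (sum-parts μ)
        (standard⇒tableau (proj₂ (∈-filter⁻ (standard? μ) {xs = fillings (allFin n) as} T∈)))

      from : ∀ {w} → w ∈ words n as → ∃ λ T → T ∈ SYT μ × Matches T w
      from {w} w∈ with tab ← place-tableau n as w∈ dec (sum-parts μ)
        with fill as (place w as) (λ j< → IsTableau.nonzero tab j< , IsTableau.bounded tab j<)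
      ... | T , T~w = T , ∈-filter⁺ (standard? μ) (∈-fillings (λ k → ∈-allFin k) T) (tableau⇒standard (record
        { nonzero    = λ j< → subst (0 <_) (sym (T~w j<)) (nonzero j<)
        ; bounded    = λ j< → subst (_≤ n) (sym (T~w j<)) (bounded j<)
        ; injective  = λ j< j′< eq → injective j< j′< (trans (sym (T~w j<)) (trans eq (T~w j′<)))
        ; surjective = λ 0<k k≤n → let i , j , j< , eq = surjective 0<k k≤n in i , j , j< , trans (T~w j<) eq
        ; rightwards = λ j<j′ j′< → subst₂ _<_ (sym (T~w (<-trans j<j′ j′<))) (sym (T~w j′<)) (rightwards j<j′ j′<)
        ; downwards  = λ i<i′ j< j<′ → subst₂ _<_ (sym (T~w j<)) (sym (T~w j<′)) (downwards i<i′ j< j<′)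
        })) , T~w
        where open IsTableau tab

      maj≡ : ∀ {T w} → T ∈ SYT μ → w ∈ words n as → Matches T w → maj μ T ≡ majʷ w
      maj≡ {T} {w} _ w∈ T~w = sum-descents n as w∈ dec (sum-parts μ) (descent? μ T) λ {k} _ _ → descent⇒ , ⇒descent
        where
        label≡place : ∀ c → label μ T c ≡ place w as (rowOf c) (colOf c)
        label≡place c = trans (label≡labels T c) (T~w (colOf< (parts μ) c))

        descent⇒ : ∀ {k} → Descent μ T k → IsDescent as (place w as) k
        descent⇒ (c , c′ , eq , eq′ , row<) = rowOf c , colOf c , rowOf c′ , colOf c′ , colOf< (parts μ) c , colOf< (parts μ) c′
          , trans (sym (label≡place c)) eq , trans (sym (label≡place c′)) eq′ , row<

        ⇒descent : ∀ {k} → IsDescent as (place w as) k → Descent μ T k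
        ⇒descent (i , j , i′ , j′ , j< , j′< , eq , eq′ , i<i′) with cellAt as i j j< | cellAt as i′ j′ j′<
        ... | c , refl , refl | c′ , refl , refl =
          c , c′ , trans (label≡place c) eq , trans (label≡place c′) eq′ , i<i′

-- Counting the cells of a hook

module HookLengths where

  open import Data.Fin.Base using (Fin; zero; suc; toℕ)
  open import Data.List.Base using (List; []; _∷_; [_]; length; lookup; map; allFin; applyUpTo; upTo; concatMap; filter; tabulate; _++_)
  open import Data.List.Properties using (map-++; map-∘; map-cong; length-++; filter-++; filter-≐; filter-none; filter-accept; filter-reject; map-concatMap; concatMap-map; concatMap-cong; map-tabulate; map-upTo; upTo-∷ʳ)
  import Data.List.Relation.Unary.All as All
  open import Data.Nat.Base as ℕ using (ℕ; zero; suc; z≤n; s≤s; _<_; _≤_; _∸_; _+_)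
  open import Data.Nat.Properties
  open import Data.Product.Base using (Σ; _×_; _,_; proj₂; map₁)
  open import Data.Sum.Base as Sum using (_⊎_; inj₁; inj₂)
  open import Function.Base using (_∘_; id)
  open import Level using (0ℓ)
  open import Relation.Binary.PropositionalEquality hiding ([_])
  open import Relation.Nullary using (yes; no; ¬_)
  open import Relation.Nullary.Decidable using (_×-dec_; _⊎-dec_)
  open import Relation.Unary using (Pred; Decidable; _≐_)
  open import Defs
  open Shapes
  open Fillings

  count : {A : Set} {P : Pred A 0ℓ} → Decidable P → List A → ℕ
  count P? xs = length (filter P? xs)

  module _ {A : Set} {P : Pred A 0ℓ} (P? : Decidable P) where

    count-++ : ∀ xs ys → count P? (xs ++ ys) ≡ count P? xs + count P? ys
    count-++ xs ys = trans (cong length (filter-++ P? xs ys)) (length-++ (filter P? xs))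

    count-map : {B : Set} (f : B → A) → ∀ xs → count P? (map f xs) ≡ count (P? ∘ f) xs
    count-map f []       = refl
    count-map f (x ∷ xs) with P? (f x)
    ... | yes _ = cong suc (count-map f xs)
    ... | no  _ = count-map f xs

    count-≐ : {Q : Pred A 0ℓ} (Q? : Decidable Q) → P ≐ Q → ∀ xs → count P? xs ≡ count Q? xs
    count-≐ Q? P≐Q xs = cong length (filter-≐ P? Q? P≐Q xs)

    count-none : (∀ x → ¬ P x) → ∀ xs → count P? xs ≡ 0
    count-none ¬P xs = cong length (filter-none P? (All.universal ¬P xs))

    count-accept : ∀ {x} → P x → ∀ xs → count P? (x ∷ xs) ≡ suc (count P? xs)
    count-accept Px xs = cong length (filter-accept P? Px)

    count-reject : ∀ {x} → ¬ P x → ∀ xs → count P? (x ∷ xs) ≡ count P? xs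
    count-reject ¬Px xs = cong length (filter-reject P? ¬Px)

  count-upTo-suc : {P : Pred ℕ 0ℓ} (P? : Decidable P) → ∀ n → count P? (upTo (suc n)) ≡ count P? (upTo n) + count P? [ n ]
  count-upTo-suc P? n = trans (cong (count P?) (sym (upTo-∷ʳ n))) (count-++ P? (upTo n) [ n ])

  count-≤ : ∀ n j → count (j ≤?_) (upTo n) ≡ n ∸ j
  count-≤ zero    j = sym (0∸n≡0 j)
  count-≤ (suc n) j with j ≤? n
  ... | yes j≤n = begin
    count (j ≤?_) (upTo (suc n))                       ≡⟨ count-upTo-suc (j ≤?_) n ⟩
    count (j ≤?_) (upTo n) + count (j ≤?_) [ n ]       ≡⟨ cong₂ _+_ (count-≤ n j) (count-accept (j ≤?_) j≤n []) ⟩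
    n ∸ j + 1                                          ≡⟨ +-comm (n ∸ j) 1 ⟩
    suc (n ∸ j)                                        ≡⟨ +-∸-assoc 1 j≤n ⟨
    suc n ∸ j                                          ∎
    where open ≡-Reasoning
  ... | no  j≰n = begin
    count (j ≤?_) (upTo (suc n))                       ≡⟨ count-upTo-suc (j ≤?_) n ⟩
    count (j ≤?_) (upTo n) + count (j ≤?_) [ n ]       ≡⟨ cong₂ _+_ (count-≤ n j) (count-reject (j ≤?_) j≰n []) ⟩
    n ∸ j + 0                                          ≡⟨ cong (_+ 0) (m≤n⇒m∸n≡0 (≰⇒≥ j≰n)) ⟩
    0                                                  ≡⟨ m≤n⇒m∸n≡0 (≰⇒> j≰n) ⟨
    suc n ∸ j                                          ∎
    where open ≡-Reasoning

  count-≡-≥ : ∀ n j → n ≤ j → count (_≟ j) (upTo n) ≡ 0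
  count-≡-≥ zero    j n≤j = refl
  count-≡-≥ (suc n) j n<j = trans (count-upTo-suc (_≟ j) n)
    (cong₂ _+_ (count-≡-≥ n j (<⇒≤ n<j)) (count-reject (_≟ j) (<⇒≢ n<j) []))

  count-≡-< : ∀ n j → j < n → count (_≟ j) (upTo n) ≡ 1
  count-≡-< (suc n) j j<1+n with n ≟ j
  ... | yes refl = trans (count-upTo-suc (_≟ j) n) (cong₂ _+_ (count-≡-≥ n n ≤-refl) (count-accept (_≟ n) refl []))
  ... | no  n≢j  = trans (count-upTo-suc (_≟ j) n)
    (cong₂ _+_ (count-≡-< n j (≤∧≢⇒< (ℕ.s≤s⁻¹ j<1+n) (n≢j ∘ sym))) (count-reject (_≟ j) n≢j []))

  coordinates : ∀ {ℓ} {m : Fin ℓ → ℕ} → Σ (Fin ℓ) (Fin ∘ m) → ℕ × ℕ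
  coordinates (i , j) = toℕ i , toℕ j

  -- With plain coordinates, prepending a row to a shape just raises the row index of the old cells
  -- by one, which allows induction on the rows.
  cellCoordinates : List ℕ → List (ℕ × ℕ)
  cellCoordinates []       = []
  cellCoordinates (a ∷ as) = map (0 ,_) (upTo a) ++ map (map₁ suc) (cellCoordinates as)

  tabulate-toℕ : {A : Set} (f : ℕ → A) → ∀ n → tabulate {n = n} (f ∘ toℕ) ≡ applyUpTo f n
  tabulate-toℕ f zero    = refl
  tabulate-toℕ f (suc n) = cong (f 0 ∷_) (tabulate-toℕ (f ∘ suc) n)

  cellsOf : ∀ as → List (CellOf as)
  cellsOf as = concatMap (λ i → map (i ,_) (allFin (lookup as i))) (allFin (length as))

  map-coordinates : ∀ as → map coordinates (cellsOf as) ≡ cellCoordinates as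
  map-coordinates as = trans (map-concatMap coordinates (λ i → map (i ,_) (allFin _)) (allFin _)) (go as)
    where
    open ≡-Reasoning
    rowCoordinates : ∀ as → Fin (length as) → List (ℕ × ℕ)
    rowCoordinates as i = map coordinates (map (i ,_) (allFin (lookup as i)))

    first : ∀ a as → rowCoordinates (a ∷ as) zero ≡ map (0 ,_) (upTo a)
    first a as = begin
      map coordinates (map (zero ,_) (allFin a))  ≡⟨ map-∘ (allFin a) ⟨
      map (λ j → 0 , toℕ j) (allFin a)            ≡⟨ map-tabulate id (λ j → 0 , toℕ j) ⟩
      tabulate (λ (j : Fin a) → 0 , toℕ j)        ≡⟨ tabulate-toℕ (0 ,_) a ⟩
      applyUpTo (0 ,_) a                          ≡⟨ map-upTo (0 ,_) a ⟨
      map (0 ,_) (upTo a)                         ∎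

    next : ∀ a as i → rowCoordinates (a ∷ as) (suc i) ≡ map (map₁ suc) (rowCoordinates as i)
    next a as i = trans (sym (map-∘ (allFin _))) (trans (map-∘ (allFin _)) (cong (map (map₁ suc)) (map-∘ (allFin _))))

    go : ∀ as → concatMap (rowCoordinates as) (allFin (length as)) ≡ cellCoordinates as
    go []       = refl
    go (a ∷ as) = cong₂ _++_ (first a as) (begin
      concatMap (rowCoordinates (a ∷ as)) (tabulate suc)                      ≡⟨ cong (concatMap (rowCoordinates (a ∷ as))) (map-tabulate id suc) ⟨
      concatMap (rowCoordinates (a ∷ as)) (map suc (allFin _))                ≡⟨ concatMap-map (rowCoordinates (a ∷ as)) suc (allFin _) ⟩
      concatMap (rowCoordinates (a ∷ as) ∘ suc) (allFin _)                    ≡⟨ concatMap-cong (next a as) (allFin _) ⟩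
      concatMap (map (map₁ suc) ∘ rowCoordinates as) (allFin _)               ≡⟨ map-concatMap (map₁ suc) (rowCoordinates as) (allFin _) ⟨
      map (map₁ suc) (concatMap (rowCoordinates as) (allFin _))               ≡⟨ cong (map (map₁ suc)) (go as) ⟩
      map (map₁ suc) (cellCoordinates as)                          ∎)

  HookAt : ℕ × ℕ → Pred (ℕ × ℕ) 0ℓ
  HookAt (i , j) (i′ , j′) = (i′ ≡ i × j ≤ j′) ⊎ (j′ ≡ j × i ≤ i′)

  hookAt? : ∀ c → Decidable (HookAt c)
  hookAt? (i , j) (i′ , j′) = (i′ ≟ i ×-dec j ≤? j′) ⊎-dec (j′ ≟ j ×-dec i ≤? i′)

  hookLengthAt : List ℕ → ℕ × ℕ → ℕ
  hookLengthAt as c = count (hookAt? c) (cellCoordinates as)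

  count-column : ∀ as j → count (λ (c : ℕ × ℕ) → proj₂ c ≟ j) (cellCoordinates as) ≡ leg as j
  count-column []       j = refl
  count-column (a ∷ as) j = trans (count-++ P? (map (0 ,_) (upTo a)) _)
    (trans (cong₂ _+_ (count-map P? (0 ,_) (upTo a))
                      (trans (count-map P? (map₁ suc) (cellCoordinates as)) (count-column as j)))
           total)
    where
    P? = λ (c : ℕ × ℕ) → proj₂ c ≟ j

    total : count (_≟ j) (upTo a) + leg as j ≡ leg (a ∷ as) j
    total with j <? a
    ... | yes j<a = trans (cong (_+ leg as j) (count-≡-< a j j<a)) (sym (count-accept (j <?_) j<a as))
    ... | no  j≮a = trans (cong (_+ leg as j) (count-≡-≥ a j (≮⇒≥ j≮a))) (sym (count-reject (j <?_) j≮a as))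

  -- Within the first row, the column condition adds nothing to the row condition: it only holds for
  -- the cell itself, which is thus counted once. In the lower rows only the column condition can
  -- hold.
  hookLengthAt-first : ∀ a as j → hookLengthAt (a ∷ as) (0 , j) ≡ a ∸ j + leg as j
  hookLengthAt-first a as j = trans (count-++ P? (map (0 ,_) (upTo a)) _) (cong₂ _+_
    (trans (count-map P? (0 ,_) (upTo a)) (trans
      (count-≐ (P? ∘ (0 ,_)) (j ≤?_) ((λ { (inj₁ (_ , j≤)) → j≤ ; (inj₂ (refl , _)) → ≤-refl }) , λ j≤ → inj₁ (refl , j≤)) (upTo a))
      (count-≤ a j)))
    (trans (count-map P? (map₁ suc) (cellCoordinates as)) (trans
      (count-≐ (P? ∘ map₁ suc) (λ (c : ℕ × ℕ) → proj₂ c ≟ j) ((λ { (inj₁ (() , _)) ; (inj₂ (eq , _)) → eq }) , λ eq → inj₂ (eq , z≤n)) (cellCoordinates as))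
      (count-column as j))))
    where P? = hookAt? (0 , j)

  hookLengthAt-next : ∀ a as c → hookLengthAt (a ∷ as) (map₁ suc c) ≡ hookLengthAt as c
  hookLengthAt-next a as (i , j) = trans (count-++ P? (map (0 ,_) (upTo a)) _) (cong₂ _+_
    (trans (count-map P? (0 ,_) (upTo a))
      (count-none (P? ∘ (0 ,_)) (λ { _ (inj₁ (() , _)) ; _ (inj₂ (_ , ())) }) (upTo a)))
    (trans (count-map P? (map₁ suc) (cellCoordinates as))
      (count-≐ (P? ∘ map₁ suc) (hookAt? (i , j))
        ((λ { (inj₁ (eq , j≤)) → inj₁ (suc-injective eq , j≤) ; (inj₂ (eq , s≤s i≤)) → inj₂ (eq , i≤) })
        , λ { (inj₁ (eq , j≤)) → inj₁ (cong suc eq , j≤) ; (inj₂ (eq , i≤)) → inj₂ (eq , s≤s i≤) })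
        (cellCoordinates as))))
    where P? = hookAt? (suc i , j)

  map-hookLengthAt : ∀ as → map (hookLengthAt as) (cellCoordinates as) ≡ hooks as
  map-hookLengthAt []       = refl
  map-hookLengthAt (a ∷ as) = trans (map-++ (hookLengthAt (a ∷ as)) (map (0 ,_) (upTo a)) _) (cong₂ _++_
    (trans (sym (map-∘ (upTo a))) (map-cong (hookLengthAt-first a as) (upTo a)))
    (trans (sym (map-∘ (cellCoordinates as))) (trans (map-cong (hookLengthAt-next a as) (cellCoordinates as)) (map-hookLengthAt as))))

  map-hookLength : ∀ {n} (μ : Partition n) → map (hookLength μ) (cells μ) ≡ hooks (parts μ)
  map-hookLength μ = begin
    map (hookLength μ) (cells μ)                                ≡⟨ map-cong hookLength≡ (cells μ) ⟩
    map (hookLengthAt (parts μ) ∘ coordinates) (cells μ)        ≡⟨ map-∘ (cells μ) ⟩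
    map (hookLengthAt (parts μ)) (map coordinates (cells μ))    ≡⟨ cong (map (hookLengthAt (parts μ))) (map-coordinates (parts μ)) ⟩
    map (hookLengthAt (parts μ)) (cellCoordinates (parts μ))    ≡⟨ map-hookLengthAt (parts μ) ⟩
    hooks (parts μ)                                             ∎
    where
    open ≡-Reasoning

    hookLength≡ : ∀ c → hookLength μ c ≡ hookLengthAt (parts μ) (coordinates c)
    hookLength≡ c = trans (sym (count-map (hookAt? (coordinates c)) coordinates (cells μ)))
      (cong (count (hookAt? (coordinates c))) (map-coordinates (parts μ)))

-- Rational arithmetic and the ring of power series

module PowerSeries where

  open import Algebra.Bundles using (CommutativeRing)
  open import Algebra.Structures using (IsCommutativeRing)

  open import Data.Fin.Base using (zero; suc)
  import Data.Integer.Base as ℤ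
  import Data.Integer.Properties as ℤ
  open import Data.Nat.Base as ℕ using (ℕ; zero; suc; z≤n; s≤s; NonZero)
  import Algebra.Construct.Pointwise ℕ as Pointwise
  import Data.Nat.Properties as ℕ
  open import Data.Product.Base using (_,_)
  open import Data.Rational.Base as ℚ using (ℚ; 0ℚ; 1ℚ; _+_; _*_; _-_; -_; toℚᵘ)
  import Data.Rational.Properties as ℚ
  open import Data.Rational.Unnormalised.Base as ℚᵘ using (mkℚᵘ; *≡*)
  import Data.Rational.Unnormalised.Properties as ℚᵘ
  open import Function.Base using (_∘_)
  open import Level using (0ℓ)
  open import Relation.Binary.PropositionalEquality
  open import Algebra.Properties.Group ℚ.+-0-group using (∙-cancelˡ)
  open import Relation.Nullary using (contradiction)
  open import Defs
  open RingSolving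

  module ℚ-Solver = IntegralRingSolver ℚ.+-*-commutativeRing

  -- Reduced fractions do not compute for a variable n, so the equation is checked by
  -- cross-multiplication of unnormalised ones.
  fromℕ-suc : ∀ n → fromℕ (suc n) ≡ 1ℚ + fromℕ n
  fromℕ-suc n = ℚ.toℚᵘ-injective (begin
    toℚᵘ (fromℕ (suc n))                ≈⟨ ℚ.toℚᵘ-fromℚᵘ (mkℚᵘ (ℤ.+ suc n) 0) ⟩
    mkℚᵘ (ℤ.+ suc n) 0                    ≈⟨ *≡* (cong (λ k → (ℤ.+ 1 ℤ.+ k) ℤ.* ℤ.+ 1) (sym (ℤ.*-identityʳ (ℤ.+ n)))) ⟩
    mkℚᵘ (ℤ.+ 1) 0 ℚᵘ.+ mkℚᵘ (ℤ.+ n) 0      ≈⟨ ℚᵘ.+-congʳ (mkℚᵘ (ℤ.+ 1) 0) (ℚ.toℚᵘ-fromℚᵘ (mkℚᵘ (ℤ.+ n) 0)) ⟨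
    toℚᵘ 1ℚ ℚᵘ.+ toℚᵘ (fromℕ n)         ≈⟨ ℚ.toℚᵘ-homo-+ 1ℚ (fromℕ n) ⟨
    toℚᵘ (1ℚ + fromℕ n)                 ∎)
    where open import Relation.Binary.Reasoning.Setoid ℚᵘ.≃-setoid

  fromℕ-+ : ∀ m n → fromℕ (m ℕ.+ n) ≡ fromℕ m + fromℕ n
  fromℕ-+ zero    n = sym (ℚ.+-identityˡ (fromℕ n))
  fromℕ-+ (suc m) n = begin
    fromℕ (suc (m ℕ.+ n))        ≡⟨ fromℕ-suc (m ℕ.+ n) ⟩
    1ℚ + fromℕ (m ℕ.+ n)         ≡⟨ cong (1ℚ +_) (fromℕ-+ m n) ⟩
    1ℚ + (fromℕ m + fromℕ n)     ≡⟨ ℚ.+-assoc 1ℚ (fromℕ m) (fromℕ n) ⟨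
    1ℚ + fromℕ m + fromℕ n       ≡⟨ cong (_+ fromℕ n) (fromℕ-suc m) ⟨
    fromℕ (suc m) + fromℕ n      ∎
    where open ≡-Reasoning

  fromℕ-* : ∀ m n → fromℕ (m ℕ.* n) ≡ fromℕ m * fromℕ n
  fromℕ-* zero    n = sym (ℚ.*-zeroˡ (fromℕ n))
  fromℕ-* (suc m) n = begin
    fromℕ (n ℕ.+ m ℕ.* n)              ≡⟨ fromℕ-+ n (m ℕ.* n) ⟩
    fromℕ n + fromℕ (m ℕ.* n)          ≡⟨ cong (fromℕ n +_) (fromℕ-* m n) ⟩
    fromℕ n + fromℕ m * fromℕ n        ≡⟨ distribute (fromℕ m) (fromℕ n) ⟩
    (1ℚ + fromℕ m) * fromℕ n           ≡⟨ cong (_* fromℕ n) (fromℕ-suc m) ⟨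
    fromℕ (suc m) * fromℕ n            ∎
    where
    open ≡-Reasoning
    open ℚ-Solver
    distribute : ∀ x y → y + x * y ≡ (1ℚ + x) * y
    distribute = solve 2 (λ x y → y :+ x :* y := (con (1 , 0) :+ x) :* y) refl

  fromℕ-^ : ∀ m d → fromℕ (m ℕ.^ d) ≡ fromℕ m ^ d
  fromℕ-^ m zero    = refl
  fromℕ-^ m (suc d) = trans (fromℕ-* m (m ℕ.^ d)) (cong (fromℕ m *_) (fromℕ-^ m d))

  fromℕ-1/ℕ : ∀ n .{{_ : NonZero n}} → fromℕ n * 1/ℕ n ≡ 1ℚ
  fromℕ-1/ℕ (suc n) = ℚ.toℚᵘ-injective (begin
    toℚᵘ (fromℕ (suc n) * 1/ℕ (suc n))              ≈⟨ ℚ.toℚᵘ-homo-* (fromℕ (suc n)) (1/ℕ (suc n)) ⟩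
    toℚᵘ (fromℕ (suc n)) ℚᵘ.* toℚᵘ (1/ℕ (suc n))    ≈⟨ ℚᵘ.*-cong (ℚ.toℚᵘ-fromℚᵘ (mkℚᵘ (ℤ.+ suc n) 0)) (ℚ.toℚᵘ-fromℚᵘ (mkℚᵘ (ℤ.+ 1) n)) ⟩
    mkℚᵘ (ℤ.+ suc n) 0 ℚᵘ.* mkℚᵘ (ℤ.+ 1) n              ≈⟨ *≡* (cong ℤ.+_ numerators) ⟩
    toℚᵘ 1ℚ                                         ∎)
    where
    open import Relation.Binary.Reasoning.Setoid ℚᵘ.≃-setoid
    numerators : suc n ℕ.* 1 ℕ.* 1 ≡ suc (n ℕ.+ 0 ℕ.* suc n) ℕ.+ 0
    numerators = trans (ℕ.*-identityʳ _) (trans (ℕ.*-identityʳ _) (sym (trans (ℕ.+-identityʳ _) (cong suc (ℕ.+-identityʳ n)))))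

  inverse-cancelˡ : ∀ a b {x y} → a * b ≡ 1ℚ → a * x ≡ a * y → x ≡ y
  inverse-cancelˡ a b {x} {y} ab≡1 eq = begin
    x              ≡⟨ expand x ⟩
    b * (a * x)    ≡⟨ cong (b *_) eq ⟩
    b * (a * y)    ≡⟨ expand y ⟨
    y              ∎
    where
    open ≡-Reasoning
    open ℚ-Solver
    expand : ∀ x → x ≡ b * (a * x)
    expand x = begin
      x              ≡⟨ ℚ.*-identityˡ x ⟨
      1ℚ * x         ≡⟨ cong (_* x) ab≡1 ⟨
      a * b * x      ≡⟨ solve 3 (λ a b x → a :* b :* x := b :* (a :* x)) refl a b x ⟩
      b * (a * x)    ∎

  nonzero-cancelˡ : ∀ {a x} → a ≢ 0ℚ → a * x ≡ 0ℚ → x ≡ 0ℚ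
  nonzero-cancelˡ {a} a≢0 eq = inverse-cancelˡ a (ℚ.1/_ a {{ℚ.≢-nonZero a≢0}})
    (ℚ.*-inverseʳ a {{ℚ.≢-nonZero a≢0}}) (trans eq (sym (ℚ.*-zeroʳ a)))

  fromℕ-cancelˡ : ∀ n .{{_ : NonZero n}} {x y} → fromℕ n * x ≡ fromℕ n * y → x ≡ y
  fromℕ-cancelˡ n = inverse-cancelˡ (fromℕ n) (1/ℕ n) (fromℕ-1/ℕ n)

  fromℕ-suc≢0 : ∀ n → fromℕ (suc n) ≢ 0ℚ
  fromℕ-suc≢0 n eq = contradiction (trans (sym (fromℕ-1/ℕ (suc n))) (trans (cong (_* 1/ℕ (suc n)) eq) (ℚ.*-zeroˡ (1/ℕ (suc n))))) λ ()

  fromℕ-injective : ∀ {m n} → fromℕ m ≡ fromℕ n → m ≡ n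
  fromℕ-injective {zero}  {zero}  eq = refl
  fromℕ-injective {zero}  {suc n} eq = contradiction (sym eq) (fromℕ-suc≢0 n)
  fromℕ-injective {suc m} {zero}  eq = contradiction eq (fromℕ-suc≢0 m)
  fromℕ-injective {suc m} {suc n} eq =
    cong suc (fromℕ-injective (∙-cancelˡ 1ℚ (fromℕ m) (fromℕ n) (trans (sym (fromℕ-suc m)) (trans eq (fromℕ-suc n)))))

  infix 4 _≈ₛ_
  _≈ₛ_ : Series → Series → Set
  f ≈ₛ g = ∀ n → f n ≡ g n

  _+ₛ_ : Series → Series → Series
  (f +ₛ g) n = f n + g n

  -ₛ_ : Series → Series
  (-ₛ f) n = - f n

  0ₛ : Series
  0ₛ _ = 0ℚ

  -- Needed in this local form because a composition of series agrees with a given partial sum only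
  -- in low degrees.
  *ₛ-cong-≤ : ∀ n {f f′ g g′} → (∀ {i} → i ℕ.≤ n → f i ≡ f′ i) → (∀ {i} → i ℕ.≤ n → g i ≡ g′ i) →
              (f *ₛ g) n ≡ (f′ *ₛ g′) n
  *ₛ-cong-≤ zero    f≡ g≡ = cong (_+ 0ℚ) (cong₂ _*_ (f≡ z≤n) (g≡ z≤n))
  *ₛ-cong-≤ (suc n) f≡ g≡ = cong₂ _+_ (cong₂ _*_ (f≡ z≤n) (g≡ ℕ.≤-refl))
    (*ₛ-cong-≤ n (λ i≤n → f≡ (s≤s i≤n)) (λ i≤n → g≡ (ℕ.m≤n⇒m≤1+n i≤n)))

  *ₛ-cong : ∀ {f f′ g g′} → f ≈ₛ f′ → g ≈ₛ g′ → (f *ₛ g) ≈ₛ (f′ *ₛ g′)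
  *ₛ-cong f≈ g≈ n = *ₛ-cong-≤ n (λ {i} _ → f≈ i) (λ {i} _ → g≈ i)

  *ₛ-zeroˡ : ∀ g → (0ₛ *ₛ g) ≈ₛ 0ₛ
  *ₛ-zeroˡ g zero    = trans (ℚ.+-identityʳ _) (ℚ.*-zeroˡ (g 0))
  *ₛ-zeroˡ g (suc n) = trans (cong₂ _+_ (ℚ.*-zeroˡ (g (suc n))) (*ₛ-zeroˡ g n)) (ℚ.+-identityʳ 0ℚ)

  *ₛ-distribʳ : ∀ h f g → ((f +ₛ g) *ₛ h) ≈ₛ ((f *ₛ h) +ₛ (g *ₛ h))
  *ₛ-distribʳ h f g zero    = solve 3 (λ f g h → (f :+ g) :* h :+ con (0 , 0) := f :* h :+ con (0 , 0) :+ (g :* h :+ con (0 , 0))) refl (f 0) (g 0) (h 0)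
    where open ℚ-Solver
  *ₛ-distribʳ h f g (suc n) = trans (cong ((f 0 + g 0) * h (suc n) +_) (*ₛ-distribʳ h (f ∘ suc) (g ∘ suc) n))
    (solve 5 (λ f g h a b → (f :+ g) :* h :+ (a :+ b) := f :* h :+ a :+ (g :* h :+ b)) refl (f 0) (g 0) (h (suc n)) _ _)
    where open ℚ-Solver

  -- The convolution unfolds at the constant term of f; splitting it at the constant term of g
  -- instead is what commutativity requires.
  *ₛ-last : ∀ f g n → (f *ₛ g) (suc n) ≡ f (suc n) * g 0 + (f *ₛ (g ∘ suc)) n
  *ₛ-last f g zero    = solve 4 (λ a b c d → a :* b :+ (c :* d :+ con (0 , 0)) := c :* d :+ (a :* b :+ con (0 , 0))) refl (f 0) (g 1) (f 1) (g 0)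
    where open ℚ-Solver
  *ₛ-last f g (suc n) = trans (cong (f 0 * g (suc (suc n)) +_) (*ₛ-last (f ∘ suc) g n))
    (solve 3 (λ a b c → a :+ (b :+ c) := b :+ (a :+ c)) refl (f 0 * g (suc (suc n))) (f (suc (suc n)) * g 0) _)
    where open ℚ-Solver

  *ₛ-comm : ∀ f g → (f *ₛ g) ≈ₛ (g *ₛ f)
  *ₛ-comm f g zero    = cong (_+ 0ℚ) (ℚ.*-comm (f 0) (g 0))
  *ₛ-comm f g (suc n) = trans (cong₂ _+_ (ℚ.*-comm (f 0) (g (suc n))) (*ₛ-comm (f ∘ suc) g n)) (sym (*ₛ-last g f n))

  constant : ℚ → Series
  constant x zero    = x
  constant x (suc n) = 0ℚ

  constant-*ₛ : ∀ x f n → (constant x *ₛ f) n ≡ x * f n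
  constant-*ₛ x f zero    = ℚ.+-identityʳ _
  constant-*ₛ x f (suc n) = trans (cong (x * f (suc n) +_) (*ₛ-zeroˡ f n)) (ℚ.+-identityʳ _)

  *ₛ-assoc : ∀ f g h → ((f *ₛ g) *ₛ h) ≈ₛ (f *ₛ (g *ₛ h))
  *ₛ-assoc f g h zero    = solve 3 (λ a b c → (a :* b :+ con (0 , 0)) :* c :+ con (0 , 0) := a :* (b :* c :+ con (0 , 0)) :+ con (0 , 0)) refl (f 0) (g 0) (h 0)
    where open ℚ-Solver
  *ₛ-assoc f g h (suc n) = begin
    -- The tail of a product is f₀ times the tail of g, plus the tail of f times g.
    (f 0 * g 0 + 0ℚ) * h (suc n) + (((f *ₛ g) ∘ suc) *ₛ h) n
      ≡⟨ cong ((f 0 * g 0 + 0ℚ) * h (suc n) +_) (trans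
           (*ₛ-cong {(f *ₛ g) ∘ suc} {(constant (f 0) *ₛ (g ∘ suc)) +ₛ ((f ∘ suc) *ₛ g)} {h} {h}
             (λ i → cong (_+ ((f ∘ suc) *ₛ g) i) (sym (constant-*ₛ (f 0) (g ∘ suc) i))) (λ _ → refl) n)
           (trans (*ₛ-distribʳ h (constant (f 0) *ₛ (g ∘ suc)) ((f ∘ suc) *ₛ g) n)
             (cong₂ _+_ (trans (scale (f 0) n) refl) (*ₛ-assoc (f ∘ suc) g h n)))) ⟩
    (f 0 * g 0 + 0ℚ) * h (suc n) + (f 0 * ((g ∘ suc) *ₛ h) n + ((f ∘ suc) *ₛ (g *ₛ h)) n)
      ≡⟨ solve 5 (λ a b c d e → (a :* b :+ con (0 , 0)) :* c :+ (a :* d :+ e) := a :* (b :* c :+ d) :+ e) refl (f 0) (g 0) (h (suc n)) _ _ ⟩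
    f 0 * (g 0 * h (suc n) + ((g ∘ suc) *ₛ h) n) + ((f ∘ suc) *ₛ (g *ₛ h)) n ∎
    where
    open ≡-Reasoning
    open ℚ-Solver

    scale-* : ∀ x g h n → ((constant x *ₛ g) *ₛ h) n ≡ x * (g *ₛ h) n
    scale-* x g h zero    = trans (cong (λ y → y * h 0 + 0ℚ) (constant-*ₛ x g 0))
      (solve 3 (λ x a b → x :* a :* b :+ con (0 , 0) := x :* (a :* b :+ con (0 , 0))) refl x (g 0) (h 0))
    scale-* x g h (suc n) = trans
      (cong₂ _+_ (cong (_* h (suc n)) (constant-*ₛ x g 0))
        (trans (*ₛ-cong {(constant x *ₛ g) ∘ suc} {constant x *ₛ (g ∘ suc)} {h} {h}
                 (λ i → trans (constant-*ₛ x g (suc i)) (sym (constant-*ₛ x (g ∘ suc) i))) (λ _ → refl) n)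
               (scale-* x (g ∘ suc) h n)))
      (solve 4 (λ x a b c → x :* a :* b :+ x :* c := x :* (a :* b :+ c)) refl x (g 0) (h (suc n)) _)

    scale : ∀ x n → ((constant x *ₛ (g ∘ suc)) *ₛ h) n ≡ x * ((g ∘ suc) *ₛ h) n
    scale x = scale-* x (g ∘ suc) h

  *ₛ-identityˡ : ∀ f → (1ₛ *ₛ f) ≈ₛ f
  *ₛ-identityˡ f n = trans (*ₛ-cong {1ₛ} {constant 1ℚ} {f} {f} (λ { zero → refl ; (suc _) → refl }) (λ _ → refl) n)
    (trans (constant-*ₛ 1ℚ f n) (ℚ.*-identityˡ (f n)))

  infix  8 ⊖_
  infixl 7 _⊗_
  infixl 6 _⊕_

  -- Sealed copies of the ring operations, since unification would otherwise
  -- unfold them to sums of coefficients.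
  opaque
    _⊕_ _⊗_ : Series → Series → Series
    _⊕_ = _+ₛ_
    _⊗_ = _*ₛ_

    ⊖_ : Series → Series
    ⊖_ = -ₛ_

    𝟘 : Series
    𝟘 = 0ₛ

  opaque
    unfolding _⊕_

    isCommutativeRing : IsCommutativeRing _≈ₛ_ _⊕_ _⊗_ ⊖_ 𝟘 1ₛ
    isCommutativeRing = record
      { isRing = record
        { +-isAbelianGroup = Pointwise.isAbelianGroup ℚ.+-0-isAbelianGroup
        ; *-cong           = *ₛ-cong
        ; *-assoc          = *ₛ-assoc
        ; *-identity       = *ₛ-identityˡ , λ f n → trans (*ₛ-comm f 1ₛ n) (*ₛ-identityˡ f n)
        ; distrib          = (λ h f g n → trans (*ₛ-comm h (f +ₛ g) n) (trans (*ₛ-distribʳ h f g n)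
                                            (cong₂ _+_ (*ₛ-comm f h n) (*ₛ-comm g h n))))
                           , *ₛ-distribʳ
        }
      ; *-comm = *ₛ-comm
      }

  seriesRing : CommutativeRing 0ℓ 0ℓ
  seriesRing = record { isCommutativeRing = isCommutativeRing }

  module 𝕊 = CommutativeRing seriesRing
  module 𝕊-Solver = IntegralRingSolver seriesRing

-- Exponential series, cancellation, inverse and logarithm

module ExpLog where

  open import Data.Fin.Base using (Fin; zero; suc; toℕ)
  open import Data.Nat.Base as ℕ using (ℕ; zero; suc; s≤s; _∸_; _!)
  import Data.Nat.Properties as ℕ
  open import Data.Product.Base using (_,_)
  open import Data.Rational.Base as ℚ using (ℚ; 0ℚ; 1ℚ; _+_; _*_; _-_; -_)
  import Data.Rational.Properties as ℚ
  open import Function.Base using (_∘_)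
  open import Relation.Binary.PropositionalEquality
  open import Relation.Nullary using (contradiction)
  open import Defs
  open RingSolving
  open ShiftedVandermondes using (module DividedDifferences)
  open HookFormula using (Generic)
  open PowerSeries

  open DividedDifferences seriesRing using (Cancellable)
  open import Algebra.Properties.Semiring.Exp 𝕊.semiring using () renaming (_^_ to _^ₚ_)

  shift : Series → Series
  shift f zero    = 0ℚ
  shift f (suc n) = f n

  -- the series t
  𝕥 : Series
  𝕥 = shift 1ₛ

  -- t d/dt
  D : Series → Series
  D f n = fromℕ n * f n

  -- Leibniz rule. The induction on the degree uses that the tail of `D f` is the tail of f plus `D`
  -- of that tail, as `suc n` is 1 + n.
  D-*ₛ : ∀ n f g → fromℕ n * (f *ₛ g) n ≡ (D f *ₛ g) n + (f *ₛ D g) n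
  D-*ₛ zero    f g = solve 2 (λ a b → con (0 , 0) :* (a :* b :+ con (0 , 0))
      := con (0 , 0) :* a :* b :+ con (0 , 0) :+ (a :* (con (0 , 0) :* b) :+ con (0 , 0))) refl (f 0) (g 0)
    where open ℚ-Solver
  D-*ₛ (suc n) f g = begin
    k * (f 0 * g (suc n) + X)
      ≡⟨ ℚ.*-distribˡ-+ k _ X ⟩
    k * (f 0 * g (suc n)) + k * X
      ≡⟨ cong (λ k′ → k * (f 0 * g (suc n)) + k′ * X) (fromℕ-suc n) ⟩
    k * (f 0 * g (suc n)) + (1ℚ + fromℕ n) * X
      ≡⟨ rearrange₁ k (f 0) (g (suc n)) (fromℕ n) X ⟩
    k * (f 0 * g (suc n)) + (X + fromℕ n * X)
      ≡⟨ cong (λ Y → k * (f 0 * g (suc n)) + (X + Y)) (D-*ₛ n (f ∘ suc) g) ⟩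
    k * (f 0 * g (suc n)) + (X + ((D (f ∘ suc) *ₛ g) n + ((f ∘ suc) *ₛ D g) n))
      ≡⟨ rearrange₂ k (f 0) (g (suc n)) X _ _ ⟩
    (0ℚ * f 0 * g (suc n) + (X + (D (f ∘ suc) *ₛ g) n)) + (f 0 * (k * g (suc n)) + ((f ∘ suc) *ₛ D g) n)
      ≡⟨ cong (λ Y → (0ℚ * f 0 * g (suc n) + Y) + (f 0 * (k * g (suc n)) + ((f ∘ suc) *ₛ D g) n)) tail≡ ⟨
    (D f *ₛ g) (suc n) + (f *ₛ D g) (suc n) ∎
    where
    open ≡-Reasoning
    open ℚ-Solver
    k = fromℕ (suc n)
    X = ((f ∘ suc) *ₛ g) n

    rearrange₁ : ∀ k a b m X → k * (a * b) + (1ℚ + m) * X ≡ k * (a * b) + (X + m * X)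
    rearrange₁ = solve 5 (λ k a b m X → k :* (a :* b) :+ (con (1 , 0) :+ m) :* X := k :* (a :* b) :+ (X :+ m :* X)) refl

    rearrange₂ : ∀ k a b X Y Z → k * (a * b) + (X + (Y + Z)) ≡ (0ℚ * a * b + (X + Y)) + (a * (k * b) + Z)
    rearrange₂ = solve 6 (λ k a b X Y Z → k :* (a :* b) :+ (X :+ (Y :+ Z))
      := (con (0 , 0) :* a :* b :+ (X :+ Y)) :+ (a :* (k :* b) :+ Z)) refl

    suc-distrib : ∀ m x → (1ℚ + m) * x ≡ x + m * x
    suc-distrib = solve 2 (λ m x → (con (1 , 0) :+ m) :* x := x :+ m :* x) refl

    tail≡ : ((D f ∘ suc) *ₛ g) n ≡ X + (D (f ∘ suc) *ₛ g) n
    tail≡ = trans (*ₛ-cong {D f ∘ suc} {(f ∘ suc) +ₛ D (f ∘ suc)} {g} {g}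
      (λ i → trans (cong (_* f (suc i)) (fromℕ-suc i)) (suc-distrib (fromℕ i) (f (suc i)))) (λ _ → refl) n)
      (*ₛ-distribʳ g (f ∘ suc) (D (f ∘ suc)) n)

  opaque
    unfolding _⊕_

    ⊕-at : ∀ f g n → (f ⊕ g) n ≡ f n + g n
    ⊕-at f g n = refl

    ⊖-at : ∀ f n → (⊖ f) n ≡ - f n
    ⊖-at f n = refl

    𝟘-at : ∀ n → 𝟘 n ≡ 0ℚ
    𝟘-at n = refl

    ⊗-at : ∀ f g n → (f ⊗ g) n ≡ (f *ₛ g) n
    ⊗-at f g n = refl

    ⊗-at-0 : ∀ f g → (f ⊗ g) 0 ≡ f 0 * g 0
    ⊗-at-0 f g = ℚ.+-identityʳ _

    ⊗-cong-≤ : ∀ n {f f′ g g′} → (∀ {i} → i ℕ.≤ n → f i ≡ f′ i) → (∀ {i} → i ℕ.≤ n → g i ≡ g′ i) →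
               (f ⊗ g) n ≡ (f′ ⊗ g′) n
    ⊗-cong-≤ = *ₛ-cong-≤

    constant-⊗ : ∀ x f n → (constant x ⊗ f) n ≡ x * f n
    constant-⊗ = constant-*ₛ

    𝕥-⊗ : ∀ f → 𝕥 ⊗ f ≈ₛ shift f
    𝕥-⊗ f zero    = trans (ℚ.+-identityʳ _) (ℚ.*-zeroˡ (f 0))
    𝕥-⊗ f (suc n) = trans (cong₂ _+_ (ℚ.*-zeroˡ (f (suc n))) (*ₛ-identityˡ f n)) (ℚ.+-identityˡ (f n))

    D-⊗ : ∀ f g → D (f ⊗ g) ≈ₛ D f ⊗ g ⊕ f ⊗ D g
    D-⊗ f g n = D-*ₛ n f g

    D-⊕ : ∀ f g → D (f ⊕ g) ≈ₛ D f ⊕ D g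
    D-⊕ f g n = ℚ.*-distribˡ-+ (fromℕ n) (f n) (g n)

    D-⊖ : ∀ f → D (⊖ f) ≈ₛ ⊖ D f
    D-⊖ f n = sym (ℚ.neg-distribʳ-* (fromℕ n) (f n))

    constant-+ : ∀ x y → constant (x + y) ≈ₛ constant x ⊕ constant y
    constant-+ x y zero    = refl
    constant-+ x y (suc n) = refl

    constant-neg : ∀ x → constant (- x) ≈ₛ ⊖ constant x
    constant-neg x zero    = refl
    constant-neg x (suc n) = refl

    D-constant : ∀ x → D (constant x) ≈ₛ 𝟘
    D-constant x zero    = ℚ.*-zeroˡ x
    D-constant x (suc n) = ℚ.*-zeroʳ (fromℕ (suc n))

    -ₛ≈⊖ : ∀ f g → f -ₛ g ≈ₛ f ⊕ ⊖ g
    -ₛ≈⊖ f g n = refl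

    tail-*≈0 : ∀ f g → f 0 ≡ 0ℚ → f ⊗ g ≈ₛ 𝟘 → (f ∘ suc) ⊗ g ≈ₛ 𝟘
    tail-*≈0 f g f0≡0 fg≈0 n = begin
      ((f ∘ suc) *ₛ g) n                       ≡⟨ ℚ.+-identityˡ _ ⟨
      0ℚ + ((f ∘ suc) *ₛ g) n                  ≡⟨ cong (_+ ((f ∘ suc) *ₛ g) n) (trans (cong (_* g (suc n)) f0≡0) (ℚ.*-zeroˡ (g (suc n)))) ⟨
      f 0 * g (suc n) + ((f ∘ suc) *ₛ g) n     ≡⟨ fg≈0 (suc n) ⟩
      0ℚ                                       ∎
      where open ≡-Reasoning

  constant-1 : constant 1ℚ ≈ₛ 1ₛ
  constant-1 zero    = refl
  constant-1 (suc n) = refl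

  constant-* : ∀ x y → constant (x * y) ≈ₛ constant x ⊗ constant y
  constant-* x y zero    = sym (constant-⊗ x (constant y) 0)
  constant-* x y (suc n) = sym (trans (constant-⊗ x (constant y) (suc n)) (ℚ.*-zeroʳ x))

  D-cong : ∀ {f g} → f ≈ₛ g → D f ≈ₛ D g
  D-cong f≈g n = cong (fromℕ n *_) (f≈g n)

  -- The lowest coefficient of f x is f₀ x₀, so x₀ = 0; then x can be divided by t and the argument
  -- repeated.
  nonzero⇒cancellable : ∀ {f} → f 0 ≢ 0ℚ → Cancellable f
  nonzero⇒cancellable {f} f0≢0 x fx≈0 n = trans (go n x (𝕊.trans (𝕊.*-comm x f) fx≈0)) (sym (𝟘-at n))
    where
    go : ∀ n x → x ⊗ f ≈ₛ 𝟘 → x n ≡ 0ℚ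
    head : ∀ x → x ⊗ f ≈ₛ 𝟘 → x 0 ≡ 0ℚ
    head x xf≈0 = nonzero-cancelˡ f0≢0 (trans (ℚ.*-comm (f 0) (x 0)) (trans (sym (⊗-at-0 x f)) (trans (xf≈0 0) (𝟘-at 0))))
    go zero    x xf≈0 = head x xf≈0
    go (suc n) x xf≈0 = go n (x ∘ suc) (tail-*≈0 x f (head x xf≈0) xf≈0)

  order-one⇒cancellable : ∀ {f} → f 0 ≡ 0ℚ → f 1 ≢ 0ℚ → Cancellable f
  order-one⇒cancellable {f} f0≡0 f1≢0 x fx≈0 = nonzero⇒cancellable {f ∘ suc} f1≢0 x (tail-*≈0 f x f0≡0 fx≈0)

  private
    move-factor : ∀ k x y z → k * (x * y * z) ≡ x * (y * (k * z))
    move-factor = solve 4 (λ k x y z → k :* (x :* y :* z) := x :* (y :* (k :* z))) refl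
      where open ℚ-Solver

  1/ℕ-! : ∀ n → fromℕ (suc n) * 1/ℕ (suc n !) {{suc n ℕ.!≢0}} ≡ 1/ℕ (n !) {{n ℕ.!≢0}}
  1/ℕ-! n = fromℕ-cancelˡ (n !) {{n ℕ.!≢0}} (begin
    fromℕ (n !) * (fromℕ (suc n) * inv)    ≡⟨ ℚ.*-assoc (fromℕ (n !)) (fromℕ (suc n)) inv ⟨
    fromℕ (n !) * fromℕ (suc n) * inv      ≡⟨ cong (_* inv) (trans (ℚ.*-comm (fromℕ (n !)) (fromℕ (suc n))) (sym (fromℕ-* (suc n) (n !)))) ⟩
    fromℕ (suc n !) * inv                  ≡⟨ fromℕ-1/ℕ (suc n !) {{suc n ℕ.!≢0}} ⟩
    1ℚ                                     ≡⟨ fromℕ-1/ℕ (n !) {{n ℕ.!≢0}} ⟨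
    fromℕ (n !) * 1/ℕ (n !) {{n ℕ.!≢0}}    ∎)
    where
    open ≡-Reasoning
    inv = 1/ℕ (suc n !) {{suc n ℕ.!≢0}}

  exp-suc : ∀ x n → fromℕ (suc n) * exp x (suc n) ≡ x * exp x n
  exp-suc x n = trans (move-factor (fromℕ (suc n)) x (x ^ n) (1/ℕ (suc n !) {{suc n ℕ.!≢0}}))
    (cong (λ y → x * (x ^ n * y)) (1/ℕ-! n))

  exp-1 : ∀ x → exp x 1 ≡ x
  exp-1 x = trans (ℚ.*-identityʳ (x * 1ℚ)) (ℚ.*-identityʳ x)

  D-exp : ∀ x → D (exp x) ≈ₛ exp x ⊗ (constant x ⊗ 𝕥)
  D-exp x = 𝕊.trans ode (𝕊.trans (𝕊.sym (𝕊.*-assoc (constant x) 𝕥 (exp x))) (𝕊.*-comm (constant x ⊗ 𝕥) (exp x)))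
    where
    ode : D (exp x) ≈ₛ constant x ⊗ (𝕥 ⊗ exp x)
    ode zero    = trans (ℚ.*-zeroˡ (exp x 0)) (sym (trans (constant-⊗ x (𝕥 ⊗ exp x) 0) (trans (cong (x *_) (𝕥-⊗ (exp x) 0)) (ℚ.*-zeroʳ x))))
    ode (suc n) = trans (exp-suc x n) (sym (trans (constant-⊗ x (𝕥 ⊗ exp x) (suc n)) (cong (x *_) (𝕥-⊗ (exp x) (suc n)))))

  -- The equation t f' = x t f is the recursion (n + 1) f_(n + 1) = x f_n. The functional equation
  -- of `exp` then follows from the Leibniz rule, in place of the binomial theorem.
  exp-unique : ∀ x f → f 0 ≡ 1ℚ → D f ≈ₛ f ⊗ (constant x ⊗ 𝕥) → f ≈ₛ exp x
  exp-unique x f f0≡1 Df≈ zero    = f0≡1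
  exp-unique x f f0≡1 Df≈ (suc n) = fromℕ-cancelˡ (suc n) (begin
    fromℕ (suc n) * f (suc n)               ≡⟨ Df≈ (suc n) ⟩
    (f ⊗ (constant x ⊗ 𝕥)) (suc n)          ≡⟨ 𝕊.trans (𝕊.*-comm f (constant x ⊗ 𝕥)) (𝕊.*-assoc (constant x) 𝕥 f) (suc n) ⟩
    (constant x ⊗ (𝕥 ⊗ f)) (suc n)          ≡⟨ trans (constant-⊗ x (𝕥 ⊗ f) (suc n)) (cong (x *_) (𝕥-⊗ f (suc n))) ⟩
    x * f n                                 ≡⟨ cong (x *_) (exp-unique x f f0≡1 Df≈ n) ⟩
    x * exp x n                             ≡⟨ exp-suc x n ⟨
    fromℕ (suc n) * exp x (suc n)           ∎)
    where open ≡-Reasoning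

  exp-+ : ∀ x y → exp x ⊗ exp y ≈ₛ exp (x + y)
  exp-+ x y = exp-unique (x + y) (exp x ⊗ exp y) (⊗-at-0 (exp x) (exp y)) (begin
    D (exp x ⊗ exp y)                                               ≈⟨ D-⊗ (exp x) (exp y) ⟩
    D (exp x) ⊗ exp y ⊕ exp x ⊗ D (exp y)                           ≈⟨ 𝕊.+-cong (𝕊.*-congʳ (D-exp x)) (𝕊.*-congˡ (D-exp y)) ⟩
    (exp x ⊗ (constant x ⊗ 𝕥)) ⊗ exp y ⊕ exp x ⊗ (exp y ⊗ (constant y ⊗ 𝕥))
      ≈⟨ solve 5 (λ e f x y t → (e :* (x :* t)) :* f :+ e :* (f :* (y :* t)) := e :* f :* ((x :+ y) :* t)) 𝕊.refl (exp x) (exp y) (constant x) (constant y) 𝕥 ⟩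
    exp x ⊗ exp y ⊗ ((constant x ⊕ constant y) ⊗ 𝕥)                 ≈⟨ 𝕊.*-congˡ (𝕊.*-congʳ (constant-+ x y)) ⟨
    exp x ⊗ exp y ⊗ (constant (x + y) ⊗ 𝕥)                          ∎)
    where
    open import Relation.Binary.Reasoning.Setoid 𝕊.setoid
    open 𝕊-Solver

  exp-zero : exp 0ℚ ≈ₛ 1ₛ
  exp-zero = 𝕊.sym (exp-unique 0ℚ 1ₛ refl λ n → trans (D-1 n) (sym (trans (*-1 n) (trans (constant-⊗ 0ℚ 𝕥 n) (ℚ.*-zeroˡ (𝕥 n))))))
    where
    *-1 : 1ₛ ⊗ (constant 0ℚ ⊗ 𝕥) ≈ₛ constant 0ℚ ⊗ 𝕥
    *-1 = 𝕊.*-identityˡ (constant 0ℚ ⊗ 𝕥)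
    D-1 : ∀ n → D 1ₛ n ≡ 0ℚ
    D-1 zero    = refl
    D-1 (suc n) = ℚ.*-zeroʳ (fromℕ (suc n))

  𝕢 : Series
  𝕢 = exp 1ℚ

  𝕢-^ : ∀ k → 𝕢 ^ₚ k ≈ₛ exp (fromℕ k)
  𝕢-^ zero    = 𝕊.sym exp-zero
  𝕢-^ (suc k) = 𝕊.trans (𝕊.*-congˡ (𝕢-^ k)) (𝕊.trans (exp-+ 1ℚ (fromℕ k)) (𝕊.reflexive (cong exp (sym (fromℕ-suc k)))))

  -- e^(at) has constant term 1, and e^(at) - e^(bt) has order one with linear coefficient a - b.
  𝕢-generic : Generic seriesRing 𝕢
  𝕢-generic = record
    { power-cancellable      = λ a → nonzero⇒cancellable {𝕢 ^ₚ a} (λ eq → contradiction (trans (sym (𝕢-^ a 0)) eq) λ ())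
    ; difference-cancellable = λ a b a≢b → order-one⇒cancellable {𝕢 ^ₚ a ⊕ ⊖ (𝕢 ^ₚ b)}
        (trans (difference a b 0) refl)
        (λ eq → a≢b (fromℕ-injective (x∙y⁻¹≈ε⇒x≈y (fromℕ a) (fromℕ b)
          (trans (sym (cong₂ _-_ (exp-1 (fromℕ a)) (exp-1 (fromℕ b)))) (trans (sym (difference a b 1)) eq)))))
    }
    where
    open import Algebra.Properties.Group ℚ.+-0-group using (x∙y⁻¹≈ε⇒x≈y)
    difference : ∀ a b n → (𝕢 ^ₚ a ⊕ ⊖ (𝕢 ^ₚ b)) n ≡ exp (fromℕ a) n - exp (fromℕ b) n
    difference a b n = trans (⊕-at (𝕢 ^ₚ a) (⊖ (𝕢 ^ₚ b)) n)
      (cong₂ _+_ (𝕢-^ a n) (trans (⊖-at (𝕢 ^ₚ b) n) (cong -_ (𝕢-^ b n))))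

  -- In `_∘ₛ_` the number of summands grows with the degree, so it is no ring expression in u. A
  -- fixed number K of summands gives one, which agrees with the composition in all degrees below K
  -- if u has constant term 0.
  partialSum : Series → Series → ℕ → Series
  partialSum g u zero    = 𝟘
  partialSum g u (suc K) = partialSum g u K ⊕ constant (g K) ⊗ u ^ₚ K

  ^-vanishes : ∀ {u} → u 0 ≡ 0ℚ → ∀ {n} k → n ℕ.< k → (u ^ₚ k) n ≡ 0ℚ
  ^-vanishes {u} u0≡0 {zero}  (suc k) _          = trans (⊗-at-0 u (u ^ₚ k)) (trans (cong (_* (u ^ₚ k) 0) u0≡0) (ℚ.*-zeroˡ ((u ^ₚ k) 0)))
  ^-vanishes {u} u0≡0 {suc n} (suc k) (s≤s n<k) = begin
    (u ⊗ u ^ₚ k) (suc n)                                    ≡⟨ ⊗-at u (u ^ₚ k) (suc n) ⟩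
    u 0 * (u ^ₚ k) (suc n) + ((u ∘ suc) *ₛ (u ^ₚ k)) n      ≡⟨ cong₂ _+_ (trans (cong (_* (u ^ₚ k) (suc n)) u0≡0) (ℚ.*-zeroˡ ((u ^ₚ k) (suc n)))) rest ⟩
    0ℚ                                                      ∎
    where
    open ≡-Reasoning
    rest : ((u ∘ suc) *ₛ (u ^ₚ k)) n ≡ 0ℚ
    rest = trans (*ₛ-comm (u ∘ suc) (u ^ₚ k) n)
      (trans (*ₛ-cong-≤ n {u ^ₚ k} {0ₛ} {u ∘ suc} {u ∘ suc} (λ i≤n → ^-vanishes u0≡0 k (ℕ.≤-<-trans i≤n n<k)) (λ _ → refl))
             (*ₛ-zeroˡ (u ∘ suc) n))

  ^ₛ≈^ₚ : ∀ u k → u ^ₛ k ≈ₛ u ^ₚ k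
  ^ₛ≈^ₚ u zero    n = refl
  ^ₛ≈^ₚ u (suc k) n = trans (*ₛ-cong {u} {u} (λ _ → refl) (^ₛ≈^ₚ u k) n) (sym (⊗-at u (u ^ₚ k) n))

  ∑-last : ∀ n (h : ℕ → ℚ) → ∑[ i ≤ suc n ] h (toℕ i) ≡ ∑[ i ≤ n ] h (toℕ i) + h (suc n)
  ∑-last zero    h = rearrange (h 0) (h 1)
    where
    open ℚ-Solver
    rearrange : ∀ a b → a + (b + 0ℚ) ≡ a + 0ℚ + b
    rearrange = solve 2 (λ a b → a :+ (b :+ con (0 , 0)) := a :+ con (0 , 0) :+ b) refl
  ∑-last (suc n) h = trans (cong (h 0 +_) (∑-last n (h ∘ suc))) (sym (ℚ.+-assoc (h 0) (∑[ i ≤ n ] h (suc (toℕ i))) (h (suc (suc n)))))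

  partialSum-at : ∀ g u K n → partialSum g u (suc K) n ≡ ∑[ k ≤ K ] (g (toℕ k) * (u ^ₚ toℕ k) n)
  partialSum-at g u zero    n = trans (⊕-at 𝟘 (constant (g 0) ⊗ u ^ₚ 0) n)
    (trans (cong₂ _+_ (𝟘-at n) (constant-⊗ (g 0) (u ^ₚ 0) n)) (trans (ℚ.+-identityˡ (g 0 * (u ^ₚ 0) n)) (sym (ℚ.+-identityʳ (g 0 * (u ^ₚ 0) n)))))
  partialSum-at g u (suc K) n = trans (⊕-at (partialSum g u (suc K)) (constant (g (suc K)) ⊗ u ^ₚ suc K) n)
    (trans (cong₂ _+_ (partialSum-at g u K n) (constant-⊗ (g (suc K)) (u ^ₚ suc K) n))
           (sym (∑-last K (λ k → g k * (u ^ₚ k) n))))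

  partialSum-stable : ∀ g {u} → u 0 ≡ 0ℚ → ∀ n j → partialSum g u (j ℕ.+ suc n) n ≡ partialSum g u (suc n) n
  partialSum-stable g {u} u0≡0 n zero    = refl
  partialSum-stable g {u} u0≡0 n (suc j) = begin
    partialSum g u (suc j ℕ.+ suc n) n                                               ≡⟨ ⊕-at (partialSum g u (j ℕ.+ suc n)) _ n ⟩
    partialSum g u (j ℕ.+ suc n) n + (constant (g (j ℕ.+ suc n)) ⊗ u ^ₚ (j ℕ.+ suc n)) n
      ≡⟨ cong₂ _+_ (partialSum-stable g u0≡0 n j) (trans (constant-⊗ (g (j ℕ.+ suc n)) (u ^ₚ (j ℕ.+ suc n)) n)
           (trans (cong (g (j ℕ.+ suc n) *_) (^-vanishes {u} u0≡0 (j ℕ.+ suc n) (ℕ.m≤n+m (suc n) j))) (ℚ.*-zeroʳ (g (j ℕ.+ suc n))))) ⟩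
    partialSum g u (suc n) n + 0ℚ                                                    ≡⟨ ℚ.+-identityʳ _ ⟩
    partialSum g u (suc n) n                                                         ∎
    where open ≡-Reasoning

  ∘ₛ-partialSum : ∀ g u → u 0 ≡ 0ℚ → ∀ {n K} → n ℕ.< K → (g ∘ₛ u) n ≡ partialSum g u K n
  ∘ₛ-partialSum g u u0≡0 {n} {K} n<K = begin
    (g ∘ₛ u) n                                          ≡⟨ sum-cong-≗ (λ (k : Fin (suc n)) → cong (g (toℕ k) *_) (^ₛ≈^ₚ u (toℕ k) n)) ⟩
    ∑[ k ≤ n ] (g (toℕ k) * (u ^ₚ toℕ k) n)             ≡⟨ partialSum-at g u n n ⟨
    partialSum g u (suc n) n                            ≡⟨ partialSum-stable g u0≡0 n (K ∸ suc n) ⟨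
    partialSum g u (K ∸ suc n ℕ.+ suc n) n              ≡⟨ cong (λ K → partialSum g u K n) (ℕ.m∸n+n≡m n<K) ⟩
    partialSum g u K n                                  ∎
    where
    open ≡-Reasoning
    open import Algebra.Properties.Monoid.Sum ℚ.+-0-monoid using (sum-cong-≗)

  geometric-telescope : ∀ u K → partialSum geometric u K ⊗ (1ₛ ⊕ ⊖ u) ≈ₛ 1ₛ ⊕ ⊖ (u ^ₚ K)
  geometric-telescope u zero    = solve 1 (λ u → con (0 , 0) :* (con (1 , 0) :- u) := con (1 , 0) :- con (1 , 0)) 𝕊.refl u
    where open 𝕊-Solver
  geometric-telescope u (suc K) = begin
    (P ⊕ constant 1ℚ ⊗ U) ⊗ (1ₛ ⊕ ⊖ u)           ≈⟨ 𝕊.*-congʳ (𝕊.+-congˡ (𝕊.*-congʳ constant-1)) ⟩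
    (P ⊕ 1ₛ ⊗ U) ⊗ (1ₛ ⊕ ⊖ u)                    ≈⟨ solve 3 (λ P U u → (P :+ con (1 , 0) :* U) :* (con (1 , 0) :- u) := P :* (con (1 , 0) :- u) :+ (U :- u :* U)) 𝕊.refl P U u ⟩
    P ⊗ (1ₛ ⊕ ⊖ u) ⊕ (U ⊕ ⊖ (u ⊗ U))             ≈⟨ 𝕊.+-congʳ (geometric-telescope u K) ⟩
    (1ₛ ⊕ ⊖ U) ⊕ (U ⊕ ⊖ (u ⊗ U))                 ≈⟨ solve 2 (λ U V → (con (1 , 0) :- U) :+ (U :- V) := con (1 , 0) :- V) 𝕊.refl U (u ⊗ U) ⟩
    1ₛ ⊕ ⊖ (u ⊗ U)                               ∎
    where
    open import Relation.Binary.Reasoning.Setoid 𝕊.setoid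
    open 𝕊-Solver
    P = partialSum geometric u K
    U = u ^ₚ K

  -- For the coefficient of tⁿ, n + 1 terms of the geometric series suffice; their product with f =
  -- 1 - u is 1 - u^(n + 1), and the remainder does not reach degree n.
  invₛ-inverse : ∀ f → f 0 ≡ 1ℚ → invₛ f ⊗ f ≈ₛ 1ₛ
  invₛ-inverse f f0≡1 n = begin
    (invₛ f ⊗ f) n                                      ≡⟨ ⊗-cong-≤ n {invₛ f} {P} {f} {f} (λ i≤n → ∘ₛ-partialSum geometric u u0≡0 (s≤s i≤n)) (λ _ → refl) ⟩
    (P ⊗ f) n                                           ≡⟨ 𝕊.*-congˡ {P} f≈ n ⟩
    (P ⊗ (1ₛ ⊕ ⊖ u)) n                                  ≡⟨ geometric-telescope u (suc n) n ⟩
    (1ₛ ⊕ ⊖ (u ^ₚ suc n)) n                             ≡⟨ ⊕-at 1ₛ (⊖ (u ^ₚ suc n)) n ⟩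
    1ₛ n + (⊖ (u ^ₚ suc n)) n                           ≡⟨ cong (1ₛ n +_) (trans (⊖-at (u ^ₚ suc n) n) (cong -_ (^-vanishes {u} u0≡0 (suc n) (ℕ.n<1+n n)))) ⟩
    1ₛ n + 0ℚ                                           ≡⟨ ℚ.+-identityʳ (1ₛ n) ⟩
    1ₛ n                                                ∎
    where
    open ≡-Reasoning
    u P : Series
    u = 1ₛ -ₛ f
    P = partialSum geometric u (suc n)

    u0≡0 : u 0 ≡ 0ℚ
    u0≡0 = cong (λ x → 1ℚ - x) f0≡1

    f≈ : f ≈ₛ 1ₛ ⊕ ⊖ u
    f≈ = 𝕊.trans (solve 2 (λ o f → f := o :- (o :- f)) 𝕊.refl 1ₛ f) (𝕊.+-congˡ (𝕊.-‿cong (𝕊.sym (-ₛ≈⊖ 1ₛ f))))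
      where open 𝕊-Solver

  D-^ : ∀ u k → D (u ^ₚ suc k) ≈ₛ constant (fromℕ (suc k)) ⊗ (u ^ₚ k ⊗ D u)
  D-^ u zero    = begin
    D (u ⊗ 1ₛ)                          ≈⟨ D-cong (𝕊.*-identityʳ u) ⟩
    D u                                 ≈⟨ solve 1 (λ d → d := con (1 , 0) :* (con (1 , 0) :* d)) 𝕊.refl (D u) ⟩
    1ₛ ⊗ (1ₛ ⊗ D u)                     ≈⟨ 𝕊.*-congʳ constant-1 ⟨
    constant 1ℚ ⊗ (1ₛ ⊗ D u)            ∎
    where
    open import Relation.Binary.Reasoning.Setoid 𝕊.setoid
    open 𝕊-Solver
  D-^ u (suc k) = begin
    D (u ⊗ U)                                          ≈⟨ D-⊗ u U ⟩
    D u ⊗ U ⊕ u ⊗ D U                                  ≈⟨ 𝕊.+-congˡ (𝕊.*-congˡ (D-^ u k)) ⟩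
    D u ⊗ (u ⊗ V) ⊕ u ⊗ (c ⊗ (V ⊗ D u))                ≈⟨ solve 4 (λ d u V c → d :* (u :* V) :+ u :* (c :* (V :* d)) := (con (1 , 0) :+ c) :* ((u :* V) :* d)) 𝕊.refl (D u) u V c ⟩
    (1ₛ ⊕ c) ⊗ (U ⊗ D u)                               ≈⟨ 𝕊.*-congʳ (𝕊.+-congʳ constant-1) ⟨
    (constant 1ℚ ⊕ c) ⊗ (U ⊗ D u)                      ≈⟨ 𝕊.*-congʳ (constant-+ 1ℚ (fromℕ (suc k))) ⟨
    constant (1ℚ + fromℕ (suc k)) ⊗ (U ⊗ D u)          ≈⟨ 𝕊.*-congʳ (𝕊.reflexive (cong constant (fromℕ-suc (suc k)))) ⟨
    constant (fromℕ (suc (suc k))) ⊗ (U ⊗ D u)         ∎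
    where
    open import Relation.Binary.Reasoning.Setoid 𝕊.setoid
    open 𝕊-Solver
    U = u ^ₚ suc k
    V = u ^ₚ k
    c = constant (fromℕ (suc k))

  log1+-suc : ∀ k → log1+ (suc k) * fromℕ (suc k) ≡ (- 1ℚ) ^ k
  log1+-suc k = begin
    (- 1ℚ) ^ k * 1/ℕ (suc k) * fromℕ (suc k)    ≡⟨ ℚ.*-assoc ((- 1ℚ) ^ k) (1/ℕ (suc k)) (fromℕ (suc k)) ⟩
    (- 1ℚ) ^ k * (1/ℕ (suc k) * fromℕ (suc k))  ≡⟨ cong ((- 1ℚ) ^ k *_) (trans (ℚ.*-comm (1/ℕ (suc k)) (fromℕ (suc k))) (fromℕ-1/ℕ (suc k))) ⟩
    (- 1ℚ) ^ k * 1ℚ                             ≡⟨ ℚ.*-identityʳ ((- 1ℚ) ^ k) ⟩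
    (- 1ℚ) ^ k                                  ∎
    where open ≡-Reasoning

  -- The derivative of the truncated logarithm is a finite geometric series in -u times that of u,
  -- and multiplication by 1 + u makes it telescope.
  log-telescope : ∀ u K →
    (1ₛ ⊕ u) ⊗ D (partialSum log1+ u (suc K)) ≈ₛ (1ₛ ⊕ ⊖ (constant ((- 1ℚ) ^ K) ⊗ u ^ₚ K)) ⊗ D u
  log-telescope u zero    = begin
    (1ₛ ⊕ u) ⊗ D (𝟘 ⊕ constant 0ℚ ⊗ 1ₛ)                ≈⟨ 𝕊.*-congˡ (D-cong (𝕊.trans (𝕊.+-identityˡ _) (𝕊.*-identityʳ (constant 0ℚ)))) ⟩
    (1ₛ ⊕ u) ⊗ D (constant 0ℚ)                         ≈⟨ 𝕊.*-congˡ (D-constant 0ℚ) ⟩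
    (1ₛ ⊕ u) ⊗ 𝟘                                       ≈⟨ solve 2 (λ u d → (con (1 , 0) :+ u) :* con (0 , 0) := (con (1 , 0) :- con (1 , 0) :* con (1 , 0)) :* d) 𝕊.refl u (D u) ⟩
    (1ₛ ⊕ ⊖ (1ₛ ⊗ 1ₛ)) ⊗ D u                           ≈⟨ 𝕊.*-congʳ (𝕊.+-congˡ (𝕊.-‿cong (𝕊.*-congʳ constant-1))) ⟨
    (1ₛ ⊕ ⊖ (constant 1ℚ ⊗ 1ₛ)) ⊗ D u                  ∎
    where
    open import Relation.Binary.Reasoning.Setoid 𝕊.setoid
    open 𝕊-Solver
  log-telescope u (suc K) = begin
    (1ₛ ⊕ u) ⊗ D (P ⊕ constant (log1+ (suc K)) ⊗ u ^ₚ suc K)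
      ≈⟨ 𝕊.*-congˡ (𝕊.trans (D-⊕ P (constant (log1+ (suc K)) ⊗ u ^ₚ suc K)) (𝕊.+-congˡ new-term)) ⟩
    (1ₛ ⊕ u) ⊗ (D P ⊕ s ⊗ (U ⊗ D u))
      ≈⟨ 𝕊.distribˡ (1ₛ ⊕ u) (D P) (s ⊗ (U ⊗ D u)) ⟩
    (1ₛ ⊕ u) ⊗ D P ⊕ (1ₛ ⊕ u) ⊗ (s ⊗ (U ⊗ D u))
      ≈⟨ 𝕊.+-congʳ (log-telescope u K) ⟩
    (1ₛ ⊕ ⊖ (s ⊗ U)) ⊗ D u ⊕ (1ₛ ⊕ u) ⊗ (s ⊗ (U ⊗ D u))
      ≈⟨ solve 4 (λ s U d u → (con (1 , 0) :- s :* U) :* d :+ (con (1 , 0) :+ u) :* (s :* (U :* d))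
           := d :+ s :* (u :* U) :* d) 𝕊.refl s U (D u) u ⟩
    D u ⊕ s ⊗ (u ⊗ U) ⊗ D u
      ≈⟨ solve 3 (λ s V d → d :+ s :* V :* d := (con (1 , 0) :- (:- con (1 , 0) :* s) :* V) :* d) 𝕊.refl s (u ⊗ U) (D u) ⟩
    (1ₛ ⊕ ⊖ ((⊖ 1ₛ ⊗ s) ⊗ (u ⊗ U))) ⊗ D u
      ≈⟨ 𝕊.*-congʳ (𝕊.+-congˡ (𝕊.-‿cong (𝕊.*-congʳ sign))) ⟩
    (1ₛ ⊕ ⊖ (constant ((- 1ℚ) ^ suc K) ⊗ u ^ₚ suc K)) ⊗ D u ∎
    where
    open import Relation.Binary.Reasoning.Setoid 𝕊.setoid
    open 𝕊-Solver
    P = partialSum log1+ u (suc K)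
    U = u ^ₚ K
    s = constant ((- 1ℚ) ^ K)

    sign : ⊖ 1ₛ ⊗ s ≈ₛ constant ((- 1ℚ) ^ suc K)
    sign = 𝕊.trans (𝕊.*-congʳ (𝕊.trans (𝕊.-‿cong (𝕊.sym constant-1)) (𝕊.sym (constant-neg 1ℚ))))
                   (𝕊.sym (constant-* (- 1ℚ) ((- 1ℚ) ^ K)))

    coefficient : constant (log1+ (suc K)) ⊗ constant (fromℕ (suc K)) ≈ₛ s
    coefficient = 𝕊.trans (𝕊.sym (constant-* (log1+ (suc K)) (fromℕ (suc K)))) (𝕊.reflexive (cong constant (log1+-suc K)))

    new-term : D (constant (log1+ (suc K)) ⊗ u ^ₚ suc K) ≈ₛ s ⊗ (U ⊗ D u)
    new-term = begin
      D (a ⊗ u ^ₚ suc K)                                         ≈⟨ D-⊗ a (u ^ₚ suc K) ⟩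
      D a ⊗ u ^ₚ suc K ⊕ a ⊗ D (u ^ₚ suc K)                      ≈⟨ 𝕊.+-cong (𝕊.*-congʳ (D-constant (log1+ (suc K)))) (𝕊.*-congˡ (D-^ u K)) ⟩
      𝟘 ⊗ u ^ₚ suc K ⊕ a ⊗ (constant (fromℕ (suc K)) ⊗ (U ⊗ D u)) ≈⟨ solve 4 (λ a c X W → con (0 , 0) :* X :+ a :* (c :* W) := (a :* c) :* W) 𝕊.refl a (constant (fromℕ (suc K))) (u ^ₚ suc K) (U ⊗ D u) ⟩
      (a ⊗ constant (fromℕ (suc K))) ⊗ (U ⊗ D u)                 ≈⟨ 𝕊.*-congʳ coefficient ⟩
      s ⊗ (U ⊗ D u)                                              ∎
      where a = constant (log1+ (suc K))

  D-logₛ : ∀ f → f 0 ≡ 1ℚ → D f ≈ₛ f ⊗ D (logₛ f)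
  D-logₛ f f0≡1 n = sym (begin
    (f ⊗ D (logₛ f)) n                                  ≡⟨ ⊗-cong-≤ n {f} {f} {D (logₛ f)} {D P} (λ _ → refl) (λ {i} i≤n → cong (fromℕ i *_) (∘ₛ-partialSum log1+ u u0≡0 (s≤s (ℕ.m≤n⇒m≤1+n i≤n)))) ⟩
    (f ⊗ D P) n                                         ≡⟨ 𝕊.*-congʳ {D P} f≈ n ⟩
    ((1ₛ ⊕ u) ⊗ D P) n                                  ≡⟨ log-telescope u (suc n) n ⟩
    ((1ₛ ⊕ ⊖ (c ⊗ u ^ₚ suc n)) ⊗ D u) n                 ≡⟨ ⊗-cong-≤ n {_} {1ₛ} {D u} {D u} vanish (λ _ → refl) ⟩
    (1ₛ ⊗ D u) n                                        ≡⟨ 𝕊.*-identityˡ (D u) n ⟩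
    D u n                                               ≡⟨ Du≈Df n ⟩
    D f n                                               ∎)
    where
    open ≡-Reasoning
    u P c : Series
    u = f -ₛ 1ₛ
    -- One summand more than degree n asks for, so that the remainder of `log-telescope` is a
    -- multiple of u^(n + 1).
    P = partialSum log1+ u (suc (suc n))
    c = constant ((- 1ℚ) ^ suc n)

    u0≡0 : u 0 ≡ 0ℚ
    u0≡0 = cong (_- 1ℚ) f0≡1

    f≈ : f ≈ₛ 1ₛ ⊕ u
    f≈ = 𝕊.trans (solve 2 (λ o f → f := o :+ (f :- o)) 𝕊.refl 1ₛ f) (𝕊.+-congˡ (𝕊.sym (-ₛ≈⊖ f 1ₛ)))
      where open 𝕊-Solver

    Du≈Df : D u ≈ₛ D f
    Du≈Df zero    = trans (ℚ.*-zeroˡ (u 0)) (sym (ℚ.*-zeroˡ (f 0)))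
    Du≈Df (suc n) = cong (fromℕ (suc n) *_) (ℚ.+-identityʳ (f (suc n)))

    vanish : ∀ {i} → i ℕ.≤ n → (1ₛ ⊕ ⊖ (c ⊗ u ^ₚ suc n)) i ≡ 1ₛ i
    vanish {i} i≤n = trans (⊕-at 1ₛ (⊖ (c ⊗ u ^ₚ suc n)) i) (trans
      (cong (1ₛ i +_) (trans (⊖-at (c ⊗ u ^ₚ suc n) i) (cong -_ (trans (constant-⊗ ((- 1ℚ) ^ suc n) (u ^ₚ suc n) i)
        (trans (cong ((- 1ℚ) ^ suc n *_) (^-vanishes {u} u0≡0 (suc n) (s≤s i≤n))) (ℚ.*-zeroʳ ((- 1ℚ) ^ suc n)))))))
      (ℚ.+-identityʳ (1ₛ i)))

-- Logarithmic derivatives and Bernoulli numbers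

module LogDerivatives where

  open import Defs
  open import Data.List.Base using (List; []; _∷_; foldr; length; applyUpTo; map)
  open import Data.List.Relation.Binary.Permutation.Propositional as ↭ using (_↭_)
  open import Data.Nat.Base as ℕ using (ℕ; zero; suc; s≤s; _<_)
  open import Data.Nat.ListAction using (sum)
  import Data.Nat.Properties as ℕ
  open import Data.Product.Base using (_,_)
  open import Data.Rational.Base as ℚ using (ℚ; 0ℚ; 1ℚ; _+_; _*_; _-_; -_)
  import Data.Rational.Properties as ℚ
  open import Function.Base using (_∘_)
  open import Relation.Binary.PropositionalEquality
  open import Relation.Nullary using (contradiction)
  open RingSolving
  open Shapes
  open ShiftedVandermondes using (module DividedDifferences)
  open Products using (module ListSums)
  open HookFormula using (Generic; module QHookFormula)
  open Fillings using (maj-SYT↭majʷ-words; parts-decreasing)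
  open PowerSeries
  open ExpLog

  open DividedDifferences seriesRing
  open ListSums seriesRing
  open QHookFormula seriesRing 𝕢 𝕢-generic
  open import Algebra.Properties.Semiring.Exp 𝕊.semiring using () renaming (_^_ to _^ₚ_)

  -- Stated without a quotient, so that it also applies to 1 - e^(kt), which has constant term 0.
  IsLogDerivative : Series → Series → Set
  IsLogDerivative f l = D f ≈ₛ f ⊗ l

  logDerivative-cong : ∀ {f g l} → f ≈ₛ g → IsLogDerivative f l → IsLogDerivative g l
  logDerivative-cong f≈g Df≈ = 𝕊.trans (D-cong (𝕊.sym f≈g)) (𝕊.trans Df≈ (𝕊.*-congʳ f≈g))

  logDerivative-⊗ : ∀ {f g l m} → IsLogDerivative f l → IsLogDerivative g m → IsLogDerivative (f ⊗ g) (l ⊕ m)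
  logDerivative-⊗ {f} {g} {l} {m} Df≈ Dg≈ = begin
    D (f ⊗ g)                      ≈⟨ D-⊗ f g ⟩
    D f ⊗ g ⊕ f ⊗ D g              ≈⟨ 𝕊.+-cong (𝕊.*-congʳ Df≈) (𝕊.*-congˡ Dg≈) ⟩
    f ⊗ l ⊗ g ⊕ f ⊗ (g ⊗ m)        ≈⟨ solve 4 (λ f g l m → f :* l :* g :+ f :* (g :* m) := f :* g :* (l :+ m)) 𝕊.refl f g l m ⟩
    f ⊗ g ⊗ (l ⊕ m)                ∎
    where
    open import Relation.Binary.Reasoning.Setoid 𝕊.setoid
    open 𝕊-Solver

  logDerivative-constant : ∀ x → IsLogDerivative (constant x) 𝟘
  logDerivative-constant x = 𝕊.trans (D-constant x) (𝕊.sym (𝕊.zeroʳ (constant x)))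

  logDerivative-∏ : {A : Set} (f l : A → Series) (xs : List A) → (∀ x → IsLogDerivative (f x) (l x)) →
                    IsLogDerivative (∏ f xs) (∑ l xs)
  logDerivative-∏ f l []       Df≈ = logDerivative-cong constant-1 (logDerivative-constant 1ℚ)
  logDerivative-∏ f l (x ∷ xs) Df≈ = logDerivative-⊗ (Df≈ x) (logDerivative-∏ f l xs Df≈)

  logDerivative-unique : ∀ {f g l m} → Cancellable f → f ≈ₛ g → IsLogDerivative f l → IsLogDerivative g m → l ≈ₛ m
  logDerivative-unique f-cancellable f≈g Df≈ Dg≈ = cancel f-cancellable
    (𝕊.trans (𝕊.sym Df≈) (𝕊.trans (D-cong f≈g) (𝕊.trans Dg≈ (𝕊.*-congʳ (𝕊.sym f≈g)))))

  logDerivative-𝕢^ : ∀ k → IsLogDerivative (𝕢 ^ₚ k) (constant (fromℕ k) ⊗ 𝕥)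
  logDerivative-𝕢^ k = logDerivative-cong (𝕊.sym (𝕢-^ k)) (D-exp (fromℕ k))

  -- f(xt)
  dilate : ℚ → Series → Series
  dilate x f n = x ^ n * f n

  dilate-cong : ∀ x {f g} → f ≈ₛ g → dilate x f ≈ₛ dilate x g
  dilate-cong x f≈g n = cong (x ^ n *_) (f≈g n)

  dilate-*ₛ : ∀ x f g n → x ^ n * (f *ₛ g) n ≡ (dilate x f *ₛ dilate x g) n
  dilate-*ₛ x f g zero    = rearrange (f 0) (g 0)
    where
    open ℚ-Solver
    rearrange : ∀ a b → 1ℚ * (a * b + 0ℚ) ≡ 1ℚ * a * (1ℚ * b) + 0ℚ
    rearrange = solve 2 (λ a b → con (1 , 0) :* (a :* b :+ con (0 , 0)) := con (1 , 0) :* a :* (con (1 , 0) :* b) :+ con (0 , 0)) refl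
  dilate-*ₛ x f g (suc n) = begin
    x * x ^ n * (f 0 * g (suc n) + ((f ∘ suc) *ₛ g) n)
      ≡⟨ rearrange x (x ^ n) (f 0) (g (suc n)) (((f ∘ suc) *ₛ g) n) ⟩
    1ℚ * f 0 * (x * x ^ n * g (suc n)) + x * (x ^ n * ((f ∘ suc) *ₛ g) n)
      ≡⟨ cong (λ y → 1ℚ * f 0 * (x * x ^ n * g (suc n)) + x * y) (dilate-*ₛ x (f ∘ suc) g n) ⟩
    1ℚ * f 0 * (x * x ^ n * g (suc n)) + x * (dilate x (f ∘ suc) *ₛ dilate x g) n
      ≡⟨ cong (1ℚ * f 0 * (x * x ^ n * g (suc n)) +_) tail≡ ⟩
    (dilate x f *ₛ dilate x g) (suc n) ∎
    where
    open ≡-Reasoning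
    open ℚ-Solver
    rearrange : ∀ x y a b X → x * y * (a * b + X) ≡ 1ℚ * a * (x * y * b) + x * (y * X)
    rearrange = solve 5 (λ x y a b X → x :* y :* (a :* b :+ X) := con (1 , 0) :* a :* (x :* y :* b) :+ x :* (y :* X)) refl

    tail≡ : x * (dilate x (f ∘ suc) *ₛ dilate x g) n ≡ ((dilate x f ∘ suc) *ₛ dilate x g) n
    tail≡ = begin
      x * (dilate x (f ∘ suc) *ₛ dilate x g) n                     ≡⟨ constant-*ₛ x (dilate x (f ∘ suc) *ₛ dilate x g) n ⟨
      (constant x *ₛ (dilate x (f ∘ suc) *ₛ dilate x g)) n         ≡⟨ *ₛ-assoc (constant x) (dilate x (f ∘ suc)) (dilate x g) n ⟨
      ((constant x *ₛ dilate x (f ∘ suc)) *ₛ dilate x g) n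
        ≡⟨ *ₛ-cong {constant x *ₛ dilate x (f ∘ suc)} {dilate x f ∘ suc} {dilate x g} {dilate x g}
             (λ i → trans (constant-*ₛ x (dilate x (f ∘ suc)) i) (sym (ℚ.*-assoc x (x ^ i) (f (suc i))))) (λ _ → refl) n ⟩
      ((dilate x f ∘ suc) *ₛ dilate x g) n                         ∎

  dilate-⊗ : ∀ x f g → dilate x (f ⊗ g) ≈ₛ dilate x f ⊗ dilate x g
  dilate-⊗ x f g n = trans (cong (x ^ n *_) (⊗-at f g n)) (trans (dilate-*ₛ x f g n) (sym (⊗-at (dilate x f) (dilate x g) n)))

  dilate-exp : ∀ x y → dilate x (exp y) ≈ₛ exp (x * y)
  dilate-exp x y n = trans (sym (ℚ.*-assoc (x ^ n) (y ^ n) _)) (cong (_* _) (powers n))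
    where
    open ℚ-Solver
    rearrange : ∀ a b c d → a * b * (c * d) ≡ a * c * (b * d)
    rearrange = solve 4 (λ a b c d → a :* b :* (c :* d) := a :* c :* (b :* d)) refl
    powers : ∀ n → x ^ n * y ^ n ≡ (x * y) ^ n
    powers zero    = refl
    powers (suc n) = trans (rearrange x (x ^ n) y (y ^ n)) (cong (x * y *_) (powers n))

  dilate-1ₛ : ∀ x → dilate x 1ₛ ≈ₛ 1ₛ
  dilate-1ₛ x zero    = refl
  dilate-1ₛ x (suc n) = ℚ.*-zeroʳ (x ^ suc n)

  dilate-𝕥 : ∀ x → dilate x 𝕥 ≈ₛ constant x ⊗ 𝕥
  dilate-𝕥 x n = trans (coefficient n) (sym (constant-⊗ x 𝕥 n))
    where
    coefficient : ∀ n → x ^ n * 𝕥 n ≡ x * 𝕥 n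
    coefficient zero          = sym (ℚ.*-zeroʳ x)
    coefficient (suc zero)    = cong (_* 1ℚ) (ℚ.*-identityʳ x)
    coefficient (suc (suc n)) = trans (ℚ.*-zeroʳ (x ^ suc (suc n))) (sym (ℚ.*-zeroʳ x))

  dilate-complement : ∀ x f → dilate x (1ₛ ⊕ ⊖ f) ≈ₛ 1ₛ ⊕ ⊖ dilate x f
  dilate-complement x f n = begin
    x ^ n * (1ₛ ⊕ ⊖ f) n              ≡⟨ cong (x ^ n *_) (trans (⊕-at 1ₛ (⊖ f) n) (cong (1ₛ n +_) (⊖-at f n))) ⟩
    x ^ n * (1ₛ n - f n)              ≡⟨ rearrange (x ^ n) (1ₛ n) (f n) ⟩
    x ^ n * 1ₛ n - x ^ n * f n        ≡⟨ cong (_- x ^ n * f n) (dilate-1ₛ x n) ⟩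
    1ₛ n - x ^ n * f n                ≡⟨ trans (⊕-at 1ₛ (⊖ dilate x f) n) (cong (1ₛ n +_) (⊖-at (dilate x f) n)) ⟨
    (1ₛ ⊕ ⊖ dilate x f) n             ∎
    where
    open ≡-Reasoning
    open ℚ-Solver
    rearrange : ∀ a b c → a * (b - c) ≡ a * b - a * c
    rearrange = solve 3 (λ a b c → a :* (b :- c) := a :* b :- a :* c) refl

  bernoulliDenominator : Series
  bernoulliDenominator k = (1ₛ -ₛ exp (- 1ℚ)) (suc k)

  -- t/(1 - e⁻ᵗ)
  𝔹 : Series
  𝔹 = invₛ bernoulliDenominator

  𝔹-equation : (1ₛ ⊕ ⊖ exp (- 1ℚ)) ⊗ 𝔹 ≈ₛ 𝕥
  𝔹-equation = begin
    (1ₛ ⊕ ⊖ exp (- 1ℚ)) ⊗ 𝔹               ≈⟨ 𝕊.*-congʳ numerator ⟩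
    𝕥 ⊗ bernoulliDenominator ⊗ 𝔹          ≈⟨ solve 3 (λ t d b → t :* d :* b := t :* (b :* d)) 𝕊.refl 𝕥 bernoulliDenominator 𝔹 ⟩
    𝕥 ⊗ (𝔹 ⊗ bernoulliDenominator)        ≈⟨ 𝕊.*-congˡ (invₛ-inverse bernoulliDenominator refl) ⟩
    𝕥 ⊗ 1ₛ                                ≈⟨ 𝕊.*-identityʳ 𝕥 ⟩
    𝕥                                     ∎
    where
    open import Relation.Binary.Reasoning.Setoid 𝕊.setoid
    open 𝕊-Solver
    numerator : 1ₛ ⊕ ⊖ exp (- 1ℚ) ≈ₛ 𝕥 ⊗ bernoulliDenominator
    numerator n = trans (sym (-ₛ≈⊖ 1ₛ (exp (- 1ℚ)) n)) (trans (shifted n) (sym (𝕥-⊗ bernoulliDenominator n)))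
      where
      shifted : ∀ n → (1ₛ -ₛ exp (- 1ℚ)) n ≡ shift bernoulliDenominator n
      shifted zero    = refl
      shifted (suc n) = refl

  -- Applying t d/dt to 1 - e^(kt) gives -kt e^(kt). Here kt is (1 - e^(-kt)) 𝔹(kt) by dilating the
  -- equation of 𝔹, and -e^(kt) (1 - e^(-kt)) = 1 - e^(kt).
  logDerivative-factor : ∀ k → IsLogDerivative (factor k) (dilate (fromℕ k) 𝔹)
  logDerivative-factor k = logDerivative-cong {1ₛ ⊕ ⊖ E} (𝕊.+-congˡ (𝕊.-‿cong (𝕊.sym (𝕢-^ k)))) (begin
    D (1ₛ ⊕ ⊖ E)                           ≈⟨ 𝕊.trans (D-⊕ 1ₛ (⊖ E)) (𝕊.+-cong D-1ₛ (𝕊.trans (D-⊖ E) (𝕊.-‿cong (D-exp x)))) ⟩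
    𝟘 ⊕ ⊖ (E ⊗ (constant x ⊗ 𝕥))           ≈⟨ 𝕊.+-congˡ (𝕊.-‿cong (𝕊.*-congˡ (𝕊.sym equation))) ⟩
    𝟘 ⊕ ⊖ (E ⊗ ((1ₛ ⊕ ⊖ E⁻) ⊗ B))          ≈⟨ solve 3 (λ e e⁻ b → con (0 , 0) :- e :* ((con (1 , 0) :- e⁻) :* b) := (e :* e⁻ :- e) :* b) 𝕊.refl E E⁻ B ⟩
    (E ⊗ E⁻ ⊕ ⊖ E) ⊗ B                     ≈⟨ 𝕊.*-congʳ (𝕊.+-congʳ inverse) ⟩
    (1ₛ ⊕ ⊖ E) ⊗ B                         ∎)
    where
    open import Relation.Binary.Reasoning.Setoid 𝕊.setoid
    open 𝕊-Solver
    x = fromℕ k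
    E = exp x
    E⁻ = exp (x * - 1ℚ)
    B = dilate x 𝔹

    D-1ₛ : D 1ₛ ≈ₛ 𝟘
    D-1ₛ = 𝕊.trans (D-cong (𝕊.sym constant-1)) (D-constant 1ℚ)

    x-x≡0 : x + x * - 1ℚ ≡ 0ℚ
    x-x≡0 = trans (cong (x +_) (trans (sym (ℚ.neg-distribʳ-* x 1ℚ)) (cong -_ (ℚ.*-identityʳ x)))) (ℚ.+-inverseʳ x)

    inverse : E ⊗ E⁻ ≈ₛ 1ₛ
    inverse = 𝕊.trans (exp-+ x (x * - 1ℚ)) (𝕊.trans (𝕊.reflexive (cong exp x-x≡0)) exp-zero)

    equation : (1ₛ ⊕ ⊖ E⁻) ⊗ B ≈ₛ constant x ⊗ 𝕥
    equation = begin
      (1ₛ ⊕ ⊖ E⁻) ⊗ B                                ≈⟨ 𝕊.*-congʳ (𝕊.+-congˡ (𝕊.-‿cong (dilate-exp x (- 1ℚ)))) ⟨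
      (1ₛ ⊕ ⊖ dilate x (exp (- 1ℚ))) ⊗ B             ≈⟨ 𝕊.*-congʳ (dilate-complement x (exp (- 1ℚ))) ⟨
      dilate x (1ₛ ⊕ ⊖ exp (- 1ℚ)) ⊗ B               ≈⟨ dilate-⊗ x (1ₛ ⊕ ⊖ exp (- 1ℚ)) 𝔹 ⟨
      dilate x ((1ₛ ⊕ ⊖ exp (- 1ℚ)) ⊗ 𝔹)             ≈⟨ dilate-cong x 𝔹-equation ⟩
      dilate x 𝕥                                     ≈⟨ dilate-𝕥 x ⟩
      constant x ⊗ 𝕥                                 ∎

  ∑-at : {A : Set} (f : A → Series) (xs : List A) → ∀ n → ∑ f xs n ≡ foldr _+_ 0ℚ (map (λ x → f x n) xs)
  ∑-at f []       n = 𝟘-at n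
  ∑-at f (x ∷ xs) n = trans (⊕-at (f x) (∑ f xs) n) (cong (f x n +_) (∑-at f xs n))

  ∑-dilate : ∀ f ks n → ∑ (λ k → dilate (fromℕ k) f) ks n ≡ fromℕ (sum (map (ℕ._^ n) ks)) * f n
  ∑-dilate f []       n = trans (𝟘-at n) (sym (ℚ.*-zeroˡ (f n)))
  ∑-dilate f (k ∷ ks) n = begin
    ∑ (λ k → dilate (fromℕ k) f) (k ∷ ks) n                      ≡⟨ ⊕-at (dilate (fromℕ k) f) (∑ (λ k → dilate (fromℕ k) f) ks) n ⟩
    fromℕ k ^ n * f n + ∑ (λ k → dilate (fromℕ k) f) ks n        ≡⟨ cong₂ (λ x y → x * f n + y) (sym (fromℕ-^ k n)) (∑-dilate f ks n) ⟩
    fromℕ (k ℕ.^ n) * f n + fromℕ s * f n                        ≡⟨ ℚ.*-distribʳ-+ (f n) (fromℕ (k ℕ.^ n)) (fromℕ s) ⟨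
    (fromℕ (k ℕ.^ n) + fromℕ s) * f n                            ≡⟨ cong (_* f n) (fromℕ-+ (k ℕ.^ n) s) ⟨
    fromℕ (k ℕ.^ n ℕ.+ s) * f n                                  ∎
    where
    open ≡-Reasoning
    s = sum (map (ℕ._^ n) ks)

  ∑-↭ : {A : Set} (f : A → Series) {xs ys : List A} → xs ↭ ys → ∑ f xs ≈ₛ ∑ f ys
  ∑-↭ f ↭.refl            = 𝕊.refl
  ∑-↭ f (↭.prep x xs↭ys)  = 𝕊.+-congˡ (∑-↭ f xs↭ys)
  ∑-↭ f {_} {_ ∷ _ ∷ ys} (↭.swap x y xs↭ys) = 𝕊.trans (𝕊.+-congˡ (𝕊.+-congˡ (∑-↭ f xs↭ys)))
    (solve 3 (λ a b c → a :+ (b :+ c) := b :+ (a :+ c)) 𝕊.refl (f x) (f y) (∑ f ys))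
    where open 𝕊-Solver
  ∑-↭ f (↭.trans p q)     = 𝕊.trans (∑-↭ f p) (∑-↭ f q)

  module _ {A : Set} (X : A → ℚ) where

    exponentials : List A → Series
    exponentials = ∑ (exp ∘ X)

    mgf≈ : ∀ ω ωs → constant (fromℕ (length (ω ∷ ωs))) ⊗ mgf (ω ∷ ωs) X ≈ₛ exponentials (ω ∷ ωs)
    mgf≈ ω ωs n = begin
      (constant N ⊗ mgf (ω ∷ ωs) X) n                ≡⟨ constant-⊗ N (mgf (ω ∷ ωs) X) n ⟩
      N * (S * 1/ℕ (length (ω ∷ ωs)))                ≡⟨ rearrange N S (1/ℕ (length (ω ∷ ωs))) ⟩
      S * (N * 1/ℕ (length (ω ∷ ωs)))                ≡⟨ cong (S *_) (fromℕ-1/ℕ (length (ω ∷ ωs))) ⟩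
      S * 1ℚ                                         ≡⟨ ℚ.*-identityʳ S ⟩
      S                                              ≡⟨ ∑-at (exp ∘ X) (ω ∷ ωs) n ⟨
      exponentials (ω ∷ ωs) n                        ∎
      where
      open ≡-Reasoning
      open ℚ-Solver
      N = fromℕ (length (ω ∷ ωs))
      S = foldr _+_ 0ℚ (map (λ ω → exp (X ω) n) (ω ∷ ωs))
      rearrange : ∀ a b c → a * (b * c) ≡ b * (a * c)
      rearrange = solve 3 (λ a b c → a :* (b :* c) := b :* (a :* c)) refl

    mgf-0 : ∀ ω ωs → mgf (ω ∷ ωs) X 0 ≡ 1ℚ
    mgf-0 ω ωs = trans (cong (_* 1/ℕ (length (ω ∷ ωs))) (ones (ω ∷ ωs))) (fromℕ-1/ℕ (length (ω ∷ ωs)))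
      where
      ones : ∀ ωs → foldr _+_ 0ℚ (map (λ ω → exp (X ω) 0) ωs) ≡ fromℕ (length ωs)
      ones []       = refl
      ones (ω ∷ ωs) = trans (cong (exp (X ω) 0 +_) (ones ωs)) (sym (fromℕ-suc (length ωs)))

    -- The number of outcomes is a constant factor and has logarithmic derivative 0, so the
    -- expectation may be replaced by the plain sum.
    logDerivative-exponentials : ∀ ω ωs → IsLogDerivative (exponentials (ω ∷ ωs)) (D (logₛ (mgf (ω ∷ ωs) X)))
    logDerivative-exponentials ω ωs = logDerivative-cong (mgf≈ ω ωs)
      (𝕊.trans (logDerivative-⊗ (logDerivative-constant (fromℕ (length (ω ∷ ωs)))) (D-logₛ (mgf (ω ∷ ωs) X) (mgf-0 ω ωs)))
        (𝕊.*-congˡ (𝕊.+-identityˡ _)))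

  module _ {n : ℕ} (μ : Partition n) where

    private
      X : Filling μ → ℚ
      X = fromℕ ∘ maj μ

      as = parts μ
      base top : ℕ
      base = exponent (Data.List.Base.replicate (length as) 0)
      top  = exponent as

    exponentials-formula : exponentials X (SYT μ) ⊗ hookProduct as ⊗ 𝕢 ^ₚ base ≈ₛ ∏ factor (applyUpTo suc n) ⊗ 𝕢 ^ₚ top
    exponentials-formula = begin
      exponentials X (SYT μ) ⊗ hookProduct as ⊗ 𝕢 ^ₚ base
        ≈⟨ 𝕊.*-congʳ (𝕊.*-congʳ (∑-cong (SYT μ) (λ T _ → 𝕢-^ (maj μ T)))) ⟨
      ∑ (λ T → 𝕢 ^ₚ maj μ T) (SYT μ) ⊗ hookProduct as ⊗ 𝕢 ^ₚ base
        ≈⟨ 𝕊.*-congʳ (𝕊.*-congʳ (𝕊.trans (𝕊.sym (∑-map (𝕢 ^ₚ_) (maj μ) (SYT μ)))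
             (𝕊.trans (∑-↭ (𝕢 ^ₚ_) (maj-SYT↭majʷ-words μ)) (∑-map (𝕢 ^ₚ_) majʷ (words n as))))) ⟩
      ∑ (λ w → 𝕢 ^ₚ majʷ w) (words n as) ⊗ hookProduct as ⊗ 𝕢 ^ₚ base
        ≈⟨ subst (λ n → ∑ (λ w → 𝕢 ^ₚ majʷ w) (words n as) ⊗ hookProduct as ⊗ 𝕢 ^ₚ base ≈ₛ pochhammer n ⊗ 𝕢 ^ₚ top)
             (sum-parts μ) (q-hook-formula as (parts-decreasing μ)) ⟩
      pochhammer n ⊗ 𝕢 ^ₚ top
        ≈⟨ 𝕊.*-congʳ (∏-applyUpTo factor suc n) ⟨
      ∏ factor (applyUpTo suc n) ⊗ 𝕢 ^ₚ top ∎
      where open import Relation.Binary.Reasoning.Setoid 𝕊.setoid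

    right-cancellable : Cancellable (∏ factor (applyUpTo suc n) ⊗ 𝕢 ^ₚ top)
    right-cancellable = cancellable-* (cancellable-∏ factor (applyUpTo suc n)
      (All.applyUpTo⁺₂ suc n (λ i → factor-cancellable {suc i} (λ ())))) (power-cancellable top)
      where
      import Data.List.Relation.Unary.All.Properties as All
      open Generic 𝕢-generic

    logDerivatives : D (logₛ (mgf (SYT μ) X)) ⊕ ∑ (λ k → dilate (fromℕ k) 𝔹) (hooks as) ⊕ constant (fromℕ base) ⊗ 𝕥
                  ≈ₛ ∑ (λ k → dilate (fromℕ k) 𝔹) (applyUpTo suc n) ⊕ constant (fromℕ top) ⊗ 𝕥
    logDerivatives = compare (SYT μ) exponentials-formula
      where
      open import Relation.Binary.Reasoning.Setoid 𝕊.setoid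
      open 𝕊-Solver
      right = ∏ factor (applyUpTo suc n) ⊗ 𝕢 ^ₚ top
      compare : ∀ ωs → exponentials X ωs ⊗ hookProduct as ⊗ 𝕢 ^ₚ base ≈ₛ right →
        D (logₛ (mgf ωs X)) ⊕ ∑ (λ k → dilate (fromℕ k) 𝔹) (hooks as) ⊕ constant (fromℕ base) ⊗ 𝕥
          ≈ₛ ∑ (λ k → dilate (fromℕ k) 𝔹) (applyUpTo suc n) ⊕ constant (fromℕ top) ⊗ 𝕥
      -- There is a standard tableau: an empty sum would make the right-hand side 0, although it is
      -- not a zero divisor.
      compare []       eq = contradiction (trans (right-cancellable 1ₛ (begin
        right ⊗ 1ₛ                                     ≈⟨ 𝕊.*-congʳ eq ⟨
        𝟘 ⊗ hookProduct as ⊗ 𝕢 ^ₚ base ⊗ 1ₛ            ≈⟨ solve 2 (λ h b → con (0 , 0) :* h :* b :* con (1 , 0) := con (0 , 0)) 𝕊.refl (hookProduct as) (𝕢 ^ₚ base) ⟩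
        𝟘                                              ∎) 0) (𝟘-at 0)) λ ()
      compare (ω ∷ ωs) eq = 𝕊.sym (logDerivative-unique right-cancellable (𝕊.sym eq)
        (logDerivative-⊗ (logDerivative-∏ factor (λ k → dilate (fromℕ k) 𝔹) (applyUpTo suc n) logDerivative-factor) (logDerivative-𝕢^ top))
        (logDerivative-⊗
          (logDerivative-⊗ (logDerivative-exponentials X ω ωs)
                           (logDerivative-∏ factor (λ k → dilate (fromℕ k) 𝔹) (hooks as) logDerivative-factor))
          (logDerivative-𝕢^ base)))

    -- Each factor 1 - e^(kt) contributes k^d times the coefficient of 𝔹, whence the power sums; the
    -- multiples of t from the powers of q have no coefficient in degree d > 1.
    logDerivatives-at : ∀ d → 1 < d → let powerSum = λ ks → fromℕ (sum (map (ℕ._^ d) ks)) in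
      fromℕ d * logₛ (mgf (SYT μ) X) d + powerSum (hooks as) * 𝔹 d ≡ powerSum (applyUpTo suc n) * 𝔹 d
    logDerivatives-at d 1<d = begin
      fromℕ d * L d + powerSum (hooks as) * 𝔹 d
        ≡⟨ cong (fromℕ d * L d +_) (∑-dilate 𝔹 (hooks as) d) ⟨
      D L d + ∑ B (hooks as) d
        ≡⟨ trans (sym (ℚ.+-identityʳ _)) (cong (D L d + ∑ B (hooks as) d +_) (sym (linear base d 1<d))) ⟩
      D L d + ∑ B (hooks as) d + (constant (fromℕ base) ⊗ 𝕥) d
        ≡⟨ trans (⊕-at (D L ⊕ ∑ B (hooks as)) (constant (fromℕ base) ⊗ 𝕥) d) (cong (_+ (constant (fromℕ base) ⊗ 𝕥) d) (⊕-at (D L) (∑ B (hooks as)) d)) ⟨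
      (D L ⊕ ∑ B (hooks as) ⊕ constant (fromℕ base) ⊗ 𝕥) d
        ≡⟨ logDerivatives d ⟩
      (∑ B (applyUpTo suc n) ⊕ constant (fromℕ top) ⊗ 𝕥) d
        ≡⟨ trans (⊕-at (∑ B (applyUpTo suc n)) (constant (fromℕ top) ⊗ 𝕥) d)
             (trans (cong (∑ B (applyUpTo suc n) d +_) (linear top d 1<d)) (ℚ.+-identityʳ _)) ⟩
      ∑ B (applyUpTo suc n) d
        ≡⟨ ∑-dilate 𝔹 (applyUpTo suc n) d ⟩
      powerSum (applyUpTo suc n) * 𝔹 d ∎
      where
      open ≡-Reasoning
      L = logₛ (mgf (SYT μ) X)
      B : ℕ → Series
      B k = dilate (fromℕ k) 𝔹
      powerSum : List ℕ → ℚ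
      powerSum ks = fromℕ (sum (map (ℕ._^ d) ks))

      linear : ∀ k d → 1 < d → (constant (fromℕ k) ⊗ 𝕥) d ≡ 0ℚ
      linear k (suc (suc d)) _         = trans (constant-⊗ (fromℕ k) 𝕥 (suc (suc d))) (ℚ.*-zeroʳ (fromℕ k))
      linear k (suc zero)    (s≤s ())

  -- Used with k = d, i = 1/d, f = d!, the coefficients L of the logarithm and B of 𝔹, and the power
  -- sums H of the hook lengths and J of 1, ..., n.
  solve-linear : ∀ k i f L H J B → k * i ≡ 1ℚ → k * L + H * B ≡ J * B → f * L ≡ f * B * i * (J - H)
  solve-linear k i f L H J B ki≡1 eq = begin
    f * L                                  ≡⟨ ℚ.*-identityˡ (f * L) ⟨
    1ℚ * (f * L)                           ≡⟨ cong (_* (f * L)) ki≡1 ⟨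
    k * i * (f * L)                        ≡⟨ rearrange₁ k i f L H B ⟩
    f * i * ((k * L + H * B) - H * B)      ≡⟨ cong (λ x → f * i * (x - H * B)) eq ⟩
    f * i * (J * B - H * B)                ≡⟨ rearrange₂ f i J H B ⟩
    f * B * i * (J - H)                    ∎
    where
    open ≡-Reasoning
    open ℚ-Solver
    rearrange₁ : ∀ k i f L H B → k * i * (f * L) ≡ f * i * ((k * L + H * B) - H * B)
    rearrange₁ = solve 6 (λ k i f L H B → k :* i :* (f :* L) := f :* i :* ((k :* L :+ H :* B) :- H :* B)) refl
    rearrange₂ : ∀ f i J H B → f * i * (J * B - H * B) ≡ f * B * i * (J - H)
    rearrange₂ = solve 5 (λ f i J H B → f :* i :* (J :* B :- H :* B) := f :* B :* i :* (J :- H)) refl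

open import Defs
open import Data.List.Base using (List; applyUpTo; map)
open import Data.List.Properties using (map-∘)
open import Data.Nat.Base as ℕ using (ℕ; suc; _<_; _!; >-nonZero)
open import Data.Nat.ListAction using (sum)
open import Data.Nat.Properties using (<⇒≤)
open import Data.Rational.Base using (ℚ; _*_; _-_)
open import Function.Base using (_∘_)
open import Relation.Binary.PropositionalEquality using (_≡_; cong; sym; trans)
open Shapes using (hooks)
open HookLengths using (map-hookLength)
open PowerSeries using (fromℕ-1/ℕ)
open LogDerivatives using (𝔹; logDerivatives-at; solve-linear)

theorem1p5 : ∀ {n : ℕ} (μ : Partition n) (d : ℕ) (1<d : 1 < d) →
    cumulant (SYT μ) (fromℕ ∘ maj μ) d
    ≡ bernoulli d * 1/ℕ d {{>-nonZero (<⇒≤ 1<d)}}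
    * (fromℕ (sum (map (ℕ._^ d) (applyUpTo suc n)))
    - fromℕ (sum (map (λ c → hookLength μ c ℕ.^ d) (cells μ))))
theorem1p5 {n} μ d 1<d = trans
  -- Cumulants and Bernoulli numbers are by definition d! times series coefficients, so `f * L` and
  -- `f * B` are already the terms of the statement.
  (solve-linear (fromℕ d) (1/ℕ d) (fromℕ (d !)) (logₛ (mgf (SYT μ) (fromℕ ∘ maj μ)) d)
    (powerSum (hooks (parts μ))) (powerSum (applyUpTo suc n)) (𝔹 d)
    (fromℕ-1/ℕ d) (logDerivatives-at μ d 1<d))
  (cong (λ hs → bernoulli d * 1/ℕ d * (powerSum (applyUpTo suc n) - fromℕ (sum hs))) hook-powers)
  where
  instance _ = >-nonZero (<⇒≤ 1<d)

  powerSum : List ℕ → ℚ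
  powerSum ks = fromℕ (sum (map (ℕ._^ d) ks))

  hook-powers : map (ℕ._^ d) (hooks (parts μ)) ≡ map (λ c → hookLength μ c ℕ.^ d) (cells μ)
  hook-powers = trans (cong (map (ℕ._^ d)) (sym (map-hookLength μ))) (sym (map-∘ (cells μ)))
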